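{- All digraphs are finite directed graphs, with loops and parallel edges allowed. The Moves (S), (R), (O), (I), (C), (P), the spectra, and the phrases "a move preserves / does not preserve the multiset of nonzero elements of a spectrum" are as defined in the context. \textbf{A. (All finite digraphs.)} \begin{itemize} \item[(i)] Moves (S), (O), and (I) preserve the multiset of nonzero elements of the adjacency spectrum $\operatorname{Spec}_{\mathbf{A}}(D)$, while Moves (R), (C), and (P) do not. \item[(ii)] Moves (S), (O), and (I) preserve the multiset of nonzero elements of the line adjacency spectrum $\operatorname{Spec}_{\mathbf{L}}(D)$, while Moves (R), (C), and (P) do not. \item[(iii)] Move (S) preserves the multiset of nonzero elements of the binary adjacency spectrum $\operatorname{Spec}_{\mathbf{A}_b}(D)$, while Moves (R), (O), (I), (C), and (P) do not. \item[(iv)] Move (C) preserves the multisets of nonzero elements of the skew adjacency spectrum $\operatorname{Spec}_{\mathbf{S}}(D)$, the binary skew adjacency spectrum $\operatorname{Spec}_{\mathbf{S}_b}(D)$, the skew Laplace spectrum $\operatorname{Spec}_{\boldsymbol{\Delta}_S}(D)$, and the binary skew Laplace spectrum $\operatorname{Spec}_{\boldsymbol{\Delta}_{b,S}}(D)$, while, for each of these four spectra, each of the Moves (S), (R), (O), (I), and (P) does not. \item[(v)] For each of the following four spectra: the Laplace spectrum $\operatorname{Spec}_{\boldsymbol{\Delta}}(D)$, the symmetric adjacency spectrum $\operatorname{Spec}^{\mathcal{S}}_{\mathbf{A}}(D)$, the symmetric binary adjacency spectrum $\operatorname{Spec}^{\mathcal{S}}_{\mathbf{A}_b}(D)$, and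 the Hermitian adjacency spectrum $\operatorname{Spec}_{\mathbf{H}}(D)$, none of the Moves (S), (R), (O), (I), (C), (P) preserves the multiset of nonzero elements of that spectrum. \end{itemize} \textbf{B. (Strongly connected digraphs.)} If $D$ is a strongly connected finite digraph, then Moves (S) and (P) cannot be applied to $D$, so that only Moves (R), (O), (I), and (C) can be applied. The claims (i)--(v), restricted to the Moves (R), (O), (I), (C), remain true within the class of strongly connected finite digraphs. Furthermore, for each of the following four spectra, which are defined only for strongly connected digraphs: the normalized Laplace spectrum $\operatorname{Spec}_{\boldsymbol{\Delta}_N}(D)$, the binary normalized Laplace spectrum $\operatorname{Spec}_{\boldsymbol{\Delta}_{b,N}}(D)$, the combinatorial Laplace spectrum $\operatorname{Spec}_{\boldsymbol{\Delta}_C}(D)$, and the binary combinatorial Laplace spectrum $\operatorname{Spec}_{\boldsymbol{\Delta}_{b,C}}(D)$, none of the Moves (R), (O), (I), (C) preserves the multiset of nonzero elements of that spectrum within the class of strongly connected finite digraphs.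
   Context: \textbf{Digraphs.} A digraph $D=(V,E,r,s)$ consists of a set $V$ of vertices, a set $E$ of edges, and maps $s,r:E\to V$ (source and range). It is finite if $V$ and $E$ are finite. Loops ($r(e)=s(e)$) and parallel edges ($e\ne f$ with $s(e)=s(f)$, $r(e)=r(f)$) are allowed. A path of length $n$ is a sequence $(e_1,\dots,e_n)$ of edges with $r(e_i)=s(e_{i+1})$ for $1\le i<n$. A cycle is a nonempty path with $r(e_n)=s(e_1)$; it is vertex-simple if the $r(e_i)$ are pairwise distinct. A vertex-simple cycle $(e_1,\dots,e_n)$ has an exit if there are an $i$ and an edge $f\neq e_i$ with $s(f)=s(e_i)$. A return path is a cycle $(e_1,\dots,e_n)$ with $r(e_n)\ne r(e_i)$ for $1\le i<n$; a vertex $v$ supports it if $r(e_n)=v$. A source is a vertex $v$ with $r^{ -1}(v)=\emptyset$; a sink is a vertex with $s^{ -1}(v)=\emptyset$; a vertex is regular if $s^{ -1}(v)$ is finite and nonempty. $D$ is strongly connected if for each pair of vertices $v,w$ there is a path from $v$ to $w$. The indegree and outdegree are $d^{in}_v=|r^{ -1}(v)|$ and $d^{out}_v=|s^{ -1}(v)|$; the binary indegree and outdegree are $d^{b,in}_v=|s(r^{ -1}(v))|$ and $d^{b,out}_v=|r(s^{ -1}(v))|$. The line digraph $\mathcal{L}(D)$ has vertex set $E$ and edge set $\{(e,f)\in E^2: r(e)=s(f)\}$, where $(e,f)$ has source $e$ and range $f$. \textbf{Matrices} (for fixed orderings of $V$ and $E$; the spectra do not depend on the orderings). For $v,w\in V$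 let $n_{vw}=|s^{ -1}(v)\cap r^{ -1}(w)|$ be the number of edges from $v$ to $w$. \begin{itemize} \item Incidence matrix $\mathbf{M}=(m_{ve})_{v\in V,e\in E}$: $m_{ve}=1$ if $s(e)=v\ne r(e)$, $m_{ve}=-1$ if $r(e)=v\neq s(e)$, and $0$ otherwise. Laplacian $\boldsymbol{\Delta}=\mathbf{M}\mathbf{M}^T$. \item Adjacency matrix $\mathbf{A}=(n_{vw})_{v,w\in V}$. Binary adjacency matrix $\mathbf{A}_b$: $(v,w)$-entry $1$ if $n_{vw}>0$ and $0$ otherwise. \item Line adjacency matrix $\mathbf{L}=(b_{ef})_{e,f\in E}$: $b_{ef}=1$ if $r(e)=s(f)$ and $0$ otherwise (the adjacency matrix of $\mathcal{L}(D)$). \item Hermitian adjacency matrix $\mathbf{H}=(h_{vw})_{v,w\in V}$: $h_{vw}=1$ if $n_{vw}>0$ and $n_{wv}>0$; $h_{vw}=i$ if $n_{vw}>0$ and $n_{wv}=0$; $h_{vw}=-i$ if $n_{vw}=0$ and $n_{wv}>0$; $h_{vw}=0$ otherwise. \item Skew adjacency matrix $\mathbf{S}=\mathbf{A}-\mathbf{A}^T$; binary skew adjacency matrix $\mathbf{S}_b=\mathbf{A}_b-\mathbf{A}_b^T$. \item Skew Laplacian $\boldsymbol{\Delta}_S=\operatorname{diag}(d^{out}_v-d^{in}_v)-\mathbf{S}$; binary skew Laplacian $\boldsymbol{\Delta}_{b,S}=\operatorname{diag}(d^{b,out}_v-d^{b,in}_v)-\mathbf{S}_b$. \item For $D$ strongly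 connected: the transition probability matrix $\mathbf{P}$ has entries $p_{vw}=n_{vw}/d^{out}_v$ if $n_{vw}>0$ and $0$ otherwise. Let $\phi$ be the unique left eigenvector of $\mathbf{P}$ with positive entries summing to $1$ (Perron--Frobenius vector), and let $\boldsymbol{\Phi}$ be the diagonal matrix with the entries of $\phi$ on the diagonal. Normalized Laplacian: $\boldsymbol{\Delta}_N=I-\frac12\big(\boldsymbol{\Phi}^{1/2}\mathbf{P}\boldsymbol{\Phi}^{ -1/2}+\boldsymbol{\Phi}^{ -1/2}\mathbf{P}^T\boldsymbol{\Phi}^{1/2}\big)$. Combinatorial Laplacian: $\boldsymbol{\Delta}_C=\boldsymbol{\Phi}-\frac12\big(\boldsymbol{\Phi}\mathbf{P}+\mathbf{P}^T\boldsymbol{\Phi}\big)$. The binary versions $\boldsymbol{\Delta}_{b,N}$ and $\boldsymbol{\Delta}_{b,C}$ are defined identically with $\mathbf{P}$ replaced throughout (including in the definition of $\phi$) by $\mathbf{P}_b$, whose $(v,w)$-entry is $1/d^{b,out}_v$ if $n_{vw}>0$ and $0$ otherwise. \end{itemize} \textbf{Spectra.} For $X\in\{\boldsymbol{\Delta},\mathbf{A},\mathbf{A}_b,\mathbf{L},\mathbf{H},\mathbf{S},\mathbf{S}_b,\boldsymbol{\Delta}_S,\boldsymbol{\Delta}_{b,S},\boldsymbol{\Delta}_N,\boldsymbol{\Delta}_{b,N},\boldsymbol{\Delta}_C,\boldsymbol{\Delta}_{b,C}\}$, $\operatorname{Spec}_X(D)$ is the multiset of complex eigenvalues of $X(D)$,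 counted with algebraic multiplicity. $\operatorname{Spec}^{\mathcal{S}}_{\mathbf{A}}(D)$ and $\operatorname{Spec}^{\mathcal{S}}_{\mathbf{A}_b}(D)$ are the multisets of eigenvalues of $\mathbf{A}\mathbf{A}^T$ and $\mathbf{A}_b\mathbf{A}_b^T$, respectively. \textbf{Moves}, applied to $D=(V,E,r,s)$: \begin{itemize} \item \emph{Move (S)} (remove a regular source): given a regular vertex $v_s$ that is a source, delete $v_s$ and all edges in $s^{ -1}(v_s)$. \item \emph{Move (R)} (reduce at a regular vertex): given a regular vertex $v_r$ such that $s^{ -1}(v_r)=\{f\}$ and $s(r^{ -1}(v_r))=\{u\}$ are one-point sets, with $u\ne v_r$, delete $v_r$, delete $f$ and all edges of $r^{ -1}(v_r)$, and add for each $e\in r^{ -1}(v_r)$ an edge $ef$ with source $u$ and range $r(f)$. \item \emph{Move (O)} (outsplit at a non-sink): given a vertex $v$ that is not a sink and a partition $\{\mathcal{E}_1,\dots,\mathcal{E}_n\}$ of $s^{ -1}(v)$ (into finitely many nonempty sets), replace $v$ by vertices $v^1,\dots,v^n$ and replace each edge $e\in r^{ -1}(v)$ by edges $e^1,\dots,e^n$. Ranges: $r(e^j)=v^j$ for $e\in r^{ -1}(v)$, and ranges of other edges are unchanged. Sources: an edge $e\in s^{ -1}(v)\setminus r^{ -1}(v)$ with $e\in\mathcal{E}_i$ has new source $v^i$; for $e\in s^{ -1}(v)\cap r^{ -1}(v)$ with $e\in\mathcal{E}_i$, all $e^j$ have source $v^i$; for $e\in r^{ -1}(v)\setminus s^{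 -1}(v)$, all $e^j$ have source $s(e)$; sources of all other edges are unchanged. \item \emph{Move (I)} (insplit at a regular non-source): given a regular vertex $v$ that is not a source and a partition $\{\mathcal{E}_1,\dots,\mathcal{E}_n\}$ of $r^{ -1}(v)$ (into finitely many nonempty sets), replace $v$ by $v^1,\dots,v^n$ and each edge $e\in s^{ -1}(v)$ by edges $e^1,\dots,e^n$. Sources: $s(e^j)=v^j$ for $e\in s^{ -1}(v)$, and sources of other edges are unchanged. Ranges: an edge $e\in r^{ -1}(v)\setminus s^{ -1}(v)$ with $e\in\mathcal{E}_i$ has new range $v^i$; for $e\in r^{ -1}(v)\cap s^{ -1}(v)$ with $e\in\mathcal{E}_i$, all $e^j$ have range $v^i$; for $e\in s^{ -1}(v)\setminus r^{ -1}(v)$, all $e^j$ have range $r(e)$; ranges of all other edges are unchanged. \item \emph{Move (C)} (Cuntz splice): given a regular vertex $v$ that supports at least two distinct return paths, add two new vertices $u_1,u_2$ and six new edges: $e_1$ from $v$ to $u_1$, $e_2$ from $u_1$ to $v$, $f_1$ from $u_1$ to $u_1$, $f_2$ from $u_1$ to $u_2$, $h_1$ from $u_2$ to $u_1$, $h_2$ from $u_2$ to $u_2$. \item \emph{Move (P)} (eclose a cyclic component): let $v$ be a vertex that supports a loop but no other return path, such that the loop has an exit. Let $S=\{w\in V\setminus\{v\}: n_{vw}>0\}$, and suppose every $w\in S$ is a regular vertex supporting at least two return paths. Perform the Cuntz splice of Move (C) at every $w\in S$, denoting the new vertices by $u_1^w,u_2^w$; then for each $w\in S$ and each edge $e\in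 s^{ -1}(v)\cap r^{ -1}(w)$ add two further edges $\bar e_w,\tilde e_w$ from $v$ to $u_2^w$. \end{itemize} \textbf{Preservation.} A move \emph{preserves} the multiset of nonzero elements of a spectrum (within a class of finite digraphs) if for every $D$ in the class and every digraph $D'$ in the class obtained from $D$ by one application of the move (at any admissible choice of data), the multisets of nonzero elements of the spectrum of $D$ and of $D'$ are equal. It \emph{does not preserve} it if there exist such $D$ and $D'$ in the class for which these multisets differ. -}

module Defs where

open import Algebra.Bundles.Raw using (RawRing)
import Algebra.Definitions.RawSemiring as RawSemiringDefs
open import Data.Bool.Base using (Bool; true; false; if_then_else_; _∧_; not)
open import Data.Fin.Base using (Fin; zero; suc; toℕ; punchIn)
open import Data.Fin.Properties using (_≟_; any?)
open import Data.Integer.Base as ℤ using (ℤ; +_)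
open import Data.Irrelevant using ([_])
open import Data.List.Base using (List; []; _∷_; map)
open import Data.Nat.Base as ℕ using (ℕ; zero; suc; _≤_; _⊔_)
import Data.Nat.Properties as ℕₚ
open import Data.Product.Base using (Σ; ∃; ∃₂; _×_; _,_; proj₁; proj₂)
open import Data.Rational.Base as ℚ using (ℚ; 0ℚ; 1ℚ; ½; _/_; ∣_∣)
import Data.Rational.Properties as ℚₚ
open import Data.Refinement.Base
  using (Refinement; Refinement-syntax; _,_; value; proof)
open import Data.Sum.Base using (_⊎_; inj₁; inj₂)
open import Data.Unit.Base using (⊤)
open import Data.Vec.Base as Vec using (Vec; []; _∷_; allFin; count)
open import Data.Vec.Functional using (Vector; transpose)
open import Data.Vec.Relation.Unary.All using (All)
open import Data.Vec.Relation.Unary.Any using (Any)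
open import Data.Vec.Relation.Unary.Linked using (Linked)
open import Function.Base using (const)
open import Function.Bundles using (_⇔_; _↔_; Equivalence; Inverse)
open import Function.Definitions using (StrictlySurjective)
open import Level using (0ℓ)
open import Relation.Binary.PropositionalEquality
  using (_≡_; _≢_; refl; sym; trans; cong; subst; module ≡-Reasoning)
open import Relation.Nullary using (¬_; Dec; yes; no; does)
open import Relation.Nullary.Decidable using (_×-dec_)
open import Relation.Unary using (Pred; Decidable)

Matrix : Set → ℕ → ℕ → Set
Matrix A m n = Vector (Vector A n) m

mapMatrix : {A B : Set} {m n : ℕ} → (A → B) → Matrix A m n → Matrix B m n
mapMatrix f M i j = f (M i j)

module MatrixOps (R : RawRing 0ℓ 0ℓ) where
  open RawRing R
  open RawSemiringDefs rawSemiring using (sum; _^_)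

  infixl 6 _⊞_ _⊟_
  infixl 7 _⊠_ _·_

  _⊞_ _⊟_ : ∀ {m n} → Matrix Carrier m n → Matrix Carrier m n → Matrix Carrier m n
  (M ⊞ N) i j = M i j + N i j
  (M ⊟ N) i j = M i j + - N i j

  _⊠_ : ∀ {l m n} → Matrix Carrier l m → Matrix Carrier m n → Matrix Carrier l n
  (M ⊠ N) i k = sum (λ j → M i j * N j k)

  _·_ : ∀ {m n} → Carrier → Matrix Carrier m n → Matrix Carrier m n
  (c · M) i j = c * M i j

  diag : ∀ {n} → Vector Carrier n → Matrix Carrier n n
  diag d i j = if does (i ≟ j) then d i else 0#

  1ᴹ : ∀ {n} → Matrix Carrier n n
  1ᴹ = diag (const 1#)

  -- Laplace expansion along the first row.
  det : ∀ {n} → Matrix Carrier n n → Carrier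
  det {zero}  M = 1#
  det {suc n} M = sum λ j →
    ((- 1#) ^ toℕ j) * (M zero j * det (λ i k → M (suc i) (punchIn j k)))

module Polynomials (R : RawRing 0ℓ 0ℓ) where
  open RawRing R
    renaming (_+_ to _+ᴿ_; _*_ to _*ᴿ_; -_ to -ᴿ_; 0# to 0ᴿ; 1# to 1ᴿ; _≈_ to _≈ᴿ_)

  -- Coefficients in order of increasing degree; trailing zeros are allowed,
  -- and ≈ₚ disregards them.
  Poly : Set
  Poly = List Carrier

  coeff : Poly → ℕ → Carrier
  coeff []      _       = 0ᴿ
  coeff (a ∷ p) zero    = a
  coeff (a ∷ p) (suc n) = coeff p n

  infix  4 _≈ₚ_
  infixl 6 _+ₚ_
  infixl 7 _*ₚ_

  _≈ₚ_ : Poly → Poly → Set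
  p ≈ₚ q = ∀ n → coeff p n ≈ᴿ coeff q n

  _+ₚ_ _*ₚ_ : Poly → Poly → Poly
  []      +ₚ q       = q
  (a ∷ p) +ₚ []      = a ∷ p
  (a ∷ p) +ₚ (b ∷ q) = (a +ᴿ b) ∷ (p +ₚ q)

  []      *ₚ q = []
  (a ∷ p) *ₚ q = map (a *ᴿ_) q +ₚ (0ᴿ ∷ p *ₚ q)

  constant : Carrier → Poly
  constant a = a ∷ []

  X : Poly
  X = 0ᴿ ∷ 1ᴿ ∷ []

  polyRawRing : RawRing 0ℓ 0ℓ
  polyRawRing = record
    { Carrier = Poly ; _≈_ = _≈ₚ_ ; _+_ = _+ₚ_ ; _*_ = _*ₚ_
    ; -_ = map -ᴿ_ ; 0# = [] ; 1# = constant 1ᴿ }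

-- A real number is a Cauchy sequence of rationals, two sequences being
-- identified by ≈ʳ when their difference tends to 0.

IsCauchy : (ℕ → ℚ) → Set
IsCauchy x = ∀ ε → 0ℚ ℚ.< ε →
  ∃ λ N → ∀ m n → N ≤ m → N ≤ n → ∣ x m ℚ.- x n ∣ ℚ.< ε

private
  halve : ∀ ε → ε ≡ ½ ℚ.* ε ℚ.+ ½ ℚ.* ε
  halve ε = trans (sym (ℚₚ.*-identityˡ ε)) (ℚₚ.*-distribʳ-+ ε ½ ½)

  ½ε>0 : ∀ {ε} → 0ℚ ℚ.< ε → 0ℚ ℚ.< ½ ℚ.* ε
  ½ε>0 {ε} 0<ε = subst (ℚ._< ½ ℚ.* ε) (ℚₚ.*-zeroʳ ½) (ℚₚ.*-monoʳ-<-pos ½ 0<ε)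

  open import Data.Rational.Solver using (module +-*-Solver)
  open +-*-Solver using (solve; _:=_; _:+_; _:*_; _:-_; :-_)

  sum-diff : ∀ a b c d →
    (a ℚ.+ b) ℚ.- (c ℚ.+ d) ≡ (a ℚ.- c) ℚ.+ (b ℚ.- d)
  sum-diff = solve 4 (λ a b c d →
    (a :+ b) :- (c :+ d) := (a :- c) :+ (b :- d)) refl

  neg-diff : ∀ a b → ℚ.- a ℚ.- (ℚ.- b) ≡ ℚ.- (a ℚ.- b)
  neg-diff = solve 2 (λ a b → :- a :- (:- b) := :- (a :- b)) refl

  prod-diff : ∀ a b c d →
    (a ℚ.* b) ℚ.- (c ℚ.* d) ≡ a ℚ.* (b ℚ.- d) ℚ.+ d ℚ.* (a ℚ.- c)
  prod-diff = solve 4 (λ a b c d →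
    (a :* b) :- (c :* d) := a :* (b :- d) :+ d :* (a :- c)) refl

  split-diff : ∀ a b → a ≡ (a ℚ.- b) ℚ.+ b
  split-diff = solve 2 (λ a b → a := (a :- b) :+ b) refl

abstract
  +-cauchy : ∀ x y → IsCauchy x → IsCauchy y → IsCauchy (λ n → x n ℚ.+ y n)
  +-cauchy x y cx cy ε 0<ε with cx (½ ℚ.* ε) (½ε>0 0<ε) | cy (½ ℚ.* ε) (½ε>0 0<ε)
  ... | M , p | N , q = M ⊔ N , λ m n ≤m ≤n → begin-strict
    ∣ (x m ℚ.+ y m) ℚ.- (x n ℚ.+ y n) ∣
      ≡⟨ cong ∣_∣ (sum-diff (x m) (y m) (x n) (y n)) ⟩
    ∣ (x m ℚ.- x n) ℚ.+ (y m ℚ.- y n) ∣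
      ≤⟨ ℚₚ.∣p+q∣≤∣p∣+∣q∣ (x m ℚ.- x n) (y m ℚ.- y n) ⟩
    ∣ x m ℚ.- x n ∣ ℚ.+ ∣ y m ℚ.- y n ∣
      <⟨ ℚₚ.+-mono-< (p m n (ℕₚ.m⊔n≤o⇒m≤o M N ≤m) (ℕₚ.m⊔n≤o⇒m≤o M N ≤n))
                     (q m n (ℕₚ.m⊔n≤o⇒n≤o M N ≤m) (ℕₚ.m⊔n≤o⇒n≤o M N ≤n)) ⟩
    ½ ℚ.* ε ℚ.+ ½ ℚ.* ε
      ≡⟨ sym (halve ε) ⟩
    ε ∎
    where open ℚₚ.≤-Reasoning

  neg-cauchy : ∀ x → IsCauchy x → IsCauchy (λ n → ℚ.- x n)
  neg-cauchy x cx ε 0<ε with cx ε 0<ε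
  ... | N , p = N , λ m n ≤m ≤n → subst (ℚ._< ε)
    (sym (trans (cong ∣_∣ (neg-diff (x m) (x n))) (ℚₚ.∣-p∣≡∣p∣ (x m ℚ.- x n))))
    (p m n ≤m ≤n)

  eventually-bounded : ∀ x → IsCauchy x →
    ∃₂ λ B N → 0ℚ ℚ.< B × (∀ n → N ≤ n → ∣ x n ∣ ℚ.< B)
  eventually-bounded x cx with cx 1ℚ (ℚₚ.positive⁻¹ 1ℚ)
  ... | N , p = 1ℚ ℚ.+ ∣ x N ∣ , N ,
    ℚₚ.<-≤-trans (ℚₚ.positive⁻¹ 1ℚ)
      (subst (ℚ._≤ 1ℚ ℚ.+ ∣ x N ∣) (ℚₚ.+-identityʳ 1ℚ) (ℚₚ.+-monoʳ-≤ 1ℚ (ℚₚ.0≤∣p∣ (x N)))) ,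
    λ n ≤n → begin-strict
      ∣ x n ∣                         ≡⟨ cong ∣_∣ (split-diff (x n) (x N)) ⟩
      ∣ (x n ℚ.- x N) ℚ.+ x N ∣       ≤⟨ ℚₚ.∣p+q∣≤∣p∣+∣q∣ (x n ℚ.- x N) (x N) ⟩
      ∣ x n ℚ.- x N ∣ ℚ.+ ∣ x N ∣     <⟨ ℚₚ.+-monoˡ-< ∣ x N ∣ (p n N ≤n ℕₚ.≤-refl) ⟩
      1ℚ ℚ.+ ∣ x N ∣                  ∎
    where open ℚₚ.≤-Reasoning

  private
    *-bound : ∀ a b {A δ} → 0ℚ ℚ.< δ → ∣ a ∣ ℚ.< A → ∣ b ∣ ℚ.< δ →
      ∣ a ℚ.* b ∣ ℚ.< A ℚ.* δ
    *-bound a b {A} {δ} 0<δ a<A b<δ = begin-strict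
      ∣ a ℚ.* b ∣        ≡⟨ ℚₚ.∣p*q∣≡∣p∣*∣q∣ a b ⟩
      ∣ a ∣ ℚ.* ∣ b ∣    ≤⟨ ℚₚ.*-monoˡ-≤-nonNeg ∣ a ∣ {{ℚₚ.∣-∣-nonNeg a}} (ℚₚ.<⇒≤ b<δ) ⟩
      ∣ a ∣ ℚ.* δ        <⟨ ℚₚ.*-monoˡ-<-pos δ {{ℚ.positive 0<δ}} a<A ⟩
      A ℚ.* δ            ∎
      where open ℚₚ.≤-Reasoning

    *-diff-bound : ∀ a b c d {A B δ ε} → 0ℚ ℚ.< δ → A ℚ.* δ ℚ.+ B ℚ.* δ ≡ ε →
      ∣ a ∣ ℚ.< A → ∣ d ∣ ℚ.< B → ∣ b ℚ.- d ∣ ℚ.< δ → ∣ a ℚ.- c ∣ ℚ.< δ →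
      ∣ (a ℚ.* b) ℚ.- (c ℚ.* d) ∣ ℚ.< ε
    *-diff-bound a b c d {A} {B} {δ} {ε} 0<δ sum≡ε a<A d<B bd<δ ac<δ = begin-strict
      ∣ (a ℚ.* b) ℚ.- (c ℚ.* d) ∣
        ≡⟨ cong ∣_∣ (prod-diff a b c d) ⟩
      ∣ a ℚ.* (b ℚ.- d) ℚ.+ d ℚ.* (a ℚ.- c) ∣
        ≤⟨ ℚₚ.∣p+q∣≤∣p∣+∣q∣ (a ℚ.* (b ℚ.- d)) (d ℚ.* (a ℚ.- c)) ⟩
      ∣ a ℚ.* (b ℚ.- d) ∣ ℚ.+ ∣ d ℚ.* (a ℚ.- c) ∣
        <⟨ ℚₚ.+-mono-< (*-bound a (b ℚ.- d) 0<δ a<A bd<δ) (*-bound d (a ℚ.- c) 0<δ d<B ac<δ) ⟩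
      A ℚ.* δ ℚ.+ B ℚ.* δ
        ≡⟨ sum≡ε ⟩
      ε ∎
      where open ℚₚ.≤-Reasoning

    divide : ∀ C ε → 0ℚ ℚ.< C → 0ℚ ℚ.< ε → ∃ λ δ → 0ℚ ℚ.< δ × C ℚ.* δ ≡ ε
    divide C ε 0<C 0<ε = ε ℚ.* C⁻¹ , 0<δ , (begin
        C ℚ.* (ε ℚ.* C⁻¹)    ≡⟨ ℚₚ.*-comm C (ε ℚ.* C⁻¹) ⟩
        ε ℚ.* C⁻¹ ℚ.* C      ≡⟨ ℚₚ.*-assoc ε C⁻¹ C ⟩
        ε ℚ.* (C⁻¹ ℚ.* C)    ≡⟨ cong (ε ℚ.*_) (ℚₚ.*-inverseˡ C {{C≢0}}) ⟩
        ε ℚ.* 1ℚ             ≡⟨ ℚₚ.*-identityʳ ε ⟩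
        ε                    ∎)
      where
      open ≡-Reasoning
      C-pos : ℚ.Positive C
      C-pos = ℚ.positive 0<C
      C≢0 : ℚ.NonZero C
      C≢0 = ℚₚ.pos⇒nonZero C {{C-pos}}
      C⁻¹ : ℚ
      C⁻¹ = (ℚ.1/ C) {{C≢0}}
      0<δ : 0ℚ ℚ.< ε ℚ.* C⁻¹
      0<δ = subst (ℚ._< ε ℚ.* C⁻¹) (ℚₚ.*-zeroˡ C⁻¹)
        (ℚₚ.*-monoˡ-<-pos C⁻¹ {{ℚₚ.1/pos⇒pos C {{C-pos}}}} 0<ε)

  *-cauchy : ∀ x y → IsCauchy x → IsCauchy y → IsCauchy (λ n → x n ℚ.* y n)
  *-cauchy x y cx cy ε 0<ε = choose-bounds (eventually-bounded x cx) (eventually-bounded y cy)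
    where
    Modulus : Set
    Modulus = ∃ λ N → ∀ m n → N ≤ m → N ≤ n → ∣ (x m ℚ.* y m) ℚ.- (x n ℚ.* y n) ∣ ℚ.< ε

    Bound : (ℕ → ℚ) → ℚ → ℕ → Set
    Bound z B K = ∀ n → K ≤ n → ∣ z n ∣ ℚ.< B

    Close : (ℕ → ℚ) → ℚ → Set
    Close z δ = ∃ λ N → ∀ m n → N ≤ m → N ≤ n → ∣ z m ℚ.- z n ∣ ℚ.< δ

    combine : ∀ {A B δ} K L → Bound x A K → Bound y B L →
      0ℚ ℚ.< δ → A ℚ.* δ ℚ.+ B ℚ.* δ ≡ ε → Close x δ → Close y δ → Modulus
    combine K L x<A y<B 0<δ sum≡ε (M₁ , dx) (M₂ , dy) = N , λ m n ≤m ≤n →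
      *-diff-bound (x m) (y m) (x n) (y n) 0<δ sum≡ε
        (x<A m (K≤ ≤m)) (y<B n (L≤ ≤n))
        (dy m n (M₂≤ ≤m) (M₂≤ ≤n)) (dx m n (M₁≤ ≤m) (M₁≤ ≤n))
      where
      N : ℕ
      N = (K ⊔ L) ⊔ (M₁ ⊔ M₂)
      K≤ : ∀ {i} → N ≤ i → K ≤ i
      K≤ h = ℕₚ.m⊔n≤o⇒m≤o K L (ℕₚ.m⊔n≤o⇒m≤o (K ⊔ L) (M₁ ⊔ M₂) h)
      L≤ : ∀ {i} → N ≤ i → L ≤ i
      L≤ h = ℕₚ.m⊔n≤o⇒n≤o K L (ℕₚ.m⊔n≤o⇒m≤o (K ⊔ L) (M₁ ⊔ M₂) h)
      M₁≤ : ∀ {i} → N ≤ i → M₁ ≤ i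
      M₁≤ h = ℕₚ.m⊔n≤o⇒m≤o M₁ M₂ (ℕₚ.m⊔n≤o⇒n≤o (K ⊔ L) (M₁ ⊔ M₂) h)
      M₂≤ : ∀ {i} → N ≤ i → M₂ ≤ i
      M₂≤ h = ℕₚ.m⊔n≤o⇒n≤o M₁ M₂ (ℕₚ.m⊔n≤o⇒n≤o (K ⊔ L) (M₁ ⊔ M₂) h)

    choose-δ : ∀ {A B} K L → Bound x A K → Bound y B L →
      (∃ λ δ → 0ℚ ℚ.< δ × (A ℚ.+ B) ℚ.* δ ≡ ε) → Modulus
    choose-δ {A} {B} K L x<A y<B (δ , 0<δ , eq) =
      combine K L x<A y<B 0<δ (trans (sym (ℚₚ.*-distribʳ-+ δ A B)) eq) (cx δ 0<δ) (cy δ 0<δ)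

    choose-bounds : (∃₂ λ A K → 0ℚ ℚ.< A × Bound x A K) →
      (∃₂ λ B L → 0ℚ ℚ.< B × Bound y B L) → Modulus
    choose-bounds (A , K , 0<A , x<A) (B , L , 0<B , y<B) =
      choose-δ K L x<A y<B (divide (A ℚ.+ B) ε (ℚₚ.+-mono-< 0<A 0<B) 0<ε)

  const-cauchy : ∀ q → IsCauchy (const q)
  const-cauchy q ε 0<ε = 0 , λ _ _ _ _ →
    subst (ℚ._< ε) (sym (cong ∣_∣ (ℚₚ.+-inverseʳ q))) 0<ε

record ℝ : Set where
  constructor mkℝ
  field
    seq    : ℕ → ℚ
    cauchy : IsCauchy seq
open ℝ public

infix  4 _≈ʳ_
infixl 6 _+ʳ_
infixl 7 _*ʳ_

_≈ʳ_ : ℝ → ℝ → Set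
x ≈ʳ y = ∀ ε → 0ℚ ℚ.< ε → ∃ λ N → ∀ n → N ≤ n → ∣ seq x n ℚ.- seq y n ∣ ℚ.< ε

_+ʳ_ _*ʳ_ : ℝ → ℝ → ℝ
mkℝ x cx +ʳ mkℝ y cy = mkℝ (λ n → x n ℚ.+ y n) (+-cauchy x y cx cy)
mkℝ x cx *ʳ mkℝ y cy = mkℝ (λ n → x n ℚ.* y n) (*-cauchy x y cx cy)

-ʳ_ : ℝ → ℝ
-ʳ mkℝ x cx = mkℝ (λ n → ℚ.- x n) (neg-cauchy x cx)

ℚ⇒ℝ : ℚ → ℝ
ℚ⇒ℝ q = mkℝ (const q) (const-cauchy q)

0ʳ 1ʳ : ℝ
0ʳ = ℚ⇒ℝ 0ℚ
1ʳ = ℚ⇒ℝ 1ℚ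

Positive : ℝ → Set
Positive x = ∃₂ λ ε N → 0ℚ ℚ.< ε × (∀ n → N ≤ n → ε ℚ.< seq x n)

ℝ-rawRing : RawRing 0ℓ 0ℓ
ℝ-rawRing = record
  { Carrier = ℝ ; _≈_ = _≈ʳ_ ; _+_ = _+ʳ_ ; _*_ = _*ʳ_
  ; -_ = -ʳ_ ; 0# = 0ʳ ; 1# = 1ʳ }

record ℂ : Set where
  constructor _+i_
  field
    re im : ℝ
open ℂ public

infix 4 _≈ᶜ_
_≈ᶜ_ : ℂ → ℂ → Set
z ≈ᶜ w = re z ≈ʳ re w × im z ≈ʳ im w

ℝ⇒ℂ : ℝ → ℂ
ℝ⇒ℂ x = x +i 0ʳ

ℤ⇒ℂ : ℤ → ℂ
ℤ⇒ℂ n = ℝ⇒ℂ (ℚ⇒ℝ (n / 1))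

𝕚 : ℂ
𝕚 = 0ʳ +i 1ʳ

ℂ-rawRing : RawRing 0ℓ 0ℓ
ℂ-rawRing = record
  { Carrier = ℂ
  ; _≈_ = _≈ᶜ_
  ; _+_ = λ (a +i b) (c +i d) → (a +ʳ c) +i (b +ʳ d)
  ; _*_ = λ (a +i b) (c +i d) → ((a *ʳ c) +ʳ (-ʳ (b *ʳ d))) +i ((a *ʳ d) +ʳ (b *ʳ c))
  ; -_ = λ (a +i b) → (-ʳ a) +i (-ʳ b)
  ; 0# = ℝ⇒ℂ 0ʳ
  ; 1# = ℝ⇒ℂ 1ʳ
  }

module _ where
  open Polynomials ℂ-rawRing
  open RawRing polyRawRing using (_+_; -_; rawSemiring)
  open RawSemiringDefs rawSemiring using (_∣_; _∤_; _^_)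
  open MatrixOps polyRawRing using (det; _⊟_; diag)

  charPoly : ∀ {n} → Matrix ℂ n n → Poly
  charPoly M = det (diag (const X) ⊟ mapMatrix constant M)

  -- "The algebraic multiplicity of z as an eigenvalue of M is k"; k = 0
  -- means that z is not an eigenvalue.
  AlgMult : ∀ {n} → Matrix ℂ n n → ℂ → ℕ → Set
  AlgMult M z k = (X-z ^ k) ∣ charPoly M × (X-z ^ suc k) ∤ charPoly M
    where
    X-z : Poly
    X-z = X + - constant z

-- A multiset of complex numbers, as the graph of its multiplicity function.
Multiset : Set₁
Multiset = ℂ → ℕ → Set

infix 4 _≋_
_≋_ : Multiset → Multiset → Set
F ≋ G = ∀ z → ¬ (z ≈ᶜ ℝ⇒ℂ 0ʳ) → ∀ k → F z k ⇔ G z k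

record Digraph : Set₁ where
  field
    V E : Set
    s r : E → V

record FiniteDigraph : Set where
  field
    ∣V∣ ∣E∣ : ℕ
    s r     : Fin ∣E∣ → Fin ∣V∣
  V E : Set
  V = Fin ∣V∣
  E = Fin ∣E∣

⟦_⟧ : FiniteDigraph → Digraph
⟦ D ⟧ = record { FiniteDigraph D }

infix 4 _≅_
record _≅_ (G H : Digraph) : Set where
  private
    module G = Digraph G
    module H = Digraph H
  field
    vertices : G.V ↔ H.V
    edges    : G.E ↔ H.E
    source   : ∀ e → H.s (Inverse.to edges e) ≡ Inverse.to vertices (G.s e)
    range    : ∀ e → H.r (Inverse.to edges e) ≡ Inverse.to vertices (G.r e)

♯ : ∀ {n} {P : Pred (Fin n) 0ℓ} → Decidable P → ℕ
♯ P? = count P? (allFin _)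

module DigraphNotions (D : FiniteDigraph) where
  open FiniteDigraph D

  IsPath : ∀ {n} → Vec E n → Set
  IsPath = Linked (λ e f → r e ≡ s f)

  IsCycle : ∀ {n} → Vec E (suc n) → Set
  IsCycle p = IsPath p × r (Vec.last p) ≡ s (Vec.head p)

  HasExit : ∀ {n} → Vec E n → Set
  HasExit p = Any (λ e → ∃ λ f → f ≢ e × s f ≡ s e) p

  NonemptyPath : Set
  NonemptyPath = ∃ λ n → Vec E (suc n)

  IsReturnPathAt : V → NonemptyPath → Set
  IsReturnPathAt v (n , p) =
    IsCycle p × All (λ e → r (Vec.last p) ≢ r e) (Vec.init p) × r (Vec.last p) ≡ v

  TwoReturnPaths : V → Set
  TwoReturnPaths v =
    ∃₂ λ p q → IsReturnPathAt v p × IsReturnPathAt v q × p ≢ q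

  IsSource IsSink Regular : V → Set
  IsSource v = ∀ e → r e ≢ v
  IsSink   v = ∀ e → s e ≢ v
  -- s⁻¹(v) is automatically finite.
  Regular  v = ∃ λ e → s e ≡ v

  -- The empty path joins v to v.
  StronglyConnected : Set
  StronglyConnected = ∀ v w → v ≡ w ⊎
    (∃₂ λ n (p : Vec E (suc n)) → IsPath p × s (Vec.head p) ≡ v × r (Vec.last p) ≡ w)

  n[_,_] : V → V → ℕ
  n[ v , w ] = ♯ (λ e → (s e ≟ v) ×-dec (r e ≟ w))

  -- n[ v , w ] > 0
  Adjacent : V → V → Set
  Adjacent v w = ∃ λ e → s e ≡ v × r e ≡ w

  adjacent? : ∀ v w → Dec (Adjacent v w)
  adjacent? v w = any? (λ e → (s e ≟ v) ×-dec (r e ≟ w))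

  outdeg indeg binaryOutdeg binaryIndeg : V → ℕ
  outdeg       v = ♯ (λ e → s e ≟ v)
  indeg        v = ♯ (λ e → r e ≟ v)
  binaryOutdeg v = ♯ (λ w → adjacent? v w)
  binaryIndeg  v = ♯ (λ w → adjacent? w v)

open DigraphNotions public using (StronglyConnected)

-- For each move, a record of the admissible data, whose result is the digraph
-- obtained from such data, on vertex and edge types built from V and E.
-- Refinement has proof-irrelevant membership, so these types are finite.

record SourceRemoval (D : FiniteDigraph) : Set where
  open FiniteDigraph D
  open DigraphNotions D
  field
    v       : V
    regular : Regular v
    source  : IsSource v

  result : Digraph
  result = record
    { V = [ w ∈ V ∣ w ≢ v ]
    ; E = [ e ∈ E ∣ s e ≢ v ]
    ; s = λ (e , p) → s e , p
    ; r = λ (e , p) → r e , [ source e ]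
    }

record Reduction (D : FiniteDigraph) : Set where
  open FiniteDigraph D
  open DigraphNotions D
  field
    v       : V
    regular : Regular v
    f       : E
    s⁻¹v    : ∀ e → s e ≡ v ⇔ e ≡ f
    u       : V
    sr⁻¹v   : ∀ w → (∃ λ e → r e ≡ v × s e ≡ w) ⇔ w ≡ u
    u≢v     : u ≢ v

  private
    rf≢v : r f ≢ v
    rf≢v rf≡v = u≢v (trans
      (sym (Equivalence.to (sr⁻¹v (s f)) (f , rf≡v , refl)))
      (Equivalence.from (s⁻¹v f) refl))

  V′ E′ : Set
  V′ = [ w ∈ V ∣ w ≢ v ]
  E′ = [ e ∈ E ∣ e ≢ f × r e ≢ v ] ⊎ [ e ∈ E ∣ r e ≡ v ]

  s′ r′ : E′ → V′
  s′ (inj₁ (e , [ p ])) = s e , [ (λ q → proj₁ p (Equivalence.to (s⁻¹v e) q)) ]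
  s′ (inj₂ _)           = u , [ u≢v ]
  r′ (inj₁ (e , [ p ])) = r e , [ proj₂ p ]
  r′ (inj₂ _)           = r f , [ rf≢v ]

  result : Digraph
  result = record { V = V′ ; E = E′ ; s = s′ ; r = r′ }

-- The partition is given by the map sending each edge to the index
-- of its block.
record Outsplit (D : FiniteDigraph) : Set where
  open FiniteDigraph D
  open DigraphNotions D
  field
    v        : V
    nonSink  : ¬ IsSink v
    blocks   : ℕ
    block    : [ e ∈ E ∣ s e ≡ v ] → Fin blocks
    nonempty : StrictlySurjective _≡_ block

  V′ E′ : Set
  V′ = [ w ∈ V ∣ w ≢ v ] ⊎ Fin blocks
  E′ = [ e ∈ E ∣ r e ≢ v ] ⊎ ([ e ∈ E ∣ r e ≡ v ] × Fin blocks)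

  original : E′ → E
  original (inj₁ e)       = value e
  original (inj₂ (e , _)) = value e

  splitSource : (e : E) → Dec (s e ≡ v) → V′
  splitSource e (yes p) = inj₂ (block (e , [ p ]))
  splitSource e (no  p) = inj₁ (s e , [ p ])

  s′ r′ : E′ → V′
  s′ e                  = splitSource (original e) (s (original e) ≟ v)
  r′ (inj₁ (e , p))     = inj₁ (r e , p)
  r′ (inj₂ (_ , j))     = inj₂ j

  result : Digraph
  result = record { V = V′ ; E = E′ ; s = s′ ; r = r′ }

record Insplit (D : FiniteDigraph) : Set where
  open FiniteDigraph D
  open DigraphNotions D
  field
    v         : V
    regular   : Regular v
    nonSource : ¬ IsSource v
    blocks    : ℕ
    block     : [ e ∈ E ∣ r e ≡ v ] → Fin blocks
    nonempty  : StrictlySurjective _≡_ block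

  V′ E′ : Set
  V′ = [ w ∈ V ∣ w ≢ v ] ⊎ Fin blocks
  E′ = [ e ∈ E ∣ s e ≢ v ] ⊎ ([ e ∈ E ∣ s e ≡ v ] × Fin blocks)

  original : E′ → E
  original (inj₁ e)       = value e
  original (inj₂ (e , _)) = value e

  splitRange : (e : E) → Dec (r e ≡ v) → V′
  splitRange e (yes p) = inj₂ (block (e , [ p ]))
  splitRange e (no  p) = inj₁ (r e , [ p ])

  s′ r′ : E′ → V′
  s′ (inj₁ (e , p))     = inj₁ (s e , p)
  s′ (inj₂ (_ , j))     = inj₂ j
  r′ e                  = splitRange (original e) (r (original e) ≟ v)

  result : Digraph
  result = record { V = V′ ; E = E′ ; s = s′ ; r = r′ }

data SpliceVertex : Set where
  u₁ u₂ : SpliceVertex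

data SpliceEdge : Set where
  e₁ e₂ f₁ f₂ h₁ h₂ : SpliceEdge

-- Cuntz splices performed simultaneously at the vertices ι w, for w in W.
module Splice (D : FiniteDigraph) (W : Set) (ι : W → FiniteDigraph.V D) where
  open FiniteDigraph D

  V′ E′ : Set
  V′ = V ⊎ (W × SpliceVertex)
  E′ = E ⊎ (W × SpliceEdge)

  s′ r′ : E′ → V′
  s′ (inj₁ e)        = inj₁ (s e)
  s′ (inj₂ (w , e₁)) = inj₁ (ι w)
  s′ (inj₂ (w , e₂)) = inj₂ (w , u₁)
  s′ (inj₂ (w , f₁)) = inj₂ (w , u₁)
  s′ (inj₂ (w , f₂)) = inj₂ (w , u₁)
  s′ (inj₂ (w , h₁)) = inj₂ (w , u₂)
  s′ (inj₂ (w , h₂)) = inj₂ (w , u₂)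
  r′ (inj₁ e)        = inj₁ (r e)
  r′ (inj₂ (w , e₁)) = inj₂ (w , u₁)
  r′ (inj₂ (w , e₂)) = inj₁ (ι w)
  r′ (inj₂ (w , f₁)) = inj₂ (w , u₁)
  r′ (inj₂ (w , f₂)) = inj₂ (w , u₂)
  r′ (inj₂ (w , h₁)) = inj₂ (w , u₁)
  r′ (inj₂ (w , h₂)) = inj₂ (w , u₂)

record CuntzSplice (D : FiniteDigraph) : Set where
  open FiniteDigraph D
  open DigraphNotions D
  field
    v           : V
    regular     : Regular v
    returnPaths : TwoReturnPaths v

  open Splice D ⊤ (const v) public

  result : Digraph
  result = record { V = V′ ; E = E′ ; s = s′ ; r = r′ }

record Eclosing (D : FiniteDigraph) : Set where
  open FiniteDigraph D
  open DigraphNotions D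
  field
    v        : V
    loop     : E
    isReturn : IsReturnPathAt v (0 , loop ∷ [])
    only     : ∀ p → IsReturnPathAt v p → p ≡ (0 , loop ∷ [])
    exit     : HasExit (loop ∷ [])

  S : Set
  S = [ w ∈ V ∣ w ≢ v × Adjacent v w ]

  field
    S-regular     : ∀ (w : S) → Regular (value w)
    S-returnPaths : ∀ (w : S) → TwoReturnPaths (value w)

  open Splice D S value public using (V′) renaming (E′ to E₀; s′ to s₀; r′ to r₀)

  -- The edges ē and ẽ, for each edge e from v to an element of S.
  data Copy : Set where
    bar tilde : Copy

  E′ : Set
  E′ = E₀ ⊎ ([ e ∈ E ∣ s e ≡ v × r e ≢ v ] × Copy)

  s′ r′ : E′ → V′
  s′ (inj₁ e) = s₀ e
  s′ (inj₂ _) = inj₁ v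
  r′ (inj₁ e) = r₀ e
  r′ (inj₂ ((e , [ p ]) , _)) =
    inj₂ ((r e , [ (proj₂ p , (e , proj₁ p , refl)) ]) , u₂)

  result : Digraph
  result = record { V = V′ ; E = E′ ; s = s′ ; r = r′ }

data Move : Set where
  S R O I C P : Move

Admissible : Move → FiniteDigraph → Set
Admissible S = SourceRemoval
Admissible R = Reduction
Admissible O = Outsplit
Admissible I = Insplit
Admissible C = CuntzSplice
Admissible P = Eclosing

result : ∀ μ {D} → Admissible μ D → Digraph
result S = SourceRemoval.result
result R = Reduction.result
result O = Outsplit.result
result I = Insplit.result
result C = CuntzSplice.result
result P = Eclosing.result

infix 4 _⟶[_]_
_⟶[_]_ : FiniteDigraph → Move → FiniteDigraph → Set
D ⟶[ μ ] D′ = Σ (Admissible μ D) λ a → result μ a ≅ ⟦ D′ ⟧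

module DigraphMatrices (D : FiniteDigraph) where
  open FiniteDigraph D
  open DigraphNotions D

  module _ where
    open MatrixOps ℤ.+-*-rawRing

    incidence : Matrix ℤ ∣V∣ ∣E∣
    incidence v e =
      if does (s e ≟ v) ∧ not (does (r e ≟ v)) then ℤ.1ℤ else
      if does (r e ≟ v) ∧ not (does (s e ≟ v)) then ℤ.-1ℤ else ℤ.0ℤ

    laplacian : Matrix ℤ ∣V∣ ∣V∣
    laplacian = incidence ⊠ transpose incidence

    adjacency binaryAdjacency : Matrix ℤ ∣V∣ ∣V∣
    adjacency       v w = + n[ v , w ]
    binaryAdjacency v w = if does (adjacent? v w) then ℤ.1ℤ else ℤ.0ℤ

    symAdjacency symBinaryAdjacency : Matrix ℤ ∣V∣ ∣V∣
    symAdjacency       = adjacency ⊠ transpose adjacency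
    symBinaryAdjacency = binaryAdjacency ⊠ transpose binaryAdjacency

    lineAdjacency : Matrix ℤ ∣E∣ ∣E∣
    lineAdjacency e f = if does (r e ≟ s f) then ℤ.1ℤ else ℤ.0ℤ

    skew binarySkew : Matrix ℤ ∣V∣ ∣V∣
    skew       = adjacency ⊟ transpose adjacency
    binarySkew = binaryAdjacency ⊟ transpose binaryAdjacency

    skewLaplacian binarySkewLaplacian : Matrix ℤ ∣V∣ ∣V∣
    skewLaplacian =
      diag (λ v → + outdeg v ℤ.- + indeg v) ⊟ skew
    binarySkewLaplacian =
      diag (λ v → + binaryOutdeg v ℤ.- + binaryIndeg v) ⊟ binarySkew

  hermitian : Matrix ℂ ∣V∣ ∣V∣
  hermitian v w = entry (does (adjacent? v w)) (does (adjacent? w v))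
    where
    open RawRing ℂ-rawRing
    entry : Bool → Bool → ℂ
    entry true  true  = 1#
    entry true  false = 𝕚
    entry false true  = - 𝕚
    entry false false = 0#

  -- The value at d = 0 is used only when n = 0.
  ratio : ℕ → ℕ → ℝ
  ratio n zero    = 0ʳ
  ratio n (suc d) = ℚ⇒ℝ (+ n / suc d)

  transition binaryTransition : Matrix ℝ ∣V∣ ∣V∣
  transition       v w = ratio n[ v , w ] (outdeg v)
  binaryTransition v w =
    if does (adjacent? v w) then ratio 1 (binaryOutdeg v) else 0ʳ

module _ where
  open RawRing ℝ-rawRing using (_≈_; _*_; 1#; rawSemiring)
  open RawSemiringDefs rawSemiring using (sum)
  open MatrixOps ℝ-rawRing

  IsPerronVector : ∀ {n} → Matrix ℝ n n → Vector ℝ n → Set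
  IsPerronVector T φ =
    (∀ v → Positive (φ v)) ×
    sum φ ≈ 1# ×
    (∃ λ ρ → ∀ w → sum (λ v → φ v * T v w) ≈ ρ * φ w)

  -- σ = φ^{1/2} and τ = φ^{-1/2}
  IsRoots : ∀ {n} → (φ σ τ : Vector ℝ n) → Set
  IsRoots φ σ τ = ∀ v → Positive (σ v) × σ v * σ v ≈ φ v × σ v * τ v ≈ 1#

  ½ʳ : ℝ
  ½ʳ = ℚ⇒ℝ ½

  normalizedLaplacian : ∀ {n} → Matrix ℝ n n → (σ τ : Vector ℝ n) → Matrix ℝ n n
  normalizedLaplacian T σ τ =
    1ᴹ ⊟ ½ʳ · (diag σ ⊠ T ⊠ diag τ ⊞ diag τ ⊠ transpose T ⊠ diag σ)

  combinatorialLaplacian : ∀ {n} → Matrix ℝ n n → (φ : Vector ℝ n) → Matrix ℝ n n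
  combinatorialLaplacian T φ =
    diag φ ⊟ ½ʳ · (diag φ ⊠ T ⊞ transpose T ⊠ diag φ)

Spectrum : Set₁
Spectrum = FiniteDigraph → Multiset

specℤ : ∀ {n} → Matrix ℤ n n → Multiset
specℤ M = AlgMult (mapMatrix ℤ⇒ℂ M)

specℝ : ∀ {n} → Matrix ℝ n n → Multiset
specℝ M = AlgMult (mapMatrix ℝ⇒ℂ M)

-- The vectors φ, φ^{1/2}, φ^{-1/2} are unique when they exist, so these
-- existentials are definite descriptions.
specNormalized specCombinatorial : ∀ {n} → Matrix ℝ n n → Multiset
specNormalized T z k = ∃ λ φ → IsPerronVector T φ ×
  (∃₂ λ σ τ → IsRoots φ σ τ × specℝ (normalizedLaplacian T σ τ) z k)
specCombinatorial T z k = ∃ λ φ → IsPerronVector T φ ×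
  specℝ (combinatorialLaplacian T φ) z k

open DigraphMatrices

Spec-Δ Spec-A Spec-Ab Spec-L Spec-H Spec-S Spec-Sb Spec-ΔS Spec-ΔbS : Spectrum
Spec-Δ   D = specℤ (laplacian D)
Spec-A   D = specℤ (adjacency D)
Spec-Ab  D = specℤ (binaryAdjacency D)
Spec-L   D = specℤ (lineAdjacency D)
Spec-H   D = AlgMult (hermitian D)
Spec-S   D = specℤ (skew D)
Spec-Sb  D = specℤ (binarySkew D)
Spec-ΔS  D = specℤ (skewLaplacian D)
Spec-ΔbS D = specℤ (binarySkewLaplacian D)

SymSpec-A SymSpec-Ab : Spectrum
SymSpec-A  D = specℤ (symAdjacency D)
SymSpec-Ab D = specℤ (symBinaryAdjacency D)

-- Meaningful for strongly connected digraphs only.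
Spec-ΔN Spec-ΔbN Spec-ΔC Spec-ΔbC : Spectrum
Spec-ΔN  D = specNormalized (transition D)
Spec-ΔbN D = specNormalized (binaryTransition D)
Spec-ΔC  D = specCombinatorial (transition D)
Spec-ΔbC D = specCombinatorial (binaryTransition D)

AllDigraphs : FiniteDigraph → Set
AllDigraphs _ = ⊤

Preserves DoesNotPreserve : (FiniteDigraph → Set) → Spectrum → Move → Set
Preserves 𝒞 X μ =
  ∀ D D′ → 𝒞 D → 𝒞 D′ → D ⟶[ μ ] D′ → X D ≋ X D′
DoesNotPreserve 𝒞 X μ =
  ∃₂ λ D D′ → 𝒞 D × 𝒞 D′ × D ⟶[ μ ] D′ × ¬ (X D ≋ X D′)

{-# OPTIONS --safe #-}

-- For the source and range incidence matrices B and C of a digraph, A = BC and L = CB; and since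
-- x^n det(x - RS) = x^m det(x - SR), the matrices RS and SR have the same nonzero spectrum.  All
-- preservation claims come from such factorizations: for (S), (O), (I) the line adjacency matrices
-- of D and D′ factor through the map from edges of D′ to the edges of D they come from, and under (C)
-- the skew adjacency matrix is merely bordered by zeros, because the six new edges are symmetric; the
-- diagonal of a skew Laplacian consists of the row sums of the skew adjacency matrix.
--
-- In ℂ as given here, z ≉ 0 does not directly make z invertible.  But if z is a root of a nonzero
-- integer polynomial, then zⁿ(c + zg) ≈ 0 for an integer c ≢ 0, so that a power of -zg/c is an
-- idempotent; ℂ has no idempotents but 0 and 1, and these mean z ≈ 0 or z invertible.
--
-- A move changes a spectrum as soon as some nonzero z is an eigenvalue of exactly one of D and D′.
-- There are small examples in which z is a Gaussian integer, or a rational for the spectra of a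
-- transition matrix P, so that det(z - M) can be evaluated exactly.  For the latter, the Perron vector φ
-- is pinned down by inverting 1 - P + J (J all ones), and conjugation by Φ^{1/2} replaces the normalized
-- Laplacian by the rational matrix 1 - ½(P + Φ⁻¹PᵀΦ).  The digraph on the other side is chosen so that
-- the entries of φ are squares of rationals.

module Submission where

open import Defs
open import Algebra.Bundles using (CommutativeRing)
open import Algebra.Bundles.Raw using (RawRing)
import Algebra.Definitions.RawMagma as RawMagmaDefs
import Algebra.Definitions.RawSemiring as RawSemiringDefs
import Algebra.Properties.CommutativeSemiring.Exp as ExpProperties
import Algebra.Properties.Ring as RingProperties
import Algebra.Properties.Semiring.Sum as SumProperties
import Algebra.Solver.Ring.NaturalCoefficients.Default as SemiringSolver
open import Data.Bool.Base using (Bool; true; false; if_then_else_; not)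
open import Data.Empty using (⊥; ⊥-elim; ⊥-elim-irr)
open import Data.Fin.Base using (Fin; zero; suc; toℕ; inject₁; punchIn; punchOut; splitAt; _↑ˡ_; _↑ʳ_)
open import Data.Fin.Patterns using (0F; 1F; 2F; 3F; 4F; 5F; 6F; 7F)
open import Data.Fin.Permutation using (Permutation)
import Data.Fin.Properties as Finₚ
open import Data.Fin.Properties using (_≟_; any?; all?; punchInᵢ≢i; punchIn-punchOut)
open import Data.Integer.Base as ℤ using (ℤ; +_)
import Data.Integer.Properties as ℤₚ
open import Data.Integer.Solver using () renaming (module +-*-Solver to ℤSolver)
open import Data.Irrelevant using (Irrelevant; [_])
open import Data.List.Base using (List; []; _∷_; map)
open import Data.List.Relation.Unary.All using (All; []; _∷_)
open import Data.Nat.Base as ℕ using (ℕ; zero; suc; _≤_; _⊔_)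
import Data.Nat.Properties as ℕₚ
open import Data.Product.Base using (∃; ∃₂; _×_; _,_; proj₁; proj₂)
open import Data.Product.Function.NonDependent.Propositional using (_×-↔_)
open import Data.Product.Properties using (≡-dec)
open import Data.Rational.Base as ℚ using (ℚ; 0ℚ; 1ℚ; ½; ∣_∣; toℚᵘ)
import Data.Rational.Properties as ℚₚ
open import Data.Rational.Solver using (module +-*-Solver)
open import Data.Rational.Unnormalised.Base as ℚᵘ using (mkℚᵘ; *≡*; _≃_)
import Data.Rational.Unnormalised.Properties as ℚᵘₚ
open import Data.Refinement.Base using (Refinement; _,_; value)
open import Data.Sum.Base using (_⊎_; inj₁; inj₂)
open import Data.Sum.Function.Propositional using (_⊎-↔_)
open import Data.Unit.Base using (⊤; tt)
open import Data.Vec.Base as Vec using (Vec; []; _∷_)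
open import Data.Vec.Functional using (Vector; transpose)
open import Data.Vec.Properties using (lookup∘tabulate)
open import Data.Vec.Relation.Unary.All as VecAll using ([]; _∷_)
open import Data.Vec.Relation.Unary.Any using (here)
open import Data.Vec.Relation.Unary.Linked using ([-]; _∷_)
open import Function.Base using (_∘_; const; id)
open import Function.Bundles using (_⇔_; _↔_; Equivalence; Injection; Inverse; mk⇔; mk↔ₛ′)
open import Function.Properties.Inverse using (↔-refl; ↔-trans; ↔-sym; ↔⇒↣)
open import Level using (0ℓ)
open import Relation.Binary.Bundles using (Setoid)
open import Relation.Binary.Definitions using (tri<; tri≈; tri>)
open import Relation.Binary.PropositionalEquality as ≡ using (_≡_; _≢_)
open import Relation.Nullary using (¬_; Dec; yes; no; does; contradiction)
open import Relation.Nullary.Decidable as Dec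
  using (_×-dec_; _⊎-dec_; _→-dec_; ¬?; does-⇔; recompute; dec-true; dec-false;
    True; False; toWitness; toWitnessFalse; from-yes; from-no)

-- Determinants over a commutative ring

-- Multiplicities are defined by divisibility of polynomials over Cauchy reals, where equality is
-- undecidable. This shapes both halves of the proof. To cancel powers of `X` from `X^a p = X^b q`
-- while keeping track of divisors `(X - z)^k`, the polynomials `X` and `X - z` have to be
-- comaximal, that is, z has to be invertible. Invertibility is therefore only asked for when
-- `X - z` divides `p` or `q`, and z is then a root of a monic integer polynomial. To separate two
-- spectra, only multiplicity 0 is compared: a nonzero exact determinant proves it, a zero one
-- refutes it. For transition matrices the spectrum is an existential over φ and its square roots.
-- Refuting multiplicity 0 must cover every choice, hence uniqueness of φ and a matrix free of the
-- roots; proving it takes one explicit choice, which stays rational if φ consists of squares. The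
-- determinant is the expansion along the first row, so Sylvester's identity is derived from
-- linearity in a column and vanishing for equal columns.

module Determinants (R : CommutativeRing 0ℓ 0ℓ) where
  open CommutativeRing R hiding (zero; _-_)
  open MatrixOps rawRing
  open RawSemiringDefs (RawRing.rawSemiring rawRing) using (_^_)
  open SumProperties semiring
    using (sum; sum-cong-≋; sum-replicate-zero; ∑-distrib-+; *-distribˡ-sum)
  open RingProperties ring using (-‿distribˡ-*; -‿distribʳ-*; -1*x≈-x)
  open import Relation.Binary.Reasoning.Setoid setoid
  open import Algebra.Properties.CommutativeSemigroup *-commutativeSemigroup
    using () renaming (x∙yz≈y∙xz to *-leftComm)

  sum-zero : ∀ {n} (f : Vector Carrier n) → (∀ i → f i ≈ 0#) → sum f ≈ 0#
  sum-zero {n} f f≈0 = trans (sum-cong-≋ f≈0) (sum-replicate-zero n)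

  sum-single : ∀ {n} (f : Vector Carrier n) k → (∀ i → i ≢ k → f i ≈ 0#) → sum f ≈ f k
  sum-single f zero    h =
    trans (+-congˡ (sum-zero (f ∘ suc) (λ i → h (suc i) (λ ())))) (+-identityʳ _)
  sum-single f (suc k) h = trans
    (+-cong (h zero (λ ())) (sum-single (f ∘ suc) k (λ i i≢k → h (suc i) (i≢k ∘ Finₚ.suc-injective))))
    (+-identityˡ _)

  sum-↑ : ∀ m {n} (f : Vector Carrier (m ℕ.+ n)) →
    sum f ≈ sum (λ i → f (i ↑ˡ n)) + sum (λ i → f (m ↑ʳ i))
  sum-↑ zero    f = sym (+-identityˡ _)
  sum-↑ (suc m) f = trans (+-congˡ (sum-↑ m (f ∘ suc))) (sym (+-assoc _ _ _))

  sum-linear : ∀ {n} c (f g : Vector Carrier n) → sum (λ i → c * f i + g i) ≈ c * sum f + sum g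
  sum-linear c f g = trans (∑-distrib-+ (λ i → c * f i) g) (+-congʳ (sym (*-distribˡ-sum c f)))

  diag-same : ∀ {n} (d : Vector Carrier n) i → diag d i i ≈ d i
  diag-same d i rewrite dec-true (i ≟ i) ≡.refl = refl

  diag-diff : ∀ {n} (d : Vector Carrier n) i j → i ≢ j → diag d i j ≈ 0#
  diag-diff d i j i≢j rewrite dec-false (i ≟ j) i≢j = refl

  diag-const : ∀ {n} x (i j : Fin n) → diag (const x) i j ≈ x * 1ᴹ i j
  diag-const x i j with i ≟ j
  ... | yes _ = sym (*-identityʳ x)
  ... | no  _ = sym (zeroʳ x)

  sum-diagˡ : ∀ {n} (d : Vector Carrier n) i (f : Vector Carrier n) →
    sum (λ j → diag d i j * f j) ≈ d i * f i
  sum-diagˡ d i f = trans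
    (sum-single _ i λ j j≢i → trans (*-congʳ (diag-diff d i j (j≢i ∘ ≡.sym))) (zeroˡ _))
    (*-congʳ (diag-same d i))

  sum-diagʳ : ∀ {n} (d : Vector Carrier n) i (f : Vector Carrier n) →
    sum (λ j → f j * diag d j i) ≈ f i * d i
  sum-diagʳ d i f = trans
    (sum-single _ i λ j j≢i → trans (*-congˡ (diag-diff d j i j≢i)) (zeroʳ _))
    (*-congˡ (diag-same d i))

  minor : ∀ {n} → Matrix Carrier (suc n) (suc n) → Fin (suc n) → Matrix Carrier n n
  minor M j i k = M (suc i) (punchIn j k)

  summand : ∀ {n} → Matrix Carrier (suc n) (suc n) → Vector Carrier (suc n)
  summand M j = ((- 1#) ^ toℕ j) * (M zero j * det (minor M j))

  det-cong : ∀ {n} {M N : Matrix Carrier n n} → (∀ i j → M i j ≈ N i j) → det M ≈ det N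
  det-cong {zero}  M≈N = refl
  det-cong {suc n} M≈N = sum-cong-≋ λ j →
    *-congˡ {(- 1#) ^ toℕ j} (*-cong (M≈N zero j) (det-cong λ i k → M≈N (suc i) (punchIn j k)))

  private
    -- s (m d) is a summand of the Laplace expansion.
    entry-linear : ∀ s c a b d → s * ((c * a + b) * d) ≈ c * (s * (a * d)) + s * (b * d)
    entry-linear s c a b d = begin
      s * ((c * a + b) * d)              ≈⟨ *-congˡ (distribʳ d (c * a) b) ⟩
      s * (c * a * d + b * d)            ≈⟨ distribˡ s _ _ ⟩
      s * (c * a * d) + s * (b * d)      ≈⟨ +-congʳ (*-congˡ (*-assoc c a d)) ⟩
      s * (c * (a * d)) + s * (b * d)    ≈⟨ +-congʳ (*-leftComm s c _) ⟩
      c * (s * (a * d)) + s * (b * d)    ∎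

    minor-linear : ∀ s c a d e → s * (a * (c * d + e)) ≈ c * (s * (a * d)) + s * (a * e)
    minor-linear s c a d e = begin
      s * (a * (c * d + e))              ≈⟨ *-congˡ (*-comm a _) ⟩
      s * ((c * d + e) * a)              ≈⟨ entry-linear s c d e a ⟩
      c * (s * (d * a)) + s * (e * a)    ≈⟨ +-cong (*-congˡ (*-congˡ (*-comm d a))) (*-congˡ (*-comm e a)) ⟩
      c * (s * (a * d)) + s * (a * e)    ∎

  AgreeOff : ∀ {m n} → Fin n → (M N : Matrix Carrier m n) → Set
  AgreeOff k M N = ∀ i j → j ≢ k → M i j ≈ N i j

  -- In the expansion along the first row, the summand of `k` is linear through its entry, as its
  -- minor does not meet column `k`. Every other summand is linear through its minor, by induction;
  -- there column `k` sits at `punchOut j≢k`. The form `c * A + B` covers additivity and scaling at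
  -- once.
  det-linear : ∀ {n} (M A B : Matrix Carrier n n) c k →
    AgreeOff k M A → AgreeOff k M B → (∀ i → M i k ≈ c * A i k + B i k) →
    det M ≈ c * det A + det B
  det-linear {suc n} M A B c k M~A M~B Mk =
    trans (sum-cong-≋ term) (sum-linear c (summand A) (summand B))
    where
    term : ∀ j → summand M j ≈ c * summand A j + summand B j
    term j with j ≟ k
    ... | yes ≡.refl = trans
      (*-congˡ (*-congʳ (Mk zero)))
      (trans (entry-linear _ c _ _ _)
        (+-cong (*-congˡ (*-congˡ (*-congˡ (same A M~A)))) (*-congˡ (*-congˡ (same B M~B)))))
      where
      same : ∀ N → AgreeOff k M N → det (minor M k) ≈ det (minor N k)
      same N M~N = det-cong λ i l → M~N (suc i) (punchIn k l) (punchInᵢ≢i k l)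
    ... | no j≢k = trans
      (*-congˡ (*-congˡ (det-linear (minor M j) (minor A j) (minor B j) c k′
        (off A M~A) (off B M~B) column)))
      (trans (minor-linear _ c _ _ _)
        (+-cong (*-congˡ (*-congˡ (*-congʳ (M~A zero j j≢k)))) (*-congˡ (*-congʳ (M~B zero j j≢k)))))
      where
      k′ : Fin n
      k′ = punchOut j≢k
      off : ∀ N → AgreeOff k M N → AgreeOff k′ (minor M j) (minor N j)
      off N M~N i l l≢k′ = M~N (suc i) (punchIn j l)
        (λ eq → l≢k′ (Finₚ.punchIn-injective j l k′ (≡.trans eq (≡.sym (punchIn-punchOut j≢k)))))
      column : ∀ i → minor M j i k′ ≈ c * minor A j i k′ + minor B j i k′
      column i rewrite punchIn-punchOut j≢k = Mk (suc i)

  setColumn : ∀ {m n} → Matrix Carrier m n → Fin n → Vector Carrier m → Matrix Carrier m n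
  setColumn M k u i j = if does (j ≟ k) then u i else M i j

  setColumn-same : ∀ {m n} (M : Matrix Carrier m n) k u i → setColumn M k u i k ≈ u i
  setColumn-same M k u i rewrite dec-true (k ≟ k) ≡.refl = refl

  setColumn-other : ∀ {m n} (M : Matrix Carrier m n) k u i j → j ≢ k → setColumn M k u i j ≈ M i j
  setColumn-other M k u i j j≢k rewrite dec-false (j ≟ k) j≢k = refl

  private
    sum-cancelling-pair : ∀ {n} (f : Vector Carrier (suc n)) k → f (inject₁ k) + f (suc k) ≈ 0# →
      (∀ j → j ≢ inject₁ k → j ≢ suc k → f j ≈ 0#) → sum f ≈ 0#
    sum-cancelling-pair f zero pair rest = trans (sym (+-assoc _ _ _)) (trans
      (+-cong pair (sum-zero _ λ i → rest (suc (suc i)) (λ ()) (λ ())))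
      (+-identityʳ _))
    sum-cancelling-pair f (suc k) pair rest = trans
      (+-cong (rest zero (λ ()) (λ ())) (sum-cancelling-pair (f ∘ suc) k pair
        λ j p q → rest (suc j) (p ∘ Finₚ.suc-injective) (q ∘ Finₚ.suc-injective)))
      (+-identityʳ _)

    -- Deleting a column `j` other than two adjacent ones leaves them adjacent, now at `k′` and
    -- `k′ + 1`.
    data AdjacentOff {n} (j : Fin (suc (suc n))) : Fin (suc n) → Set where
      shifted : ∀ (k : Fin (suc n)) k′ → punchIn j (inject₁ k′) ≡ inject₁ k → punchIn j (suc k′) ≡ suc k →
        AdjacentOff j k

    adjacentOff : ∀ {n} (j : Fin (suc (suc n))) k → j ≢ inject₁ k → j ≢ suc k → AdjacentOff j k
    adjacentOff zero          zero    p q = contradiction ≡.refl p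
    adjacentOff {suc n} zero  (suc k) p q = shifted _ k ≡.refl ≡.refl
    adjacentOff (suc zero)    zero    p q = contradiction ≡.refl q
    adjacentOff {suc n} (suc (suc j)) zero p q = shifted _ zero ≡.refl ≡.refl
    adjacentOff {suc n} (suc j) (suc k) p q
      with adjacentOff j k (p ∘ ≡.cong suc) (q ∘ ≡.cong suc)
    ... | shifted _ k′ e e′ = shifted _ (suc k′) (≡.cong suc e) (≡.cong suc e′)

    -- Deleting column `k` or deleting column `k + 1` gives minors that differ in a single column:
    -- it is column `k + 1` in the first and column `k` in the second.
    punchIn-adjacent : ∀ {n} (k l : Fin n) → punchIn (inject₁ k) l ≡ punchIn (suc k) l ⊎
      (punchIn (inject₁ k) l ≡ suc k × punchIn (suc k) l ≡ inject₁ k)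
    punchIn-adjacent zero    zero    = inj₂ (≡.refl , ≡.refl)
    punchIn-adjacent zero    (suc l) = inj₁ ≡.refl
    punchIn-adjacent (suc k) zero    = inj₁ ≡.refl
    punchIn-adjacent (suc k) (suc l) with punchIn-adjacent k l
    ... | inj₁ e        = inj₁ (≡.cong suc e)
    ... | inj₂ (e , e′) = inj₂ (≡.cong suc e , ≡.cong suc e′)

  -- The summands of `k` and `k + 1` have equal minors and opposite signs; every other minor still
  -- has two equal adjacent columns, so induction applies.
  det-adjacent-equal : ∀ {n} (M : Matrix Carrier (suc n) (suc n)) k →
    (∀ i → M i (inject₁ k) ≈ M i (suc k)) → det M ≈ 0#
  det-adjacent-equal {n} M k eq = sum-cancelling-pair _ k pair rest
    where
    sign-flip : ∀ s a b → s * a + (- 1# * s) * b ≈ s * (a + - b)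
    sign-flip s a b = begin
      s * a + (- 1# * s) * b    ≈⟨ +-congˡ (*-congʳ (-1*x≈-x s)) ⟩
      s * a + (- s) * b         ≈⟨ +-congˡ (trans (sym (-‿distribˡ-* s b)) (-‿distribʳ-* s b)) ⟩
      s * a + s * - b           ≈⟨ distribˡ s a (- b) ⟨
      s * (a + - b)             ∎
    minors : ∀ i l → minor M (inject₁ k) i l ≈ minor M (suc k) i l
    minors i l with punchIn-adjacent k l
    ... | inj₁ e        = reflexive (≡.cong (M (suc i)) e)
    ... | inj₂ (e , e′) rewrite e | e′ = sym (eq (suc i))
    pair : summand M (inject₁ k) + summand M (suc k) ≈ 0#
    pair rewrite Finₚ.toℕ-inject₁ k = trans (sign-flip _ _ _) (trans
      (*-congˡ (trans (+-congʳ (*-cong (eq zero) (det-cong minors))) (-‿inverseʳ _)))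
      (zeroʳ _))
    rest : ∀ j → j ≢ inject₁ k → j ≢ suc k → summand M j ≈ 0#
    rest j p q = trans (*-congˡ (trans (*-congˡ (vanish n M k eq j p q)) (zeroʳ _))) (zeroʳ _)
      where
      vanish : ∀ n (M : Matrix Carrier (suc n) (suc n)) k → (∀ i → M i (inject₁ k) ≈ M i (suc k)) →
        ∀ j → j ≢ inject₁ k → j ≢ suc k → det (minor M j) ≈ 0#
      vanish (suc n) M k eq j p q with adjacentOff j k p q
      ... | shifted _ k′ e e′ = det-adjacent-equal (minor M j) k′ λ i →
        trans (reflexive (≡.cong (M (suc i)) e)) (trans (eq (suc i)) (reflexive (≡.cong (M (suc i)) (≡.sym e′))))

  private
    -- The right-hand column is moved towards `a`. With `W x y` having `x` at `p` and `y` at `q`,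
    -- expanding `det (W (u ⊕ v) (u ⊕ v)) ≈ 0#` relates `det (W v u)`, which is `det M`, to
    -- `det (W u v)`, where the copy of column `a` stands one place further left. The induction runs
    -- on the position `d`, since `inject₁ k` is not a subterm of `suc k`.
    det-equal-columns-≤ : ∀ d {n} (M : Matrix Carrier (suc n) (suc n)) a (k : Fin n) →
      toℕ k ≡ d → toℕ a ≤ d → (∀ i → M i a ≈ M i (suc k)) → det M ≈ 0#
    det-equal-columns-≤ d M a k k≡d a≤d eq with a ≟ inject₁ k
    ... | yes ≡.refl = det-adjacent-equal M k eq
    det-equal-columns-≤ zero M zero zero _ _ _ | no a≢k = contradiction ≡.refl a≢k
    det-equal-columns-≤ zero M (suc a) zero _ () _ | no _
    det-equal-columns-≤ (suc d) {suc n} M a (suc k) k≡d a≤d eq | no a≢k = begin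
      det M                                        ≈⟨ det-cong W-vu ⟨
      det (W v u)                                  ≈⟨ +-identityʳ _ ⟨
      det (W v u) + 0#                             ≈⟨ +-congˡ (diagonal v) ⟨
      det (W v u) + det (W v v)                    ≈⟨ split-q v u v ⟨
      det (W v (u ⊕ v))                            ≈⟨ +-identityˡ _ ⟨
      0# + det (W v (u ⊕ v))                       ≈⟨ +-congʳ W-u-zero ⟨
      det (W u (u ⊕ v)) + det (W v (u ⊕ v))        ≈⟨ split-p u v (u ⊕ v) ⟨
      det (W (u ⊕ v) (u ⊕ v))                      ≈⟨ diagonal (u ⊕ v) ⟩
      0#                                           ∎
      where
      p q : Fin (suc (suc n))
      p = suc (inject₁ k)
      q = suc (suc k)
      u v : Vector Carrier (suc (suc n))
      u i = M i q
      v i = M i p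
      _⊕_ : Vector Carrier (suc (suc n)) → Vector Carrier (suc (suc n)) → Vector Carrier (suc (suc n))
      (x ⊕ y) i = x i + y i
      W : Vector Carrier (suc (suc n)) → Vector Carrier (suc (suc n)) → Matrix Carrier (suc (suc n)) (suc (suc n))
      W x y = setColumn (setColumn M p x) q y
      p≢q : p ≢ q
      p≢q eq = ℕₚ.1+n≢n (≡.sym (≡.trans (≡.sym (Finₚ.toℕ-inject₁ k)) (≡.cong (ℕ.pred ∘ toℕ) eq)))
      W-p : ∀ x y i → W x y i p ≈ x i
      W-p x y i = trans (setColumn-other (setColumn M p x) q y i p p≢q) (setColumn-same M p x i)
      W-q : ∀ x y i → W x y i q ≈ y i
      W-q x y i = setColumn-same (setColumn M p x) q y i
      W-other : ∀ x y i j → j ≢ p → j ≢ q → W x y i j ≈ M i j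
      W-other x y i j j≢p j≢q = trans (setColumn-other (setColumn M p x) q y i j j≢q) (setColumn-other M p x i j j≢p)
      diagonal : ∀ x → det (W x x) ≈ 0#
      diagonal x = det-adjacent-equal (W x x) (suc k) λ i → trans (W-p x x i) (sym (W-q x x i))
      W-vu : ∀ i j → W v u i j ≈ M i j
      W-vu i j with j ≟ q
      ... | yes ≡.refl = refl
      ... | no _ with j ≟ p
      ... | yes ≡.refl = refl
      ... | no _ = refl
      agree-p : ∀ x x′ y → AgreeOff p (W x y) (W x′ y)
      agree-p x x′ y i j j≢p with j ≟ q
      ... | yes _ = refl
      ... | no _ = trans (setColumn-other M p x i j j≢p) (sym (setColumn-other M p x′ i j j≢p))
      agree-q : ∀ x y y′ → AgreeOff q (W x y) (W x y′)
      agree-q x y y′ i j j≢q =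
        trans (setColumn-other (setColumn M p x) q y i j j≢q) (sym (setColumn-other (setColumn M p x) q y′ i j j≢q))
      split-p : ∀ x x′ y → det (W (x ⊕ x′) y) ≈ det (W x y) + det (W x′ y)
      split-p x x′ y = trans
        (det-linear (W (x ⊕ x′) y) (W x y) (W x′ y) 1# p (agree-p (x ⊕ x′) x y) (agree-p (x ⊕ x′) x′ y)
          λ i → trans (W-p (x ⊕ x′) y i) (+-cong (trans (sym (W-p x y i)) (sym (*-identityˡ _))) (sym (W-p x′ y i))))
        (+-congʳ (*-identityˡ _))
      split-q : ∀ x y y′ → det (W x (y ⊕ y′)) ≈ det (W x y) + det (W x y′)
      split-q x y y′ = trans
        (det-linear (W x (y ⊕ y′)) (W x y) (W x y′) 1# q (agree-q x (y ⊕ y′) y) (agree-q x (y ⊕ y′) y′)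
          λ i → trans (W-q x (y ⊕ y′) i) (+-cong (trans (sym (W-q x y i)) (sym (*-identityˡ _))) (sym (W-q x y′ i))))
        (+-congʳ (*-identityˡ _))
      a≤d′ : toℕ a ≤ d
      a≤d′ = ℕₚ.≤-pred (ℕₚ.≤∧≢⇒< a≤d λ a≡d → a≢k (Finₚ.toℕ-injective
        (≡.trans a≡d (≡.trans (≡.sym k≡d) (≡.sym (Finₚ.toℕ-inject₁ (suc k)))))))
      a≢q : a ≢ q
      a≢q ≡.refl = ℕₚ.<-irrefl ≡.refl (ℕₚ.≤-trans (ℕ.s≤s (ℕₚ.≤-reflexive (≡.sym k≡d))) a≤d)
      W-u-zero : det (W u (u ⊕ v)) ≈ 0#
      W-u-zero = trans (split-q u u v) (trans
        (+-cong (diagonal u) (det-equal-columns-≤ d (W u v) a (inject₁ k)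
          (≡.trans (Finₚ.toℕ-inject₁ k) (ℕₚ.suc-injective k≡d)) a≤d′
          λ i → trans (W-other u v i a a≢k a≢q) (trans (eq i) (sym (W-p u v i)))))
        (+-identityʳ 0#))

  det-equal-columns : ∀ {n} (M : Matrix Carrier n n) a b → a ≢ b → (∀ i → M i a ≈ M i b) → det M ≈ 0#
  det-equal-columns M zero    zero    a≢b eq = contradiction ≡.refl a≢b
  det-equal-columns M zero    (suc b) a≢b eq = det-equal-columns-≤ (toℕ b) M zero b ≡.refl ℕ.z≤n eq
  det-equal-columns M (suc a) zero    a≢b eq =
    det-equal-columns-≤ (toℕ a) M zero a ≡.refl ℕ.z≤n (λ i → sym (eq i))
  det-equal-columns M (suc a) (suc b) a≢b eq with ℕₚ.<-cmp (toℕ a) (toℕ b)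
  ... | tri< a<b _ _ = det-equal-columns-≤ (toℕ b) M (suc a) b ≡.refl a<b eq
  ... | tri≈ _ a≡b _ = contradiction (≡.cong suc (Finₚ.toℕ-injective a≡b)) a≢b
  ... | tri> _ _ b<a = det-equal-columns-≤ (toℕ a) M (suc b) a ≡.refl b<a (λ i → sym (eq i))

  -- By linearity in column `k`, each added term contributes a multiple of a determinant with two
  -- equal columns. The terms are peeled off one by one until only `x * M i k` remains.
  det-columnOp : ∀ {n p} (N M : Matrix Carrier n n) k x (c : Vector Carrier p) (g : Fin p → Fin n) →
    AgreeOff k N M → (∀ t → g t ≢ k) → (∀ i → N i k ≈ sum (λ t → c t * M i (g t)) + x * M i k) →
    det N ≈ x * det M
  det-columnOp {p = zero} N M k x c g N~M g≢k Nk = begin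
    det N                    ≈⟨ det-linear N M (setColumn M k (const 0#)) x k N~M
                                 (λ i j j≢k → trans (N~M i j j≢k) (sym (setColumn-other M k (const 0#) i j j≢k)))
                                 (λ i → trans (Nk i) (trans (+-comm _ _) (+-congˡ (sym (setColumn-same M k (const 0#) i))))) ⟩
    x * det M + det Z        ≈⟨ +-congˡ Z≈0 ⟩
    x * det M + 0#           ≈⟨ +-identityʳ _ ⟩
    x * det M                ∎
    where
    Z : Matrix Carrier _ _
    Z = setColumn M k (const 0#)
    Z≈0 : det Z ≈ 0#
    -- The zero column is `- 1#` times itself plus itself, so `det Z` equals `- det Z + det Z`.
    Z≈0 = trans
      (det-linear Z Z Z (- 1#) k (λ _ _ _ → refl) (λ _ _ _ → refl) λ i →
        trans (zeroColumn i) (sym (trans (+-cong (trans (*-congˡ (zeroColumn i)) (zeroʳ _)) (zeroColumn i)) (+-identityˡ 0#))))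
      (trans (+-congʳ (-1*x≈-x _)) (-‿inverseˡ _))
      where
      zeroColumn : ∀ i → Z i k ≈ 0#
      zeroColumn = setColumn-same M k (const 0#)
  det-columnOp {p = suc p} N M k x c g N~M g≢k Nk = begin
    det N                       ≈⟨ det-linear N A B (c zero) k
                                     (λ i j j≢k → trans (N~M i j j≢k) (sym (setColumn-other M k a i j j≢k)))
                                     (λ i j j≢k → trans (N~M i j j≢k) (sym (setColumn-other M k b i j j≢k)))
                                     (λ i → trans (Nk i) (trans (+-assoc _ _ _)
                                       (+-cong (*-congˡ (sym (setColumn-same M k a i))) (sym (setColumn-same M k b i))))) ⟩
    c zero * det A + det B      ≈⟨ +-cong (*-congˡ (det-equal-columns A (g zero) k (g≢k zero) λ i →
                                     trans (setColumn-other M k a i (g zero) (g≢k zero)) (sym (setColumn-same M k a i))))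
                                     (det-columnOp B M k x (c ∘ suc) (g ∘ suc)
                                       (setColumn-other M k b) (g≢k ∘ suc)
                                       (setColumn-same M k b)) ⟩
    c zero * 0# + x * det M     ≈⟨ trans (+-congʳ (zeroʳ _)) (+-identityˡ _) ⟩
    x * det M                   ∎
    where
    a b : Vector Carrier _
    a i = M i (g zero)
    b i = sum (λ t → c (suc t) * M i (g (suc t))) + x * M i k
    A B : Matrix Carrier _ _
    A = setColumn M k a
    B = setColumn M k b

  -- The source columns `g t` are never among the updated columns `h k`, so the updates can be made
  -- one after another from unchanged sources; each contributes a factor `x`.
  det-columnOps : ∀ {n p q} (N M : Matrix Carrier n n) x (c : Matrix Carrier p q)
    (g : Fin p → Fin n) (h : Fin q → Fin n) → (∀ {i j} → h i ≡ h j → i ≡ j) → (∀ t k → g t ≢ h k) →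
    (∀ i j → (∀ k → j ≢ h k) → N i j ≈ M i j) →
    (∀ i k → N i (h k) ≈ sum (λ t → c t k * M i (g t)) + x * M i (h k)) →
    det N ≈ (x ^ q) * det M
  det-columnOps {q = zero} N M x c g h h-inj g≢h same upd =
    trans (det-cong λ i j → same i j (λ ())) (sym (*-identityˡ _))
  det-columnOps {q = suc q} N M x c g h h-inj g≢h same upd = begin
    det N                         ≈⟨ det-columnOp N M′ (h zero) x (λ t → c t zero) g
                                       (λ i j j≢h → sym (setColumn-other N (h zero) m i j j≢h))
                                       (λ t → g≢h t zero)
                                       (λ i → trans (upd i zero) (+-cong
                                         (sum-cong-≋ λ t → *-congˡ {c t zero} (sym (trans
                                           (setColumn-other N (h zero) m i (g t) (g≢h t zero))
                                           (same i (g t) (g≢h t)))))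
                                         (*-congˡ (sym (setColumn-same N (h zero) m i))))) ⟩
    x * det M′                    ≈⟨ *-congˡ (det-columnOps M′ M x (λ t k → c t (suc k)) g (h ∘ suc)
                                       (Finₚ.suc-injective ∘ h-inj) (λ t k → g≢h t (suc k)) same′ upd′) ⟩
    x * ((x ^ q) * det M)         ≈⟨ *-assoc x _ _ ⟨
    (x ^ suc q) * det M           ∎
    where
    m : Vector Carrier _
    m i = M i (h zero)
    M′ : Matrix Carrier _ _
    M′ = setColumn N (h zero) m
    h-suc : ∀ k → h (suc k) ≢ h zero
    h-suc k eq with h-inj eq
    ... | ()
    same′ : ∀ i j → (∀ k → j ≢ h (suc k)) → M′ i j ≈ M i j
    same′ i j off with j ≟ h zero
    ... | yes ≡.refl = refl
    ... | no j≢h = same i j λ { zero → j≢h ; (suc k) → off k }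
    upd′ : ∀ i k → M′ i (h (suc k)) ≈ sum (λ t → c t (suc k) * M i (g t)) + x * M i (h (suc k))
    upd′ i k = trans (setColumn-other N (h zero) m i (h (suc k)) (h-suc k)) (upd i (suc k))

  det-zero-row : ∀ {n} (M : Matrix Carrier n n) i → (∀ j → M i j ≈ 0#) → det M ≈ 0#
  det-zero-row M zero    row = sum-zero (summand M) λ j →
    trans (*-congˡ {(- 1#) ^ toℕ j} (trans (*-congʳ (row j)) (zeroˡ _))) (zeroʳ _)
  det-zero-row M (suc i) row = sum-zero (summand M) λ j →
    trans (*-congˡ {(- 1#) ^ toℕ j}
      (trans (*-congˡ (det-zero-row (minor M j) i λ k → row (punchIn j k))) (zeroʳ _))) (zeroʳ _)

  det-first-row : ∀ {n} (M : Matrix Carrier (suc n) (suc n)) → (∀ j → M zero (suc j) ≈ 0#) →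
    det M ≈ M zero zero * det (λ i j → M (suc i) (suc j))
  det-first-row M row = trans (sum-single (summand M) zero off) (*-identityˡ _)
    where
    off : ∀ j → j ≢ zero → summand M j ≈ 0#
    off zero    j≢0 = contradiction ≡.refl j≢0
    off (suc j) _   = trans (*-congˡ {(- 1#) ^ suc (toℕ j)} (trans (*-congʳ (row j)) (zeroˡ _))) (zeroʳ _)

  det-1ᴹ : ∀ n → det (1ᴹ {n}) ≈ 1#
  det-1ᴹ zero    = refl
  det-1ᴹ (suc n) = trans (det-first-row (1ᴹ {suc n}) (λ _ → refl)) (trans (*-identityˡ _) (det-1ᴹ n))

  data Split (m : ℕ) {n : ℕ} : Fin (m ℕ.+ n) → Set where
    left  : ∀ i → Split m (i ↑ˡ n)
    right : ∀ i → Split m (m ↑ʳ i)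

  split : ∀ m {n} (i : Fin (m ℕ.+ n)) → Split m i
  split m {n} i with splitAt m i | Finₚ.join-splitAt m n i
  ... | inj₁ j | ≡.refl = left j
  ... | inj₂ j | ≡.refl = right j

  ↑ˡ≢↑ʳ : ∀ {m n} (i : Fin m) (j : Fin n) → i ↑ˡ n ≢ m ↑ʳ j
  ↑ˡ≢↑ʳ {m} {n} i j eq
    with ≡.trans (≡.sym (Finₚ.splitAt-↑ˡ m i n)) (≡.trans (≡.cong (splitAt m) eq) (Finₚ.splitAt-↑ʳ m n j))
  ... | ()

  private
    punchIn-↑ˡ-↑ˡ : ∀ {m} n (i : Fin (suc m)) (j : Fin m) → punchIn (i ↑ˡ n) (j ↑ˡ n) ≡ punchIn i j ↑ˡ n
    punchIn-↑ˡ-↑ˡ n zero    j       = ≡.refl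
    punchIn-↑ˡ-↑ˡ n (suc i) zero    = ≡.refl
    punchIn-↑ˡ-↑ˡ n (suc i) (suc j) = ≡.cong suc (punchIn-↑ˡ-↑ˡ n i j)

    punchIn-↑ˡ-↑ʳ : ∀ {m n} (i : Fin (suc m)) (j : Fin n) → punchIn (i ↑ˡ n) (m ↑ʳ j) ≡ suc m ↑ʳ j
    punchIn-↑ˡ-↑ʳ zero            j = ≡.refl
    punchIn-↑ˡ-↑ʳ {suc m} (suc i) j = ≡.cong suc (punchIn-↑ˡ-↑ʳ i j)

  -- Deleting a right-hand column deletes the only nonzero entry of one of the lower rows, so that
  -- minor has a zero row. What remains is the expansion of `T`, with minors of the same block
  -- shape.
  det-block-upper : ∀ m {n} (K : Matrix Carrier (m ℕ.+ n) (m ℕ.+ n)) (T : Matrix Carrier m m) →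
    (∀ i j → K (i ↑ˡ n) (j ↑ˡ n) ≈ T i j) → (∀ i j → K (m ↑ʳ i) (j ↑ˡ n) ≈ 0#) →
    (∀ i j → K (m ↑ʳ i) (m ↑ʳ j) ≈ 1ᴹ i j) → det K ≈ det T
  det-block-upper zero    {n} K T KT K0 KI = trans (det-cong KI) (det-1ᴹ n)
  det-block-upper (suc m) {n} K T KT K0 KI = trans (sum-↑ (suc m) (summand K)) (trans
    (+-cong (sum-cong-≋ leftTerm) (sum-zero (λ j → summand K (suc m ↑ʳ j)) rightTerm)) (+-identityʳ _))
    where
    leftTerm : ∀ j → summand K (j ↑ˡ n) ≈ summand T j
    leftTerm j rewrite Finₚ.toℕ-↑ˡ j n = *-congˡ {(- 1#) ^ toℕ j} (*-cong (KT zero j)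
      (det-block-upper m (minor K (j ↑ˡ n)) (minor T j)
        (λ i k → trans (reflexive (≡.cong (K (suc i ↑ˡ n)) (punchIn-↑ˡ-↑ˡ n j k))) (KT (suc i) (punchIn j k)))
        (λ i k → trans (reflexive (≡.cong (K (suc m ↑ʳ i)) (punchIn-↑ˡ-↑ˡ n j k))) (K0 i (punchIn j k)))
        (λ i k → trans (reflexive (≡.cong (K (suc m ↑ʳ i)) (punchIn-↑ˡ-↑ʳ j k))) (KI i k))))
    lowerRow : ∀ i j → j ≢ suc m ↑ʳ i → K (suc m ↑ʳ i) j ≈ 0#
    lowerRow i j j≢i with split (suc m) j
    ... | left j′  = K0 i j′
    ... | right j′ = trans (KI i j′) (diag-diff _ i j′ (λ eq → j≢i (≡.cong (suc m ↑ʳ_) (≡.sym eq))))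
    rightTerm : ∀ j → summand K (suc m ↑ʳ j) ≈ 0#
    rightTerm j = trans (*-congˡ {(- 1#) ^ toℕ (suc m ↑ʳ j)} (trans
      (*-congˡ (det-zero-row (minor K (suc m ↑ʳ j)) (m ↑ʳ j)
        λ k → lowerRow j _ (punchInᵢ≢i (suc m ↑ʳ j) k)))
      (zeroʳ _))) (zeroʳ _)

  det-block-lower : ∀ m {n} (K : Matrix Carrier (m ℕ.+ n) (m ℕ.+ n)) x (Q : Matrix Carrier n n) →
    (∀ i j → K (i ↑ˡ n) (j ↑ˡ n) ≈ diag (const x) i j) → (∀ i j → K (i ↑ˡ n) (m ↑ʳ j) ≈ 0#) →
    (∀ i j → K (m ↑ʳ i) (m ↑ʳ j) ≈ Q i j) → det K ≈ (x ^ m) * det Q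
  det-block-lower zero        K x Q KD K0 KQ = trans (det-cong KQ) (sym (*-identityˡ _))
  det-block-lower (suc m) {n} K x Q KD K0 KQ = begin
    det K                                            ≈⟨ det-first-row K row ⟩
    K zero zero * det (λ i j → K (suc i) (suc j))    ≈⟨ *-cong (KD zero zero)
      (det-block-lower m (λ i j → K (suc i) (suc j)) x Q
        (λ i j → KD (suc i) (suc j)) (λ i j → K0 (suc i) j) KQ) ⟩
    x * ((x ^ m) * det Q)                            ≈⟨ *-assoc x _ _ ⟨
    (x ^ suc m) * det Q                              ∎
    where
    row : ∀ j → K zero (suc j) ≈ 0#
    row j with split m j
    ... | left j′  = KD zero (suc j′)
    ... | right j′ = K0 zero j′

  -- Both sides are x^n times the determinant of [[x, A], [B, 1]]: clear either its lower left
  -- block or (after scaling the right columns by x) its upper right block by column operations.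
  sylvester : ∀ {m n} x (A : Matrix Carrier m n) (B : Matrix Carrier n m) →
    (x ^ n) * det (diag (const x) ⊟ (A ⊠ B)) ≈ (x ^ m) * det (diag (const x) ⊟ (B ⊠ A))
  sylvester {m} {n} x A B = begin
    (x ^ n) * det (diag (const x) ⊟ (A ⊠ B))    ≈⟨ *-congˡ (det-block-upper m U _
                                                     (blocks-ll _ _ _ _) (blocks-rl _ _ _ _) (blocks-rr _ _ _ _)) ⟨
    (x ^ n) * det U
      ≈⟨ *-congˡ (det-columnOps U K 1# (λ t k → - B t k) (m ↑ʳ_) (_↑ˡ n)
        (Finₚ.↑ˡ-injective n _ _) (λ t k eq → ↑ˡ≢↑ʳ k t (≡.sym eq))
        sameU updU) ⟩
    (x ^ n) * ((1# ^ m) * det K)                ≈⟨ *-congˡ (trans (*-congʳ (1^ m)) (*-identityˡ _)) ⟩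
    (x ^ n) * det K                             ≈⟨ det-columnOps L K x (λ t k → - A t k) (_↑ˡ n) (m ↑ʳ_)
                                                     (Finₚ.↑ʳ-injective m _ _) (λ t k → ↑ˡ≢↑ʳ t k) sameL updL ⟨
    det L                                       ≈⟨ det-block-lower m L x _
                                                     (blocks-ll _ _ _ _) (blocks-lr _ _ _ _) (blocks-rr _ _ _ _) ⟩
    (x ^ m) * det (diag (const x) ⊟ (B ⊠ A))    ∎
    where
    1^ : ∀ k → 1# ^ k ≈ 1#
    1^ zero    = refl
    1^ (suc k) = trans (*-identityˡ _) (1^ k)
    blocks : Matrix Carrier m m → Matrix Carrier m n → Matrix Carrier n m → Matrix Carrier n n →
      Matrix Carrier (m ℕ.+ n) (m ℕ.+ n)
    blocks ll lr rl rr i j with splitAt m i | splitAt m j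
    ... | inj₁ i′ | inj₁ j′ = ll i′ j′
    ... | inj₁ i′ | inj₂ j′ = lr i′ j′
    ... | inj₂ i′ | inj₁ j′ = rl i′ j′
    ... | inj₂ i′ | inj₂ j′ = rr i′ j′
    blocks-ll : ∀ ll lr rl rr i j → blocks ll lr rl rr (i ↑ˡ n) (j ↑ˡ n) ≈ ll i j
    blocks-ll ll lr rl rr i j rewrite Finₚ.splitAt-↑ˡ m i n | Finₚ.splitAt-↑ˡ m j n = refl
    blocks-lr : ∀ ll lr rl rr i j → blocks ll lr rl rr (i ↑ˡ n) (m ↑ʳ j) ≈ lr i j
    blocks-lr ll lr rl rr i j rewrite Finₚ.splitAt-↑ˡ m i n | Finₚ.splitAt-↑ʳ m n j = refl
    blocks-rl : ∀ ll lr rl rr i j → blocks ll lr rl rr (m ↑ʳ i) (j ↑ˡ n) ≈ rl i j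
    blocks-rl ll lr rl rr i j rewrite Finₚ.splitAt-↑ʳ m n i | Finₚ.splitAt-↑ˡ m j n = refl
    blocks-rr : ∀ ll lr rl rr i j → blocks ll lr rl rr (m ↑ʳ i) (m ↑ʳ j) ≈ rr i j
    blocks-rr ll lr rl rr i j rewrite Finₚ.splitAt-↑ʳ m n i | Finₚ.splitAt-↑ʳ m n j = refl
    K U L : Matrix Carrier (m ℕ.+ n) (m ℕ.+ n)
    K = blocks (diag (const x)) A B 1ᴹ
    U = blocks (diag (const x) ⊟ (A ⊠ B)) A (λ _ _ → 0#) 1ᴹ
    L = blocks (diag (const x)) (λ _ _ → 0#) B (diag (const x) ⊟ (B ⊠ A))
    negated : ∀ {p} (f g : Vector Carrier p) → sum (λ t → - f t * g t) ≈ - sum (λ t → g t * f t)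
    negated f g = begin
      sum (λ t → - f t * g t)          ≈⟨ sum-cong-≋ (λ t → trans (sym (-‿distribˡ-* (f t) (g t)))
                                             (trans (-‿cong (*-comm (f t) (g t))) (sym (-1*x≈-x _)))) ⟩
      sum (λ t → - 1# * (g t * f t))   ≈⟨ *-distribˡ-sum (- 1#) (λ t → g t * f t) ⟨
      - 1# * sum (λ t → g t * f t)     ≈⟨ -1*x≈-x _ ⟩
      - sum (λ t → g t * f t)          ∎
    negated-diag : ∀ {p} (f : Vector Carrier p) y i → sum (λ t → - f t * diag (const y) i t) ≈ - (y * f i)
    negated-diag f y i = trans (negated f _) (-‿cong (sum-diagˡ (const y) i f))
    sameU : ∀ i j → (∀ k → j ≢ k ↑ˡ n) → U i j ≈ K i j
    sameU i j off with split m j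
    ... | left j′ = contradiction ≡.refl (off j′)
    ... | right j′ with split m i
    ... | left i′  = trans (blocks-lr _ _ _ _ i′ j′) (sym (blocks-lr _ _ _ _ i′ j′))
    ... | right i′ = trans (blocks-rr _ _ _ _ i′ j′) (sym (blocks-rr _ _ _ _ i′ j′))
    updU : ∀ i k → U i (k ↑ˡ n) ≈ sum (λ t → - B t k * K i (m ↑ʳ t)) + 1# * K i (k ↑ˡ n)
    updU i k with split m i
    ... | left i′ = begin
      U (i′ ↑ˡ n) (k ↑ˡ n)                          ≈⟨ blocks-ll _ _ _ _ i′ k ⟩
      diag (const x) i′ k + - (A ⊠ B) i′ k          ≈⟨ +-comm _ _ ⟩
      - (A ⊠ B) i′ k + diag (const x) i′ k          ≈⟨ +-congʳ (negated (λ t → B t k) (A i′)) ⟨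
      sum (λ t → - B t k * A i′ t) + diag (const x) i′ k
        ≈⟨ +-cong (sum-cong-≋ λ t → *-congˡ { - B t k} (blocks-lr _ _ _ _ i′ t))
                  (trans (*-identityˡ _) (blocks-ll _ _ _ _ i′ k)) ⟨
      sum (λ t → - B t k * K (i′ ↑ˡ n) (m ↑ʳ t)) + 1# * K (i′ ↑ˡ n) (k ↑ˡ n)    ∎
    ... | right i′ = begin
      U (m ↑ʳ i′) (k ↑ˡ n)                          ≈⟨ blocks-rl _ _ _ _ i′ k ⟩
      0#                                            ≈⟨ -‿inverseˡ _ ⟨
      - B i′ k + B i′ k                             ≈⟨ +-cong (-‿cong (*-identityˡ _)) (*-identityˡ _) ⟨
      - (1# * B i′ k) + 1# * B i′ k                 ≈⟨ +-congʳ (negated-diag (λ t → B t k) 1# i′) ⟨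
      sum (λ t → - B t k * 1ᴹ i′ t) + 1# * B i′ k
        ≈⟨ +-cong (sum-cong-≋ λ t → *-congˡ { - B t k} (blocks-rr _ _ _ _ i′ t)) (*-congˡ (blocks-rl _ _ _ _ i′ k)) ⟨
      sum (λ t → - B t k * K (m ↑ʳ i′) (m ↑ʳ t)) + 1# * K (m ↑ʳ i′) (k ↑ˡ n)    ∎
    sameL : ∀ i j → (∀ k → j ≢ m ↑ʳ k) → L i j ≈ K i j
    sameL i j off with split m j
    ... | right j′ = contradiction ≡.refl (off j′)
    ... | left j′ with split m i
    ... | left i′  = trans (blocks-ll _ _ _ _ i′ j′) (sym (blocks-ll _ _ _ _ i′ j′))
    ... | right i′ = trans (blocks-rl _ _ _ _ i′ j′) (sym (blocks-rl _ _ _ _ i′ j′))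
    updL : ∀ i k → L i (m ↑ʳ k) ≈ sum (λ t → - A t k * K i (t ↑ˡ n)) + x * K i (m ↑ʳ k)
    updL i k with split m i
    ... | left i′ = begin
      L (i′ ↑ˡ n) (m ↑ʳ k)                          ≈⟨ blocks-lr _ _ _ _ i′ k ⟩
      0#                                            ≈⟨ -‿inverseˡ _ ⟨
      - (x * A i′ k) + x * A i′ k                   ≈⟨ +-congʳ (negated-diag (λ t → A t k) x i′) ⟨
      sum (λ t → - A t k * diag (const x) i′ t) + x * A i′ k
        ≈⟨ +-cong (sum-cong-≋ λ t → *-congˡ { - A t k} (blocks-ll _ _ _ _ i′ t)) (*-congˡ (blocks-lr _ _ _ _ i′ k)) ⟨
      sum (λ t → - A t k * K (i′ ↑ˡ n) (t ↑ˡ n)) + x * K (i′ ↑ˡ n) (m ↑ʳ k)    ∎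
    ... | right i′ = begin
      L (m ↑ʳ i′) (m ↑ʳ k)                          ≈⟨ blocks-rr _ _ _ _ i′ k ⟩
      diag (const x) i′ k + - (B ⊠ A) i′ k          ≈⟨ +-comm _ _ ⟩
      - (B ⊠ A) i′ k + diag (const x) i′ k
        ≈⟨ +-cong (negated (λ t → A t k) (B i′)) (sym (diag-const x i′ k)) ⟨
      sum (λ t → - A t k * B i′ t) + x * 1ᴹ i′ k
        ≈⟨ +-cong (sum-cong-≋ λ t → *-congˡ { - A t k} (blocks-rl _ _ _ _ i′ t)) (*-congˡ (blocks-rr _ _ _ _ i′ k)) ⟨
      sum (λ t → - A t k * K (m ↑ʳ i′) (t ↑ˡ n)) + x * K (m ↑ʳ i′) (m ↑ʳ k)    ∎

-- Polynomials

-- These equations are all it takes to carry a determinant over, so exact arithmetic can run in a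
-- bare raw ring such as the Gaussian integers below.
record IsRawHom (A B : RawRing 0ℓ 0ℓ) (h : RawRing.Carrier A → RawRing.Carrier B) : Set where
  private
    module A = RawRing A
    module B = RawRing B
  field
    +-homo : ∀ x y → h (x A.+ y) B.≈ h x B.+ h y
    *-homo : ∀ x y → h (x A.* y) B.≈ h x B.* h y
    -‿homo : ∀ x → h (A.- x) B.≈ B.- h x
    0-homo : h A.0# B.≈ B.0#
    1-homo : h A.1# B.≈ B.1#

module MatrixHom (A : RawRing 0ℓ 0ℓ) (R : CommutativeRing 0ℓ 0ℓ)
  {h : RawRing.Carrier A → CommutativeRing.Carrier R}
  (isHom : IsRawHom A (CommutativeRing.rawRing R) h) where
  private
    module A where
      open RawRing A public
      open MatrixOps A public
      open RawSemiringDefs rawSemiring public using (sum; _^_)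
  open CommutativeRing R hiding (zero; _-_)
  open MatrixOps rawRing
  open RawSemiringDefs (RawRing.rawSemiring rawRing) using (_^_)
  open SumProperties semiring using (sum; sum-cong-≋)
  open IsRawHom isHom

  sum-homo : ∀ {n} (f : Vector A.Carrier n) → h (A.sum f) ≈ sum (h ∘ f)
  sum-homo {zero}  f = 0-homo
  sum-homo {suc n} f = trans (+-homo _ _) (+-congˡ (sum-homo (f ∘ suc)))

  ^-homo : ∀ x k → h (x A.^ k) ≈ h x ^ k
  ^-homo x zero    = 1-homo
  ^-homo x (suc k) = trans (*-homo _ _) (*-congˡ (^-homo x k))

  sign-homo : ∀ k → h ((A.- A.1#) A.^ k) ≈ (- 1#) ^ k
  sign-homo zero    = 1-homo
  sign-homo (suc k) = trans (*-homo _ _) (*-cong (trans (-‿homo _) (-‿cong 1-homo)) (sign-homo k))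

  det-homo : ∀ {n} (M : Matrix A.Carrier n n) → h (A.det M) ≈ det (mapMatrix h M)
  det-homo {zero}  M = 1-homo
  det-homo {suc n} M = trans (sum-homo summand) (sum-cong-≋ λ j →
    trans (*-homo _ _) (*-cong (sign-homo (toℕ j)) (trans (*-homo (M zero j) _)
      (*-congˡ (det-homo (λ i k → M (suc i) (punchIn j k)))))))
    where
    summand : Vector A.Carrier (suc n)
    summand j = ((A.- A.1#) A.^ toℕ j) A.* (M zero j A.* A.det (λ i k → M (suc i) (punchIn j k)))

  diag-homo : ∀ {n} (d : Vector A.Carrier n) i j → h (A.diag d i j) ≈ diag (h ∘ d) i j
  diag-homo d i j with i ≟ j
  ... | yes _ = refl
  ... | no _  = 0-homo

  ⊠-homo : ∀ {l m n} (M : Matrix A.Carrier l m) (N : Matrix A.Carrier m n) i k →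
    h ((M A.⊠ N) i k) ≈ (mapMatrix h M ⊠ mapMatrix h N) i k
  ⊠-homo M N i k = trans (sum-homo λ j → M i j A.* N j k) (sum-cong-≋ λ j → *-homo (M i j) (N j k))

module PolynomialRing (R : CommutativeRing 0ℓ 0ℓ) where
  open CommutativeRing R hiding (zero; _-_)
  open Polynomials rawRing
  open RingProperties ring using (-‿distribˡ-*; -‿distribʳ-*; -0#≈0#; -‿+-comm)
  open import Relation.Binary.Reasoning.Setoid setoid
  open import Algebra.Properties.CommutativeSemigroup +-commutativeSemigroup
    using () renaming (interchange to +-interchange; x∙yz≈y∙xz to +-leftComm)
  open import Algebra.Properties.CommutativeSemigroup *-commutativeSemigroup
    using () renaming (x∙yz≈y∙xz to *-leftComm)

  coeff-+ : ∀ p q n → coeff (p +ₚ q) n ≈ coeff p n + coeff q n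
  coeff-+ []      q       n       = sym (+-identityˡ _)
  coeff-+ (a ∷ p) []      n       = sym (+-identityʳ _)
  coeff-+ (a ∷ p) (b ∷ q) zero    = refl
  coeff-+ (a ∷ p) (b ∷ q) (suc n) = coeff-+ p q n

  coeff-neg : ∀ p n → coeff (map -_ p) n ≈ - coeff p n
  coeff-neg []      n       = sym -0#≈0#
  coeff-neg (a ∷ p) zero    = refl
  coeff-neg (a ∷ p) (suc n) = coeff-neg p n

  coeff-scale : ∀ a p n → coeff (map (a *_) p) n ≈ a * coeff p n
  coeff-scale a []      n       = sym (zeroʳ a)
  coeff-scale a (b ∷ p) zero    = refl
  coeff-scale a (b ∷ p) (suc n) = coeff-scale a p n

  -- A wrapper from which Agda can infer p and q, unlike from p ≈ₚ q.
  infix 4 _≋ₚ_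
  record _≋ₚ_ (p q : Poly) : Set where
    constructor mk
    field at : p ≈ₚ q
  open _≋ₚ_ public

  private
    ≋-setoid : Setoid 0ℓ 0ℓ
    ≋-setoid = record
      { Carrier = Poly ; _≈_ = _≋ₚ_
      ; isEquivalence = record
        { refl = mk λ _ → refl
        ; sym = λ (mk e) → mk λ n → sym (e n)
        ; trans = λ (mk e) (mk f) → mk λ n → trans (e n) (f n) } }
    open Setoid ≋-setoid using () renaming (refl to reflₚ; sym to symₚ; trans to transₚ)

    +ₚ-cong : ∀ {p p′ q q′} → p ≋ₚ p′ → q ≋ₚ q′ → p +ₚ q ≋ₚ p′ +ₚ q′
    +ₚ-cong {p} {p′} {q} {q′} (mk e) (mk f) = mk λ n →
      trans (coeff-+ p q n) (trans (+-cong (e n) (f n)) (sym (coeff-+ p′ q′ n)))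

    +ₚ-congˡ : ∀ {p q q′} → q ≋ₚ q′ → p +ₚ q ≋ₚ p +ₚ q′
    +ₚ-congˡ = +ₚ-cong reflₚ

    +ₚ-congʳ : ∀ {p p′ q} → p ≋ₚ p′ → p +ₚ q ≋ₚ p′ +ₚ q
    +ₚ-congʳ e = +ₚ-cong e reflₚ

    ∷-cong : ∀ {a b p q} → a ≈ b → p ≋ₚ q → a ∷ p ≋ₚ b ∷ q
    ∷-cong e (mk f) = mk λ { zero → e ; (suc n) → f n }

    scale-cong : ∀ {a b p q} → a ≈ b → p ≋ₚ q → map (a *_) p ≋ₚ map (b *_) q
    scale-cong {a} {b} {p} {q} e (mk f) = mk λ n →
      trans (coeff-scale a p n) (trans (*-cong e (f n)) (sym (coeff-scale b q n)))

    neg-cong : ∀ {p q} → p ≋ₚ q → map -_ p ≋ₚ map -_ q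
    neg-cong {p} {q} (mk f) = mk λ n →
      trans (coeff-neg p n) (trans (-‿cong (f n)) (sym (coeff-neg q n)))

    +ₚ-assoc : ∀ p q r → (p +ₚ q) +ₚ r ≋ₚ p +ₚ (q +ₚ r)
    +ₚ-assoc p q r = mk λ n → trans (coeff-+ (p +ₚ q) r n) (trans (+-congʳ (coeff-+ p q n))
      (trans (+-assoc _ _ _) (sym (trans (coeff-+ p (q +ₚ r) n) (+-congˡ (coeff-+ q r n))))))

    +ₚ-comm : ∀ p q → p +ₚ q ≋ₚ q +ₚ p
    +ₚ-comm p q = mk λ n → trans (coeff-+ p q n) (trans (+-comm _ _) (sym (coeff-+ q p n)))

    +ₚ-identityʳ : ∀ p → p +ₚ [] ≋ₚ p
    +ₚ-identityʳ p = mk λ n → trans (coeff-+ p [] n) (+-identityʳ _)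

    +ₚ-inverseʳ : ∀ p → p +ₚ map -_ p ≋ₚ []
    +ₚ-inverseʳ p = mk λ n → trans (coeff-+ p (map -_ p) n) (trans (+-congˡ (coeff-neg p n)) (-‿inverseʳ _))

    +ₚ-interchange : ∀ p q r s → (p +ₚ q) +ₚ (r +ₚ s) ≋ₚ (p +ₚ r) +ₚ (q +ₚ s)
    +ₚ-interchange p q r s = mk λ n → trans (expand p q r s n)
      (trans (+-interchange _ _ _ _) (sym (expand p r q s n)))
      where
      expand : ∀ p q r s n → coeff ((p +ₚ q) +ₚ (r +ₚ s)) n ≈ (coeff p n + coeff q n) + (coeff r n + coeff s n)
      expand p q r s n = trans (coeff-+ (p +ₚ q) (r +ₚ s) n) (+-cong (coeff-+ p q n) (coeff-+ r s n))

    0∷-+ : ∀ p q → 0# ∷ (p +ₚ q) ≋ₚ (0# ∷ p) +ₚ (0# ∷ q)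
    0∷-+ p q = ∷-cong (sym (+-identityˡ 0#)) reflₚ

    0∷[] : 0# ∷ [] ≋ₚ []
    0∷[] = mk λ { zero → refl ; (suc n) → refl }

    scale-+ : ∀ a p q → map (a *_) (p +ₚ q) ≋ₚ map (a *_) p +ₚ map (a *_) q
    scale-+ a p q = mk λ n → trans (coeff-scale a (p +ₚ q) n) (trans (*-congˡ (coeff-+ p q n))
      (trans (distribˡ a _ _) (sym (trans (coeff-+ (map (a *_) p) (map (a *_) q) n)
        (+-cong (coeff-scale a p n) (coeff-scale a q n))))))

    scale-scale : ∀ a b p → map (a *_) (map (b *_) p) ≋ₚ map ((a * b) *_) p
    scale-scale a b p = mk λ n → trans (coeff-scale a (map (b *_) p) n) (trans (*-congˡ (coeff-scale b p n))
      (trans (sym (*-assoc a b _)) (sym (coeff-scale (a * b) p n))))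

    scale-0 : ∀ {a} p → a ≈ 0# → map (a *_) p ≋ₚ []
    scale-0 {a} p a≈0 = mk λ n → trans (coeff-scale a p n) (trans (*-congʳ a≈0) (zeroˡ _))

    scale-1 : ∀ p → map (1# *_) p ≋ₚ p
    scale-1 p = mk λ n → trans (coeff-scale 1# p n) (*-identityˡ _)

    scale-sum : ∀ a b p → map ((a + b) *_) p ≋ₚ map (a *_) p +ₚ map (b *_) p
    scale-sum a b p = mk λ n → trans (coeff-scale (a + b) p n) (trans (distribʳ _ a b)
      (sym (trans (coeff-+ (map (a *_) p) (map (b *_) p) n) (+-cong (coeff-scale a p n) (coeff-scale b p n)))))

    tail≋[] : ∀ {a p} → a ∷ p ≋ₚ [] → p ≋ₚ []
    tail≋[] (mk e) = mk (e ∘ suc)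

    *ₚ-zeroˡ : ∀ p q → p ≋ₚ [] → p *ₚ q ≋ₚ []
    *ₚ-zeroˡ []      q e = reflₚ
    *ₚ-zeroˡ (a ∷ p) q e = transₚ
      (+ₚ-cong (scale-0 q (at e zero)) (∷-cong refl (*ₚ-zeroˡ p q (tail≋[] e)))) 0∷[]

    *ₚ-congʳ : ∀ p p′ q → p ≋ₚ p′ → p *ₚ q ≋ₚ p′ *ₚ q
    *ₚ-congʳ []      p′       q e = symₚ (*ₚ-zeroˡ p′ q (symₚ e))
    *ₚ-congʳ (a ∷ p) []       q e = *ₚ-zeroˡ (a ∷ p) q e
    *ₚ-congʳ (a ∷ p) (b ∷ p′) q e = +ₚ-cong (scale-cong {p = q} (at e zero) reflₚ)
      (∷-cong refl (*ₚ-congʳ p p′ q (mk (at e ∘ suc))))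

    *ₚ-congˡ : ∀ p {q q′} → q ≋ₚ q′ → p *ₚ q ≋ₚ p *ₚ q′
    *ₚ-congˡ []      e = reflₚ
    *ₚ-congˡ (a ∷ p) e = +ₚ-cong (scale-cong refl e) (∷-cong refl (*ₚ-congˡ p e))

    *ₚ-zeroʳ : ∀ p → p *ₚ [] ≋ₚ []
    *ₚ-zeroʳ []      = reflₚ
    *ₚ-zeroʳ (a ∷ p) = transₚ (∷-cong refl (*ₚ-zeroʳ p)) 0∷[]

    *ₚ-distribʳ : ∀ q p p′ → (p +ₚ p′) *ₚ q ≋ₚ (p *ₚ q) +ₚ (p′ *ₚ q)
    *ₚ-distribʳ q []      p′       = reflₚ
    *ₚ-distribʳ q (a ∷ p) []       = symₚ (+ₚ-identityʳ _)
    *ₚ-distribʳ q (a ∷ p) (b ∷ p′) = transₚ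
      (+ₚ-cong (scale-sum a b q) (transₚ (∷-cong refl (*ₚ-distribʳ q p p′)) (0∷-+ (p *ₚ q) (p′ *ₚ q))))
      (+ₚ-interchange (map (a *_) q) _ _ _)

    -- The recursion of `_*ₚ_` read on its right factor; commutativity follows from it by induction
    -- on the left one.
    *ₚ-∷ʳ : ∀ p b q → p *ₚ (b ∷ q) ≋ₚ map (b *_) p +ₚ (0# ∷ p *ₚ q)
    *ₚ-∷ʳ []      b q = symₚ 0∷[]
    *ₚ-∷ʳ (a ∷ p) b q = ∷-cong (+-congʳ (*-comm a b)) (transₚ
      (+ₚ-congˡ (*ₚ-∷ʳ p b q))
      (transₚ (symₚ (+ₚ-assoc (map (a *_) q) (map (b *_) p) (0# ∷ p *ₚ q))) (transₚ
        (+ₚ-congʳ (+ₚ-comm (map (a *_) q) (map (b *_) p))) (+ₚ-assoc (map (b *_) p) (map (a *_) q) (0# ∷ p *ₚ q)))))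

    *ₚ-comm : ∀ p q → p *ₚ q ≋ₚ q *ₚ p
    *ₚ-comm []      q = symₚ (*ₚ-zeroʳ q)
    *ₚ-comm (a ∷ p) q = transₚ (+ₚ-congˡ (∷-cong refl (*ₚ-comm p q))) (symₚ (*ₚ-∷ʳ q a p))

    scale-* : ∀ a p q → map (a *_) p *ₚ q ≋ₚ map (a *_) (p *ₚ q)
    scale-* a []      q = reflₚ
    scale-* a (b ∷ p) q = transₚ
      (+ₚ-cong (symₚ (scale-scale a b q)) (∷-cong (sym (zeroʳ a)) (scale-* a p q)))
      (symₚ (scale-+ a (map (b *_) q) _))

    *ₚ-assoc : ∀ p q r → (p *ₚ q) *ₚ r ≋ₚ p *ₚ (q *ₚ r)
    *ₚ-assoc []      q r = reflₚ
    *ₚ-assoc (a ∷ p) q r = transₚ (*ₚ-distribʳ r (map (a *_) q) (0# ∷ p *ₚ q))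
      (+ₚ-cong (scale-* a q r) (transₚ (+ₚ-congʳ (scale-0 r refl)) (∷-cong refl (*ₚ-assoc p q r))))

    *ₚ-identityˡ : ∀ p → constant 1# *ₚ p ≋ₚ p
    *ₚ-identityˡ p = transₚ (+ₚ-cong (scale-1 p) 0∷[]) (+ₚ-identityʳ p)

  polynomialRing : CommutativeRing 0ℓ 0ℓ
  polynomialRing = record
    { Carrier = Poly ; _≈_ = _≈ₚ_ ; _+_ = _+ₚ_ ; _*_ = _*ₚ_
    ; -_ = map -_ ; 0# = [] ; 1# = constant 1#
    ; isCommutativeRing = record
      { isRing = record
        { +-isAbelianGroup = record
          { isGroup = record
            { isMonoid = record
              { isSemigroup = record
                { isMagma = record
                  { isEquivalence = record
                    { refl = λ _ → refl ; sym = λ e n → sym (e n) ; trans = λ e f n → trans (e n) (f n) }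
                  ; ∙-cong = λ {p} {p′} {q} {q′} e f → at (+ₚ-cong {p} {p′} {q} {q′} (mk e) (mk f)) }
                ; assoc = λ p q r → at (+ₚ-assoc p q r) }
              ; identity = (λ _ _ → refl) , (λ p → at (+ₚ-identityʳ p)) }
            ; inverse = (λ p → at (transₚ (+ₚ-comm (map -_ p) p) (+ₚ-inverseʳ p))) , (λ p → at (+ₚ-inverseʳ p))
            ; ⁻¹-cong = λ {p} {q} e → at (neg-cong {p} {q} (mk e)) }
          ; comm = λ p q → at (+ₚ-comm p q) }
        ; *-cong = λ {p} {p′} {q} {q′} e f → at (transₚ (*ₚ-congʳ p p′ q (mk e)) (*ₚ-congˡ p′ (mk f)))
        ; *-assoc = λ p q r → at (*ₚ-assoc p q r)
        ; *-identity = (λ p → at (*ₚ-identityˡ p)) , (λ p → at (transₚ (*ₚ-comm p (constant 1#)) (*ₚ-identityˡ p)))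
        ; distrib = (λ p q r → at (transₚ (*ₚ-comm p (q +ₚ r)) (transₚ (*ₚ-distribʳ p q r)
                      (+ₚ-cong (*ₚ-comm q p) (*ₚ-comm r p)))))
                  , (λ p q r → at (*ₚ-distribʳ p q r)) }
      ; *-comm = λ p q → at (*ₚ-comm p q) } }

  module Evaluation (z : Carrier) where
    ev : Poly → Carrier
    ev []      = 0#
    ev (a ∷ p) = a + z * ev p

    private
      ev-0 : ∀ p → p ≋ₚ [] → ev p ≈ 0#
      ev-0 []      e = refl
      ev-0 (a ∷ p) e = trans (+-cong (at e zero) (trans (*-congˡ (ev-0 p (tail≋[] e))) (zeroʳ z))) (+-identityˡ 0#)

    ev-cong : ∀ p q → p ≈ₚ q → ev p ≈ ev q
    ev-cong []      q       e = sym (ev-0 q (mk λ n → sym (e n)))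
    ev-cong (a ∷ p) []      e = ev-0 (a ∷ p) (mk e)
    ev-cong (a ∷ p) (b ∷ q) e = +-cong (e zero) (*-congˡ (ev-cong p q (e ∘ suc)))

    private
      ev-+ : ∀ p q → ev (p +ₚ q) ≈ ev p + ev q
      ev-+ []      q       = sym (+-identityˡ _)
      ev-+ (a ∷ p) []      = sym (+-identityʳ _)
      ev-+ (a ∷ p) (b ∷ q) = trans (+-congˡ (trans (*-congˡ (ev-+ p q)) (distribˡ z _ _))) (+-interchange a b _ _)

      ev-scale : ∀ a p → ev (map (a *_) p) ≈ a * ev p
      ev-scale a []      = sym (zeroʳ a)
      ev-scale a (b ∷ p) = trans (+-congˡ (trans (*-congˡ (ev-scale a p)) (*-leftComm z a _))) (sym (distribˡ a _ _))

      ev-* : ∀ p q → ev (p *ₚ q) ≈ ev p * ev q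
      ev-* []      q = sym (zeroˡ _)
      ev-* (a ∷ p) q = trans (ev-+ (map (a *_) q) (0# ∷ p *ₚ q)) (trans
        (+-cong (ev-scale a q) (trans (+-identityˡ _) (trans (*-congˡ (ev-* p q)) (sym (*-assoc z _ _)))))
        (sym (distribʳ _ a _)))

      ev-neg : ∀ p → ev (map -_ p) ≈ - ev p
      ev-neg []      = sym -0#≈0#
      ev-neg (a ∷ p) = trans (+-congˡ (trans (*-congˡ (ev-neg p)) (sym (-‿distribʳ-* z _)))) (-‿+-comm a _)

    ev-constant : ∀ a → ev (constant a) ≈ a
    ev-constant a = trans (+-congˡ (zeroʳ z)) (+-identityʳ a)

    ev-X : ev X ≈ z
    ev-X = trans (+-identityˡ _) (trans (*-congˡ (ev-constant 1#)) (*-identityʳ z))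

    ev-isHom : IsRawHom polyRawRing rawRing ev
    ev-isHom = record
      { +-homo = ev-+ ; *-homo = ev-* ; -‿homo = ev-neg ; 0-homo = refl ; 1-homo = ev-constant 1# }

    X-z : Poly
    X-z = X +ₚ map -_ (constant z)

    ev-X-z : ev X-z ≈ 0#
    ev-X-z = trans (ev-+ X (map -_ (constant z))) (trans
      (+-cong ev-X (trans (ev-neg (constant z)) (-‿cong (ev-constant z)))) (-‿inverseʳ z))

    quotient : Poly → Poly
    quotient []      = []
    quotient (a ∷ p) = ev p ∷ quotient p

    -- Horner's scheme.
    division : ∀ p → quotient p *ₚ X-z ≈ₚ p +ₚ map -_ (constant (ev p))
    division [] zero    = sym -0#≈0#
    division [] (suc n) = refl
    division (a ∷ p) zero = begin
      ev p * (0# + - z) + 0#    ≈⟨ +-identityʳ _ ⟩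
      ev p * (0# + - z)         ≈⟨ *-congˡ (+-identityˡ _) ⟩
      ev p * - z                ≈⟨ trans (*-comm _ _) (sym (-‿distribˡ-* z _)) ⟩
      - (z * ev p)              ≈⟨ +-identityˡ _ ⟨
      0# + - (z * ev p)         ≈⟨ +-congʳ (-‿inverseʳ a) ⟨
      a + - a + - (z * ev p)    ≈⟨ +-assoc a _ _ ⟩
      a + (- a + - (z * ev p))  ≈⟨ +-congˡ (-‿+-comm a _) ⟩
      a + - (a + z * ev p)      ∎
    division (a ∷ p) (suc n) = begin
      coeff ((ev p * 1# ∷ []) +ₚ quotient p *ₚ X-z) n
        ≈⟨ coeff-+ (ev p * 1# ∷ []) (quotient p *ₚ X-z) n ⟩
      coeff (constant (ev p * 1#)) n + coeff (quotient p *ₚ X-z) n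
        ≈⟨ +-cong (at (∷-cong {p = []} (*-identityʳ (ev p)) reflₚ) n) (division p n) ⟩
      coeff r n + coeff (p +ₚ map -_ r) n
        ≈⟨ +-congˡ (trans (coeff-+ p (map -_ r) n) (+-congˡ (coeff-neg r n))) ⟩
      coeff r n + (coeff p n + - coeff r n)                   ≈⟨ +-leftComm _ _ _ ⟩
      coeff p n + (coeff r n + - coeff r n)                   ≈⟨ +-congˡ (-‿inverseʳ _) ⟩
      coeff p n + 0#                                          ≈⟨ +-identityʳ _ ⟩
      coeff p n                                               ≈⟨ at (+ₚ-identityʳ p) n ⟨
      coeff (p +ₚ []) n                                       ∎
      where
      r : Poly
      r = constant (ev p)

    division-root : ∀ p → ev p ≈ 0# → quotient p *ₚ X-z ≈ₚ p
    division-root p root n = begin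
      coeff (quotient p *ₚ X-z) n                      ≈⟨ division p n ⟩
      coeff (p +ₚ map -_ (constant (ev p))) n          ≈⟨ coeff-+ p _ n ⟩
      coeff p n + coeff (map -_ (constant (ev p))) n   ≈⟨ +-congˡ (remainder n) ⟩
      coeff p n + 0#                                   ≈⟨ +-identityʳ _ ⟩
      coeff p n                                        ∎
      where
      remainder : ∀ n → coeff (map -_ (constant (ev p))) n ≈ 0#
      remainder zero    = trans (-‿cong root) -0#≈0#
      remainder (suc n) = refl

module Coprimality (R : CommutativeRing 0ℓ 0ℓ) where
  open CommutativeRing R hiding (zero; _-_)
  open RawSemiringDefs (RawRing.rawSemiring rawRing) using (_^_; _∣_)
  open RawMagmaDefs (RawRing.*-rawMagma rawRing) using (_,_)
  open import Relation.Binary.Reasoning.Setoid setoid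
  open SemiringSolver commutativeSemiring using (solve; _:+_; _:*_; _:=_)

  -- Coprimality in Bézout form, which makes sense without decidable equality: `p = d u p + x v p`
  -- shows that `d` divides `p` if it divides `x p`.
  Comaximal : Carrier → Carrier → Set
  Comaximal d x = ∃₂ λ u v → d * u + x * v ≈ 1#

  -- Multiply the first summand of `1 = d^k u′ + x v′` by `1 = d u + x v`.
  comaximal-^ : ∀ {d x} → Comaximal d x → ∀ k → Comaximal (d ^ k) x
  comaximal-^ {d} {x} c zero = 1# , 0# , trans (+-cong (*-identityˡ 1#) (zeroʳ x)) (+-identityʳ 1#)
  comaximal-^ {d} {x} (u , v , du+xv) (suc k) with comaximal-^ (u , v , du+xv) k
  ... | u′ , v′ , eq = u′ * u , v * (d ^ k) * u′ + v′ , (begin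
    (d * (d ^ k)) * (u′ * u) + x * (v * (d ^ k) * u′ + v′)
      ≈⟨ solve 7 (λ d D u u′ v v′ x → (d :* D) :* (u′ :* u) :+ x :* (v :* D :* u′ :+ v′) :=
           D :* u′ :* (d :* u :+ x :* v) :+ x :* v′) refl d (d ^ k) u u′ v v′ x ⟩
    (d ^ k) * u′ * (d * u + x * v) + x * v′
      ≈⟨ +-congʳ (trans (*-congˡ du+xv) (*-identityʳ _)) ⟩
    (d ^ k) * u′ + x * v′    ≈⟨ eq ⟩
    1#                       ∎)

  ∣-cancel : ∀ {d x p} → Comaximal d x → d ∣ x * p → d ∣ p
  ∣-cancel {d} {x} {p} (u , v , eq) (q , qd≈xp) = u * p + v * q , (begin
    (u * p + v * q) * d
      ≈⟨ solve 5 (λ u v p q d → (u :* p :+ v :* q) :* d := d :* u :* p :+ v :* (q :* d)) refl u v p q d ⟩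
    d * u * p + v * (q * d)     ≈⟨ +-congˡ (*-congˡ qd≈xp) ⟩
    d * u * p + v * (x * p)
      ≈⟨ solve 5 (λ u v p x d → d :* u :* p :+ v :* (x :* p) := (d :* u :+ x :* v) :* p) refl u v p x d ⟩
    (d * u + x * v) * p         ≈⟨ trans (*-congʳ eq) (*-identityˡ p) ⟩
    p                           ∎)

  ∣-cancel-^ : ∀ {d x p} → Comaximal d x → ∀ j → d ∣ (x ^ j) * p → d ∣ p
  ∣-cancel-^ c zero    (q , e) = q , trans e (*-identityˡ _)
  ∣-cancel-^ c (suc j) (q , e) = ∣-cancel-^ c j (∣-cancel c (q , trans e (*-assoc _ _ _)))

module CharacteristicPolynomial (R : CommutativeRing 0ℓ 0ℓ) where
  open CommutativeRing R hiding (zero; _-_)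
  open Polynomials rawRing
  open PolynomialRing R
  open RawRing polyRawRing using () renaming (1# to 1ₚ; -_ to -ₚ_)
  open RawSemiringDefs (RawRing.rawSemiring polyRawRing) using () renaming (sum to sumₚ; _^_ to _^ₚ_)
  open RawSemiringDefs (RawRing.rawSemiring rawRing) using (_^_)
  open MatrixOps rawRing using (det; 1ᴹ; _⊠_)
  open MatrixOps polyRawRing using (_⊟_; diag) renaming (det to detₚ)
  open SumProperties semiring using (sum; sum-cong-≋)

  coeff-sum : ∀ {n} (f : Vector Poly n) k → coeff (sumₚ f) k ≈ sum (λ i → coeff (f i) k)
  coeff-sum {zero}  f k = refl
  coeff-sum {suc n} f k = trans (coeff-+ (f zero) (sumₚ (f ∘ suc)) k) (+-congˡ (coeff-sum (f ∘ suc) k))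

  coeff-constant-* : ∀ a p k → coeff (constant a *ₚ p) k ≈ a * coeff p k
  coeff-constant-* a p k = trans (coeff-+ (map (a *_) p) (0# ∷ []) k)
    (trans (+-cong (coeff-scale a p k) (vanish k)) (+-identityʳ _))
    where
    vanish : ∀ k → coeff (0# ∷ []) k ≈ 0#
    vanish zero    = refl
    vanish (suc k) = refl

  coeff-sign-* : ∀ j p k → coeff (((-ₚ 1ₚ) ^ₚ j) *ₚ p) k ≈ ((- 1#) ^ j) * coeff p k
  coeff-sign-* zero    p k = coeff-constant-* 1# p k
  coeff-sign-* (suc j) p k = trans (CommutativeRing.*-assoc polynomialRing (-ₚ 1ₚ) ((-ₚ 1ₚ) ^ₚ j) p k) (trans
    (coeff-constant-* (- 1#) (((-ₚ 1ₚ) ^ₚ j) *ₚ p) k)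
    (trans (*-congˡ (coeff-sign-* j p k)) (sym (*-assoc _ _ _))))

  DegreeAtMost : ℕ → Poly → Set
  DegreeAtMost n p = ∀ k → n ℕ.< k → coeff p k ≈ 0#

  coeff-linear-* : ∀ p q → DegreeAtMost 1 p → ∀ k →
    coeff (p *ₚ q) (suc k) ≈ coeff p 0 * coeff q (suc k) + coeff p 1 * coeff q k
  coeff-linear-* p q p≤1 k = begin
    coeff (p *ₚ q) (suc k)
      -- `p` is replaced by the list of its first two coefficients, on which `_*ₚ_` unfolds.
      ≈⟨ CommutativeRing.*-congʳ polynomialRing {q} {p} {coeff p 0 ∷ constant (coeff p 1)}
        (λ { 0 → refl ; 1 → refl ; (suc (suc k)) → p≤1 _ (ℕ.s≤s (ℕ.s≤s ℕ.z≤n)) }) (suc k) ⟩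
    coeff (map (coeff p 0 *_) q +ₚ (0# ∷ constant (coeff p 1) *ₚ q)) (suc k)
                              ≈⟨ coeff-+ (map (coeff p 0 *_) q) (0# ∷ constant (coeff p 1) *ₚ q) (suc k) ⟩
    coeff (map (coeff p 0 *_) q) (suc k) + coeff (constant (coeff p 1) *ₚ q) k
                              ≈⟨ +-cong (coeff-scale (coeff p 0) q (suc k)) (coeff-constant-* (coeff p 1) q k) ⟩
    coeff p 0 * coeff q (suc k) + coeff p 1 * coeff q k    ∎
    where open import Relation.Binary.Reasoning.Setoid setoid

  -- An entry of degree at most 1 raises the degree of its minor by at most one, so the coefficient
  -- of order `n` collects exactly the products of linear coefficients.
  det-degree : ∀ {n} (M : Matrix Poly n n) → (∀ i j → DegreeAtMost 1 (M i j)) →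
    DegreeAtMost n (detₚ M) × coeff (detₚ M) n ≈ det (λ i j → coeff (M i j) 1)
  det-degree {zero}  M M≤1 = (λ { (suc k) _ → refl }) , refl
  det-degree {suc n} M M≤1 =
    (λ { (suc k) (ℕ.s≤s n<k) → trans (coeff-det (suc k)) (trans
      (sum-cong-≋ λ j → trans (*-congˡ {(- 1#) ^ toℕ j} (trans (entry j k) (trans (+-cong
          (trans (*-congˡ (proj₁ (minor j) (suc k) (ℕₚ.m≤n⇒m≤1+n n<k))) (zeroʳ _))
          (trans (*-congˡ (proj₁ (minor j) k n<k)) (zeroʳ _)))
        (+-identityʳ 0#)))) (zeroʳ _))
      (SumProperties.sum-replicate-zero semiring (suc n))) }) ,
    trans (coeff-det (suc n)) (sum-cong-≋ λ j → *-congˡ {(- 1#) ^ toℕ j} (trans (entry j n) (trans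
      (+-cong (trans (*-congˡ (proj₁ (minor j) (suc n) ℕₚ.≤-refl)) (zeroʳ _)) (*-congˡ (proj₂ (minor j))))
      (+-identityˡ _))))
    where
    M′ : Fin (suc n) → Matrix Poly n n
    M′ j i k = M (suc i) (punchIn j k)
    minor : ∀ j → DegreeAtMost n (detₚ (M′ j)) × coeff (detₚ (M′ j)) n ≈ det (λ i l → coeff (M′ j i l) 1)
    minor j = det-degree (M′ j) λ i l → M≤1 (suc i) (punchIn j l)
    entry : ∀ j k → coeff (M zero j *ₚ detₚ (M′ j)) (suc k) ≈
      coeff (M zero j) 0 * coeff (detₚ (M′ j)) (suc k) + coeff (M zero j) 1 * coeff (detₚ (M′ j)) k
    entry j = coeff-linear-* (M zero j) (detₚ (M′ j)) (M≤1 zero j)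
    coeff-det : ∀ k → coeff (detₚ M) k ≈ sum (λ j → ((- 1#) ^ toℕ j) * coeff (M zero j *ₚ detₚ (M′ j)) k)
    coeff-det k = trans (coeff-sum (λ j → ((-ₚ 1ₚ) ^ₚ toℕ j) *ₚ (M zero j *ₚ detₚ (M′ j))) k)
      (sum-cong-≋ λ j → coeff-sign-* (toℕ j) (M zero j *ₚ detₚ (M′ j)) k)

  characteristic : ∀ {n} → Matrix Carrier n n → Matrix Poly n n
  characteristic M = diag (const X) ⊟ mapMatrix constant M

  -- The linear coefficients of the characteristic matrix form the identity matrix. Over the
  -- integers this certifies that a root of the polynomial satisfies a nonzero equation.
  charPoly-monic : ∀ {n} (M : Matrix Carrier n n) → coeff (detₚ (characteristic M)) n ≈ 1#
  charPoly-monic {n} M = trans (proj₂ (det-degree (characteristic M) degree))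
    (trans (Determinants.det-cong R leading) (Determinants.det-1ᴹ R n))
    where
    degree : ∀ i j → DegreeAtMost 1 (characteristic M i j)
    degree i j with i ≟ j
    ... | yes _ = λ { (suc (suc k)) _ → refl ; 1 (ℕ.s≤s ()) }
    ... | no _  = λ { (suc (suc k)) _ → refl ; 1 (ℕ.s≤s ()) }
    leading : ∀ i j → coeff (characteristic M i j) 1 ≈ 1ᴹ i j
    leading i j with i ≟ j
    ... | yes _ = refl
    ... | no _  = refl

  open Determinants polynomialRing using (sylvester)

  -- Sylvester's identity over the polynomial ring at `x = X`; `constant` commutes with matrix
  -- products.
  charPoly-swap : ∀ {m n} (A : Matrix Carrier m n) (B : Matrix Carrier n m) →
    (X ^ₚ n) *ₚ detₚ (characteristic (A ⊠ B)) ≈ₚ (X ^ₚ m) *ₚ detₚ (characteristic (B ⊠ A))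
  charPoly-swap {m} {n} A B = begin
    (X ^ₚ n) *ₚ detₚ (characteristic (A ⊠ B))    ≈⟨ product (X ^ₚ n) A B ⟩
    (X ^ₚ n) *ₚ detₚ (diag (const X) ⊟ (mapMatrix constant A ⊠ₚ mapMatrix constant B))
      ≈⟨ sylvester X (mapMatrix constant A) (mapMatrix constant B) ⟩
    (X ^ₚ m) *ₚ detₚ (diag (const X) ⊟ (mapMatrix constant B ⊠ₚ mapMatrix constant A))
      ≈⟨ product (X ^ₚ m) B A ⟨
    (X ^ₚ m) *ₚ detₚ (characteristic (B ⊠ A))    ∎
    where
    open MatrixOps polyRawRing using () renaming (_⊠_ to _⊠ₚ_)
    open import Relation.Binary.Reasoning.Setoid (CommutativeRing.setoid polynomialRing)
    constant-isHom : IsRawHom rawRing polyRawRing constant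
    constant-isHom = record
      { +-homo = λ _ _ _ → refl
      ; *-homo = λ { x y zero → sym (+-identityʳ _) ; x y (suc n) → refl }
      ; -‿homo = λ _ _ → refl
      ; 0-homo = λ { zero → refl ; (suc n) → refl }
      ; 1-homo = λ _ → refl }
    product : ∀ {m n} p (A : Matrix Carrier m n) (B : Matrix Carrier n m) →
      p *ₚ detₚ (characteristic (A ⊠ B)) ≈ₚ
      p *ₚ detₚ (diag (const X) ⊟ (mapMatrix constant A ⊠ₚ mapMatrix constant B))
    product p A B = CommutativeRing.*-congˡ polynomialRing {p}
      {detₚ (characteristic (A ⊠ B))} {detₚ (diag (const X) ⊟ (mapMatrix constant A ⊠ₚ mapMatrix constant B))}
      (Determinants.det-cong polynomialRing λ i j →
        CommutativeRing.+-congˡ polynomialRing {diag (const X) i j}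
          {map -_ (constant ((A ⊠ B) i j))} {map -_ ((mapMatrix constant A ⊠ₚ mapMatrix constant B) i j)}
          (CommutativeRing.-‿cong polynomialRing
            {constant ((A ⊠ B) i j)} {(mapMatrix constant A ⊠ₚ mapMatrix constant B) i j}
            (MatrixHom.⊠-homo rawRing polynomialRing constant-isHom A B i j)))

-- Laplacians of transition matrices

module LaplacianEntries (R : RawRing 0ℓ 0ℓ) (½# : RawRing.Carrier R) where
  open RawRing R
  open MatrixOps R using (diag)

  -- The common form of the entries of the Laplacians of a transition matrix T.
  entry : ∀ {n} (d a b a′ b′ : Vector Carrier n) → Matrix Carrier n n → Matrix Carrier n n
  entry d a b a′ b′ T v w = diag d v w + - (½# * (a v * T v w * b w + a′ v * T w v * b′ w))

module TransitionLaplacians (R : CommutativeRing 0ℓ 0ℓ) (½# : CommutativeRing.Carrier R) where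
  open CommutativeRing R hiding (zero; _-_)
  open MatrixOps rawRing
  open LaplacianEntries rawRing ½#
  open RawSemiringDefs (RawRing.rawSemiring rawRing) using (_^_)
  open Determinants R using (sum-diagˡ; sum-diagʳ; det-cong; sylvester)
  open SumProperties semiring using (sum; sum-cong-≋; *-distribˡ-sum; *-distribʳ-sum; ∑-comm; ∑-distrib-+)
  open RingProperties ring using (-1*x≈-x; -‿distribˡ-*; -‿distribʳ-*)
  open import Relation.Binary.Reasoning.Setoid setoid
  open SemiringSolver commutativeSemiring using (solve; _:+_; _:*_; _:=_)

  1s : ∀ {n} → Vector Carrier n
  1s = const 1#

  private
    diag-sandwich : ∀ {n} (a b : Vector Carrier n) (T : Matrix Carrier n n) v w →
      (diag a ⊠ T ⊠ diag b) v w ≈ a v * T v w * b w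
    diag-sandwich a b T v w = trans (sum-diagʳ b w ((diag a ⊠ T) v)) (*-congʳ (sum-diagˡ a v (λ k → T k w)))

    entry-cong : ∀ {n} (d : Vector Carrier n) v w {x x′ y y′} → x ≈ x′ → y ≈ y′ →
      diag d v w + - (½# * (x + y)) ≈ diag d v w + - (½# * (x′ + y′))
    entry-cong d v w e f = +-congˡ (-‿cong (*-congˡ (+-cong e f)))

  normalized-entry : ∀ {n} (T : Matrix Carrier n n) σ τ v w →
    (1ᴹ ⊟ ½# · (diag σ ⊠ T ⊠ diag τ ⊞ diag τ ⊠ transpose T ⊠ diag σ)) v w ≈ entry 1s σ τ τ σ T v w
  normalized-entry T σ τ v w =
    entry-cong 1s v w (diag-sandwich σ τ T v w) (diag-sandwich τ σ (transpose T) v w)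

  combinatorial-entry : ∀ {n} (T : Matrix Carrier n n) φ v w →
    (diag φ ⊟ ½# · (diag φ ⊠ T ⊞ transpose T ⊠ diag φ)) v w ≈ entry φ φ 1s 1s φ T v w
  combinatorial-entry T φ v w = entry-cong φ v w
    (trans (sum-diagˡ φ v (λ k → T k w)) (sym (*-identityʳ _)))
    (trans (sum-diagʳ φ w (λ k → T k v)) (*-congʳ (sym (*-identityˡ _))))

  -- Conjugation by diag σ turns the normalized Laplacian into a matrix with entries rational in T and φ.
  normalized-det : ∀ {n} (T : Matrix Carrier n n) φ ψ σ τ x → (∀ v → σ v * σ v ≈ φ v) → (∀ v → σ v * τ v ≈ 1#) →
    (∀ v → ψ v * φ v ≈ 1#) →
    (x ^ n) * det (diag (const x) ⊟ entry 1s σ τ τ σ T) ≈ (x ^ n) * det (diag (const x) ⊟ entry 1s 1s 1s ψ φ T)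
  normalized-det {n} T φ ψ σ τ x σσ≈φ στ≈1 ψφ≈1 = begin
    (x ^ n) * det (diag (const x) ⊟ entry 1s σ τ τ σ T)
      ≈⟨ *-congˡ (det-cong λ v w → +-congˡ (-‿cong (conjugate v w))) ⟨
    -- Sylvester's identity, here for square factors, plays the part of invariance under
    -- conjugation; hence the factor `x ^ n` on both sides.
    (x ^ n) * det (diag (const x) ⊟ ((diag σ ⊠ Q) ⊠ diag τ))      ≈⟨ sylvester x (diag σ ⊠ Q) (diag τ) ⟩
    (x ^ n) * det (diag (const x) ⊟ (diag τ ⊠ (diag σ ⊠ Q)))
      ≈⟨ *-congˡ (det-cong λ v w → +-congˡ (-‿cong (unconjugate v w))) ⟩
    (x ^ n) * det (diag (const x) ⊟ Q)                            ∎
    where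
    Q : Matrix Carrier n n
    Q = entry 1s 1s 1s ψ φ T
    unconjugate : ∀ v w → (diag τ ⊠ (diag σ ⊠ Q)) v w ≈ Q v w
    unconjugate v w = begin
      (diag τ ⊠ (diag σ ⊠ Q)) v w    ≈⟨ sum-diagˡ τ v (λ k → (diag σ ⊠ Q) k w) ⟩
      τ v * (diag σ ⊠ Q) v w         ≈⟨ *-congˡ (sum-diagˡ σ v (λ k → Q k w)) ⟩
      τ v * (σ v * Q v w)            ≈⟨ *-assoc _ _ _ ⟨
      τ v * σ v * Q v w              ≈⟨ *-congʳ (trans (*-comm _ _) (στ≈1 v)) ⟩
      1# * Q v w                     ≈⟨ *-identityˡ _ ⟩
      Q v w                          ∎
    σψ≈τ : ∀ v → σ v * ψ v ≈ τ v
    σψ≈τ v = begin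
      σ v * ψ v                      ≈⟨ trans (sym (*-identityʳ _)) (*-congˡ (sym (στ≈1 v))) ⟩
      σ v * ψ v * (σ v * τ v)
        ≈⟨ solve 3 (λ s p t → s :* p :* (s :* t) := p :* (s :* s) :* t) refl (σ v) (ψ v) (τ v) ⟩
      ψ v * (σ v * σ v) * τ v        ≈⟨ *-congʳ (trans (*-congˡ (σσ≈φ v)) (ψφ≈1 v)) ⟩
      1# * τ v                       ≈⟨ *-identityˡ _ ⟩
      τ v                            ∎
    φτ≈σ : ∀ v → φ v * τ v ≈ σ v
    φτ≈σ v = begin
      φ v * τ v                      ≈⟨ *-congʳ (sym (σσ≈φ v)) ⟩
      σ v * σ v * τ v                ≈⟨ *-assoc _ _ _ ⟩
      σ v * (σ v * τ v)              ≈⟨ *-congˡ (στ≈1 v) ⟩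
      σ v * 1#                       ≈⟨ *-identityʳ _ ⟩
      σ v                            ∎
    diagonal : ∀ v w → σ v * 1ᴹ v w * τ w ≈ 1ᴹ v w
    diagonal v w with v ≟ w
    ... | yes ≡.refl = trans (*-congʳ (*-identityʳ _)) (στ≈1 v)
    ... | no _       = trans (*-congʳ (zeroʳ _)) (zeroˡ _)
    conjugate : ∀ v w → ((diag σ ⊠ Q) ⊠ diag τ) v w ≈ entry 1s σ τ τ σ T v w
    conjugate v w = begin
      ((diag σ ⊠ Q) ⊠ diag τ) v w    ≈⟨ diag-sandwich σ τ Q v w ⟩
      σ v * (1ᴹ v w + - (½# * x₀)) * τ w
        ≈⟨ *-congʳ (distribˡ _ _ _) ⟩
      (σ v * 1ᴹ v w + σ v * - (½# * x₀)) * τ w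
        ≈⟨ distribʳ _ _ _ ⟩
      σ v * 1ᴹ v w * τ w + σ v * - (½# * x₀) * τ w
        ≈⟨ +-cong (diagonal v w) (trans (*-congʳ (sym (-‿distribʳ-* _ _))) (sym (-‿distribˡ-* _ _))) ⟩
      1ᴹ v w + - (σ v * (½# * x₀) * τ w)
        ≈⟨ +-congˡ (-‿cong (trans
             (solve 8 (λ s h t one p t′ f u → s :* (h :* (one :* t :* one :+ p :* t′ :* f)) :* u :=
               h :* ((one :* one) :* (s :* t :* u) :+ (s :* p) :* t′ :* (f :* u))) refl
               (σ v) ½# (T v w) 1# (ψ v) (T w v) (φ w) (τ w))
             (*-congˡ (+-cong (trans (*-congʳ (*-identityˡ 1#)) (*-identityˡ _)) (*-cong (*-congʳ (σψ≈τ v)) (φτ≈σ w)))))) ⟩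
      entry 1s σ τ τ σ T v w         ∎
      where
      x₀ : Carrier
      x₀ = 1# * T v w * 1# + ψ v * T w v * φ w

  fundamental : ∀ {n} → Matrix Carrier n n → Matrix Carrier n n
  fundamental T v w = 1ᴹ v w + - T v w + 1#

  -- With 1 = Σ φ, an invariant φ satisfies φ (1 - T + J) = (1, …, 1), J being the all-ones matrix.
  invariant-unique : ∀ {n} (T B : Matrix Carrier n n) φ ρ → (∀ v → sum (T v) ≈ 1#) → sum φ ≈ 1# →
    (∀ w → sum (λ v → φ v * T v w) ≈ ρ * φ w) → (∀ v w → (fundamental T ⊠ B) v w ≈ 1ᴹ v w) →
    ∀ w → φ w ≈ sum (λ v → B v w)
  invariant-unique T B φ ρ stochastic total invariant inverse w = begin
    φ w                                                                 ≈⟨ *-identityʳ _ ⟨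
    φ w * 1#                                                            ≈⟨ sum-diagʳ 1s w φ ⟨
    sum (λ u → φ u * 1ᴹ u w)
      ≈⟨ sum-cong-≋ (λ u → *-congˡ {φ u} (inverse u w)) ⟨
    sum (λ u → φ u * sum (λ v → fundamental T u v * B v w))
      ≈⟨ sum-cong-≋ (λ u → trans (*-distribˡ-sum (φ u) (λ v → fundamental T u v * B v w))
        (sum-cong-≋ λ v → sym (*-assoc (φ u) (fundamental T u v) (B v w)))) ⟩
    sum (λ u → sum (λ v → φ u * fundamental T u v * B v w))
      ≈⟨ ∑-comm (λ u v → φ u * fundamental T u v * B v w) ⟩
    sum (λ v → sum (λ u → φ u * fundamental T u v * B v w))
      ≈⟨ sum-cong-≋ (λ v → sym (*-distribʳ-sum (B v w) (λ u → φ u * fundamental T u v))) ⟩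
    sum (λ v → sum (λ u → φ u * fundamental T u v) * B v w)
      ≈⟨ sum-cong-≋ (λ v → trans (*-congʳ {B v w} (ones v)) (*-identityˡ _)) ⟩
    sum (λ v → B v w)                                                   ∎
    where
    -- A Perron vector comes with an unspecified `ρ`. Summing its equation over all entries, with
    -- row sums 1, gives `ρ * sum φ ≈ sum φ`.
    ρ≈1 : ρ ≈ 1#
    ρ≈1 = begin
      ρ                                          ≈⟨ trans (sym (*-identityʳ ρ)) (*-congˡ (sym total)) ⟩
      ρ * sum φ                                  ≈⟨ *-distribˡ-sum ρ φ ⟩
      sum (λ v → ρ * φ v)                        ≈⟨ sum-cong-≋ invariant ⟨
      sum (λ v → sum (λ u → φ u * T u v))        ≈⟨ ∑-comm (λ u v → φ u * T u v) ⟨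
      sum (λ u → sum (λ v → φ u * T u v))
        ≈⟨ sum-cong-≋ (λ u → trans (sym (*-distribˡ-sum (φ u) (T u))) (trans (*-congˡ (stochastic u)) (*-identityʳ _))) ⟩
      sum φ                                      ≈⟨ total ⟩
      1#                                         ∎
    ones : ∀ v → sum (λ u → φ u * fundamental T u v) ≈ 1#
    ones v = begin
      sum (λ u → φ u * fundamental T u v)
        ≈⟨ sum-cong-≋ (λ u → trans (distribˡ (φ u) _ 1#) (+-cong (distribˡ (φ u) _ _) (*-identityʳ (φ u)))) ⟩
      sum (λ u → φ u * 1ᴹ u v + φ u * - T u v + φ u)
        ≈⟨ trans (∑-distrib-+ (λ u → φ u * 1ᴹ u v + φ u * - T u v) φ)
             (+-congʳ (∑-distrib-+ (λ u → φ u * 1ᴹ u v) (λ u → φ u * - T u v))) ⟩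
      sum (λ u → φ u * 1ᴹ u v) + sum (λ u → φ u * - T u v) + sum φ
        ≈⟨ +-cong (+-cong (trans (sum-diagʳ 1s v φ) (*-identityʳ _)) negated) total ⟩
      φ v + - φ v + 1#    ≈⟨ trans (+-congʳ (-‿inverseʳ _)) (+-identityˡ _) ⟩
      1#                  ∎
      where
      negated : sum (λ u → φ u * - T u v) ≈ - φ v
      negated = begin
        sum (λ u → φ u * - T u v)
          ≈⟨ sum-cong-≋ (λ u → trans (sym (-‿distribʳ-* (φ u) (T u v))) (sym (-1*x≈-x _))) ⟩
        sum (λ u → - 1# * (φ u * T u v))      ≈⟨ *-distribˡ-sum (- 1#) (λ u → φ u * T u v) ⟨
        - 1# * sum (λ u → φ u * T u v)        ≈⟨ -1*x≈-x _ ⟩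
        - sum (λ u → φ u * T u v)
          ≈⟨ -‿cong (trans (invariant v) (trans (*-congʳ ρ≈1) (*-identityˡ _))) ⟩
        - φ v                                 ∎

module EntryHom (A : RawRing 0ℓ 0ℓ) (R : CommutativeRing 0ℓ 0ℓ)
  {h : RawRing.Carrier A → CommutativeRing.Carrier R} (isHom : IsRawHom A (CommutativeRing.rawRing R) h)
  (½ᴬ : RawRing.Carrier A) where
  open CommutativeRing R hiding (zero; _-_)
  open IsRawHom isHom
  open MatrixOps rawRing using (diag)
  open LaplacianEntries rawRing (h ½ᴬ)
  private module A where
    open RawRing A public
    open MatrixOps A public using (diag)
    open LaplacianEntries A ½ᴬ public

  entry-homo : ∀ {n} {d a b a′ b′ : Vector Carrier n} {T : Matrix Carrier n n}
    {d₀ a₀ b₀ a₀′ b₀′ : Vector A.Carrier n} {T₀ : Matrix A.Carrier n n} →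
    (∀ v → d v ≈ h (d₀ v)) → (∀ v → a v ≈ h (a₀ v)) → (∀ v → b v ≈ h (b₀ v)) →
    (∀ v → a′ v ≈ h (a₀′ v)) → (∀ v → b′ v ≈ h (b₀′ v)) → (∀ v w → T v w ≈ h (T₀ v w)) →
    ∀ v w → entry d a b a′ b′ T v w ≈ h (A.entry d₀ a₀ b₀ a₀′ b₀′ T₀ v w)
  entry-homo {d = d} {d₀ = d₀} d≈ a≈ b≈ a′≈ b′≈ T≈ v w = sym (trans (+-homo _ _) (+-cong diag≈
    (trans (-‿homo _) (-‿cong (trans (*-homo _ _) (*-congˡ (trans (+-homo _ _) (+-cong
      (product (a≈ v) (T≈ v w) (b≈ w)) (product (a′≈ v) (T≈ w v) (b′≈ w))))))))))
    where
    product : ∀ {x y z x₀ y₀ z₀} → x ≈ h x₀ → y ≈ h y₀ → z ≈ h z₀ → h (x₀ A.* y₀ A.* z₀) ≈ x * y * z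
    product e f g = trans (*-homo _ _) (*-cong (trans (*-homo _ _) (*-cong (sym e) (sym f))) (sym g))
    diag≈ : h (A.diag d₀ v w) ≈ diag d v w
    diag≈ with v ≟ w
    ... | yes _ = sym (d≈ v)
    ... | no _  = 0-homo

-- Real and complex numbers

module ℚSolver = +-*-Solver

-- By definition `x ≈ʳ y` says that the sequence of differences is `Null`, so the laws of real
-- arithmetic reduce to closure properties of null sequences and rational identities at each index.
Null : (ℕ → ℚ) → Set
Null u = ∀ ε → 0ℚ ℚ.< ε → ∃ λ N → ∀ n → N ≤ n → ∣ u n ∣ ℚ.< ε

EventuallyBounded : (ℕ → ℚ) → Set
EventuallyBounded u = ∃₂ λ B N → 0ℚ ℚ.< B × (∀ n → N ≤ n → ∣ u n ∣ ℚ.< B)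

0<* : ∀ {p q} → 0ℚ ℚ.< p → 0ℚ ℚ.< q → 0ℚ ℚ.< p ℚ.* q
0<* {p} {q} 0<p 0<q = ≡.subst (ℚ._< p ℚ.* q) (ℚₚ.*-zeroˡ q) (ℚₚ.*-monoˡ-<-pos q {{ℚ.positive 0<q}} 0<p)

null-≗ : ∀ {u v} → (∀ n → u n ≡ v n) → Null u → Null v
null-≗ u≗v null ε 0<ε with null ε 0<ε
... | N , h = N , λ n N≤n → ≡.subst (λ q → ∣ q ∣ ℚ.< ε) (u≗v n) (h n N≤n)

null-0 : Null (const 0ℚ)
null-0 ε 0<ε = 0 , λ _ _ → 0<ε

null-neg : ∀ {u} → Null u → Null (λ n → ℚ.- u n)
null-neg {u} null ε 0<ε with null ε 0<ε
... | N , h = N , λ n N≤n → ≡.subst (ℚ._< ε) (≡.sym (ℚₚ.∣-p∣≡∣p∣ (u n))) (h n N≤n)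

null-+ : ∀ {u v} → Null u → Null v → Null (λ n → u n ℚ.+ v n)
null-+ {u} {v} nu nv ε 0<ε with nu (½ ℚ.* ε) (0<* (ℚₚ.positive⁻¹ ½) 0<ε) | nv (½ ℚ.* ε) (0<* (ℚₚ.positive⁻¹ ½) 0<ε)
... | M , h | N , k = M ⊔ N , λ n ≤n → begin-strict
  ∣ u n ℚ.+ v n ∣          ≤⟨ ℚₚ.∣p+q∣≤∣p∣+∣q∣ (u n) (v n) ⟩
  ∣ u n ∣ ℚ.+ ∣ v n ∣      <⟨ ℚₚ.+-mono-< (h n (ℕₚ.m⊔n≤o⇒m≤o M N ≤n)) (k n (ℕₚ.m⊔n≤o⇒n≤o M N ≤n)) ⟩
  ½ ℚ.* ε ℚ.+ ½ ℚ.* ε      ≡⟨ ≡.trans (≡.sym (ℚₚ.*-distribʳ-+ ε ½ ½)) (ℚₚ.*-identityˡ ε) ⟩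
  ε                        ∎
  where open ℚₚ.≤-Reasoning

null-* : ∀ {u v} → Null u → EventuallyBounded v → Null (λ n → u n ℚ.* v n)
null-* {u} {v} nu (B , M , 0<B , bound) ε 0<ε = combine (nu (ε ℚ.* 1/B) (0<* 0<ε 0<1/B))
  where
  instance
    B-pos : ℚ.Positive B
    B-pos = ℚ.positive 0<B
    B≢0 : ℚ.NonZero B
    B≢0 = ℚₚ.pos⇒nonZero B
  1/B : ℚ
  1/B = ℚ.1/ B
  0<1/B : 0ℚ ℚ.< 1/B
  0<1/B = ℚₚ.positive⁻¹ 1/B {{ℚₚ.1/pos⇒pos B}}
  combine : (∃ λ N → ∀ n → N ≤ n → ∣ u n ∣ ℚ.< ε ℚ.* 1/B) →
    ∃ λ N → ∀ n → N ≤ n → ∣ u n ℚ.* v n ∣ ℚ.< ε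
  combine (N , h) = M ⊔ N , λ n ≤n → begin-strict
    ∣ u n ℚ.* v n ∣        ≡⟨ ℚₚ.∣p*q∣≡∣p∣*∣q∣ (u n) (v n) ⟩
    ∣ u n ∣ ℚ.* ∣ v n ∣
      ≤⟨ ℚₚ.*-monoˡ-≤-nonNeg ∣ u n ∣ {{ℚₚ.∣-∣-nonNeg (u n)}} (ℚₚ.<⇒≤ (bound n (ℕₚ.m⊔n≤o⇒m≤o M N ≤n))) ⟩
    ∣ u n ∣ ℚ.* B          <⟨ ℚₚ.*-monoˡ-<-pos B (h n (ℕₚ.m⊔n≤o⇒n≤o M N ≤n)) ⟩
    ε ℚ.* 1/B ℚ.* B        ≡⟨ ℚₚ.*-assoc ε 1/B B ⟩
    ε ℚ.* (1/B ℚ.* B)      ≡⟨ ≡.cong (ε ℚ.*_) (ℚₚ.*-inverseˡ B) ⟩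
    ε ℚ.* 1ℚ               ≡⟨ ℚₚ.*-identityʳ ε ⟩
    ε                      ∎
    where open ℚₚ.≤-Reasoning

bounded : ∀ x → EventuallyBounded (seq x)
bounded x = eventually-bounded (seq x) (cauchy x)

-- Stated for sequences rather than for reals x ≈ʳ y, so that Agda can infer them.
pointwise : ∀ {u v : ℕ → ℚ} → (∀ n → u n ≡ v n) → Null (λ n → u n ℚ.- v n)
pointwise {u} {v} eq = null-≗
  (λ n → ≡.trans (≡.sym (ℚₚ.+-inverseʳ (v n))) (≡.cong (ℚ._- v n) (≡.sym (eq n)))) null-0

≈0⇒null : ∀ {x} → x ≈ʳ 0ʳ → Null (seq x)
≈0⇒null = null-≗ λ n → ℚₚ.+-identityʳ _

null⇒≈0 : ∀ {x} → Null (seq x) → x ≈ʳ 0ʳ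
null⇒≈0 = null-≗ λ n → ≡.sym (ℚₚ.+-identityʳ _)

≈ʳ-sym : ∀ {x y} → x ≈ʳ y → y ≈ʳ x
≈ʳ-sym {x} {y} e = null-≗ (λ n → solve 2 (λ a b → :- (a :- b) := b :- a) ≡.refl (seq x n) (seq y n)) (null-neg e)
  where open ℚSolver

≈ʳ-trans : ∀ {x y z} → x ≈ʳ y → y ≈ʳ z → x ≈ʳ z
≈ʳ-trans {x} {y} {z} e f = null-≗
  (λ n → solve 3 (λ a b c → (a :- b) :+ (b :- c) := a :- c) ≡.refl (seq x n) (seq y n) (seq z n)) (null-+ e f)
  where open ℚSolver

+ʳ-cong : ∀ {x x′ y y′} → x ≈ʳ x′ → y ≈ʳ y′ → x +ʳ y ≈ʳ x′ +ʳ y′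
+ʳ-cong {x} {x′} {y} {y′} e f = null-≗
  (λ n → solve 4 (λ a a′ b b′ → (a :- a′) :+ (b :- b′) := (a :+ b) :- (a′ :+ b′))
      ≡.refl (seq x n) (seq x′ n) (seq y n) (seq y′ n))
  (null-+ e f)
  where open ℚSolver

*ʳ-cong : ∀ {x x′ y y′} → x ≈ʳ x′ → y ≈ʳ y′ → x *ʳ y ≈ʳ x′ *ʳ y′
*ʳ-cong {x} {x′} {y} {y′} e f = null-≗
  (λ n → solve 4 (λ a a′ b b′ → (a :- a′) :* b :+ (b :- b′) :* a′ := a :* b :- a′ :* b′)
      ≡.refl (seq x n) (seq x′ n) (seq y n) (seq y′ n))
  (null-+ (null-* e (bounded y)) (null-* f (bounded x′)))
  where open ℚSolver

-ʳ-cong : ∀ {x x′} → x ≈ʳ x′ → -ʳ x ≈ʳ -ʳ x′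
-ʳ-cong {x} {x′} e = null-≗ (λ n → solve 2 (λ a a′ → :- (a :- a′) := (:- a) :- (:- a′)) ≡.refl (seq x n) (seq x′ n))
  (null-neg e)
  where open ℚSolver

ℝ-commutativeRing : CommutativeRing 0ℓ 0ℓ
ℝ-commutativeRing = record
  { Carrier = ℝ ; _≈_ = _≈ʳ_ ; _+_ = _+ʳ_ ; _*_ = _*ʳ_ ; -_ = -ʳ_ ; 0# = 0ʳ ; 1# = 1ʳ
  ; isCommutativeRing = record
    { isRing = record
      { +-isAbelianGroup = record
        { isGroup = record
          { isMonoid = record
            { isSemigroup = record
              { isMagma = record
                { isEquivalence = record
                  { refl = λ {x} → pointwise {seq x} (λ _ → ≡.refl)
                  ; sym = λ {x} {y} → ≈ʳ-sym {x} {y}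
                  ; trans = λ {x} {y} {z} → ≈ʳ-trans {x} {y} {z} }
                ; ∙-cong = λ {x} {x′} {y} {y′} → +ʳ-cong {x} {x′} {y} {y′} }
              ; assoc = λ x y z → pointwise (λ n → ℚₚ.+-assoc (seq x n) (seq y n) (seq z n)) }
            ; identity = (λ x → pointwise (λ n → ℚₚ.+-identityˡ (seq x n)))
                       , (λ x → pointwise (λ n → ℚₚ.+-identityʳ (seq x n))) }
          ; inverse = (λ x → pointwise (λ n → ℚₚ.+-inverseˡ (seq x n)))
                    , (λ x → pointwise (λ n → ℚₚ.+-inverseʳ (seq x n)))
          ; ⁻¹-cong = λ {x} {y} → -ʳ-cong {x} {y} }
        ; comm = λ x y → pointwise (λ n → ℚₚ.+-comm (seq x n) (seq y n)) }
      ; *-cong = λ {x} {x′} {y} {y′} → *ʳ-cong {x} {x′} {y} {y′}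
      ; *-assoc = λ x y z → pointwise (λ n → ℚₚ.*-assoc (seq x n) (seq y n) (seq z n))
      ; *-identity = (λ x → pointwise (λ n → ℚₚ.*-identityˡ (seq x n)))
                   , (λ x → pointwise (λ n → ℚₚ.*-identityʳ (seq x n)))
      ; distrib = (λ x y z → pointwise (λ n → ℚₚ.*-distribˡ-+ (seq x n) (seq y n) (seq z n)))
                , (λ x y z → pointwise (λ n → ℚₚ.*-distribʳ-+ (seq x n) (seq y n) (seq z n))) }
    ; *-comm = λ x y → pointwise (λ n → ℚₚ.*-comm (seq x n) (seq y n)) } }

ℚ-rawRing : RawRing 0ℓ 0ℓ
ℚ-rawRing = record
  { Carrier = ℚ ; _≈_ = _≡_ ; _+_ = ℚ._+_ ; _*_ = ℚ._*_ ; -_ = ℚ.-_ ; 0# = 0ℚ ; 1# = 1ℚ }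

≈ʳ-refl : ∀ {x} → x ≈ʳ x
≈ʳ-refl {x} = pointwise {seq x} λ _ → ≡.refl

ℚ⇒ℝ-isHom : IsRawHom ℚ-rawRing ℝ-rawRing ℚ⇒ℝ
ℚ⇒ℝ-isHom = record
  { +-homo = λ x y → pointwise {const (x ℚ.+ y)} λ _ → ≡.refl
  ; *-homo = λ x y → pointwise {const (x ℚ.* y)} λ _ → ≡.refl
  ; -‿homo = λ x → pointwise {const (ℚ.- x)} λ _ → ≡.refl
  ; 0-homo = ≈ʳ-refl {0ʳ}
  ; 1-homo = ≈ʳ-refl {1ʳ} }

≡⇒≈ʳ : ∀ {x y} → x ≡ y → ℚ⇒ℝ x ≈ʳ ℚ⇒ℝ y
≡⇒≈ʳ {x} ≡.refl = ≈ʳ-refl {ℚ⇒ℝ x}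

ℂ-commutativeRing : CommutativeRing 0ℓ 0ℓ
ℂ-commutativeRing = record
  { RawRing ℂ-rawRing
  ; isCommutativeRing = record
    { isRing = record
      { +-isAbelianGroup = record
        { isGroup = record
          { isMonoid = record
            { isSemigroup = record
              { isMagma = record
                { isEquivalence = record
                  { refl = λ {z} → ≈ʳ-refl {re z} , ≈ʳ-refl {im z}
                  ; sym = λ {z} {w} (e , f) → ≈ʳ-sym {re z} {re w} e , ≈ʳ-sym {im z} {im w} f
                  ; trans = λ {x} {y} {z} (e , f) (e′ , f′) →
                      ≈ʳ-trans {re x} {re y} {re z} e e′ , ≈ʳ-trans {im x} {im y} {im z} f f′ }
                ; ∙-cong = λ {x} {x′} {y} {y′} (e , f) (e′ , f′) →
                    Rℝ.+-cong {re x} {re x′} {re y} {re y′} e e′ , Rℝ.+-cong {im x} {im x′} {im y} {im y′} f f′ }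
              ; assoc = λ (a +i b) (c +i d) (e +i f) → Rℝ.+-assoc a c e , Rℝ.+-assoc b d f }
            ; identity = (λ (a +i b) → Rℝ.+-identityˡ a , Rℝ.+-identityˡ b) ,
                (λ (a +i b) → Rℝ.+-identityʳ a , Rℝ.+-identityʳ b) }
          ; inverse = (λ (a +i b) → Rℝ.-‿inverseˡ a , Rℝ.-‿inverseˡ b) , (λ (a +i b) → Rℝ.-‿inverseʳ a , Rℝ.-‿inverseʳ b)
          ; ⁻¹-cong = λ {x} {y} (e , f) → Rℝ.-‿cong {re x} {re y} e , Rℝ.-‿cong {im x} {im y} f }
        ; comm = λ (a +i b) (c +i d) → Rℝ.+-comm a c , Rℝ.+-comm b d }
      ; *-cong = λ {x} {x′} {y} {y′} (e , f) (e′ , f′) →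
          Rℝ.+-cong {re x *ʳ re y} {re x′ *ʳ re y′} { -ʳ (im x *ʳ im y)} { -ʳ (im x′ *ʳ im y′)}
            (Rℝ.*-cong {re x} {re x′} {re y} {re y′} e e′)
            (Rℝ.-‿cong {im x *ʳ im y} {im x′ *ʳ im y′} (Rℝ.*-cong {im x} {im x′} {im y} {im y′} f f′)) ,
          Rℝ.+-cong {re x *ʳ im y} {re x′ *ʳ im y′} {im x *ʳ re y} {im x′ *ʳ re y′}
            (Rℝ.*-cong {re x} {re x′} {im y} {im y′} e f′) (Rℝ.*-cong {im x} {im x′} {re y} {re y′} f e′)
      ; *-assoc = λ (a +i b) (c +i d) (e +i f) →
          pointwise (λ n → solve 6 (λ a b c d e f → (a :* c :- b :* d) :* e :- (a :* d :+ b :* c) :* f :=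
            a :* (c :* e :- d :* f) :- b :* (c :* f :+ d :* e))
              ≡.refl (seq a n) (seq b n) (seq c n) (seq d n) (seq e n) (seq f n)) ,
          pointwise (λ n → solve 6 (λ a b c d e f → (a :* c :- b :* d) :* f :+ (a :* d :+ b :* c) :* e :=
            a :* (c :* f :+ d :* e) :+ b :* (c :* e :- d :* f))
              ≡.refl (seq a n) (seq b n) (seq c n) (seq d n) (seq e n) (seq f n))
      ; *-identity = (λ (a +i b) → *-1 a b) , (λ (a +i b) → 1-* a b)
      ; distrib =
          (λ (a +i b) (c +i d) (e +i f) →
            pointwise (λ n → solve 6 (λ a b c d e f → a :* (c :+ e) :- b :* (d :+ f) :=
              (a :* c :- b :* d) :+ (a :* e :- b :* f)) ≡.refl (seq a n) (seq b n) (seq c n) (seq d n) (seq e n) (seq f n)) ,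
            pointwise (λ n → solve 6 (λ a b c d e f → a :* (d :+ f) :+ b :* (c :+ e) :=
              (a :* d :+ b :* c) :+ (a :* f :+ b :* e)) ≡.refl (seq a n) (seq b n) (seq c n) (seq d n) (seq e n) (seq f n))) ,
          (λ (a +i b) (c +i d) (e +i f) →
            pointwise (λ n → solve 6 (λ a b c d e f → (c :+ e) :* a :- (d :+ f) :* b :=
              (c :* a :- d :* b) :+ (e :* a :- f :* b)) ≡.refl (seq a n) (seq b n) (seq c n) (seq d n) (seq e n) (seq f n)) ,
            pointwise (λ n → solve 6 (λ a b c d e f → (c :+ e) :* b :+ (d :+ f) :* a :=
              (c :* b :+ d :* a) :+ (e :* b :+ f :* a)) ≡.refl (seq a n) (seq b n) (seq c n) (seq d n) (seq e n) (seq f n))) }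
    ; *-comm = λ (a +i b) (c +i d) →
        pointwise (λ n → solve 4 (λ a b c d → a :* c :- b :* d := c :* a :- d :* b)
          ≡.refl (seq a n) (seq b n) (seq c n) (seq d n)) ,
        pointwise (λ n → solve 4 (λ a b c d → a :* d :+ b :* c := c :* b :+ d :* a)
          ≡.refl (seq a n) (seq b n) (seq c n) (seq d n)) } }
  where
  module Rℝ = CommutativeRing ℝ-commutativeRing
  open ℚSolver
  *-1 : ∀ a b → RawRing._≈_ ℂ-rawRing (RawRing._*_ ℂ-rawRing (ℝ⇒ℂ 1ʳ) (a +i b)) (a +i b)
  *-1 a b =
    pointwise (λ n → solve 2 (λ a b → con 1ℚ :* a :- con 0ℚ :* b := a) ≡.refl (seq a n) (seq b n)) ,
    pointwise (λ n → solve 2 (λ a b → con 1ℚ :* b :+ con 0ℚ :* a := b) ≡.refl (seq a n) (seq b n))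
  1-* : ∀ a b → RawRing._≈_ ℂ-rawRing (RawRing._*_ ℂ-rawRing (a +i b) (ℝ⇒ℂ 1ʳ)) (a +i b)
  1-* a b =
    pointwise (λ n → solve 2 (λ a b → a :* con 1ℚ :- b :* con 0ℚ := a) ≡.refl (seq a n) (seq b n)) ,
    pointwise (λ n → solve 2 (λ a b → a :* con 0ℚ :+ b :* con 1ℚ := b) ≡.refl (seq a n) (seq b n))

/1-isHom : IsRawHom ℤ.+-*-rawRing ℚ-rawRing (λ n → n ℚ./ 1)
/1-isHom = record
  { +-homo = λ m n → toℚᵘ-injective (begin
      toℚᵘ ((m ℤ.+ n) ℚ./ 1)                       ≈⟨ toℚᵘ-/1 (m ℤ.+ n) ⟩
      mkℚᵘ (m ℤ.+ n) 0
        ≈⟨ *≡* (≡.cong (ℤ._* ℤ.1ℤ) (≡.cong₂ ℤ._+_ (≡.sym (ℤₚ.*-identityʳ m)) (≡.sym (ℤₚ.*-identityʳ n)))) ⟩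
      mkℚᵘ m 0 ℚᵘ.+ mkℚᵘ n 0                       ≈⟨ ℚᵘₚ.+-cong (toℚᵘ-/1 m) (toℚᵘ-/1 n) ⟨
      toℚᵘ (m ℚ./ 1) ℚᵘ.+ toℚᵘ (n ℚ./ 1)           ≈⟨ toℚᵘ-homo-+ (m ℚ./ 1) (n ℚ./ 1) ⟨
      toℚᵘ (m ℚ./ 1 ℚ.+ n ℚ./ 1)                   ∎)
  ; *-homo = λ m n → toℚᵘ-injective (begin
      toℚᵘ ((m ℤ.* n) ℚ./ 1)                       ≈⟨ toℚᵘ-/1 (m ℤ.* n) ⟩
      mkℚᵘ m 0 ℚᵘ.* mkℚᵘ n 0                       ≈⟨ ℚᵘₚ.*-cong (toℚᵘ-/1 m) (toℚᵘ-/1 n) ⟨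
      toℚᵘ (m ℚ./ 1) ℚᵘ.* toℚᵘ (n ℚ./ 1)           ≈⟨ toℚᵘ-homo-* (m ℚ./ 1) (n ℚ./ 1) ⟨
      toℚᵘ ((m ℚ./ 1) ℚ.* (n ℚ./ 1))                   ∎)
  ; -‿homo = λ n → toℚᵘ-injective (begin
      toℚᵘ ((ℤ.- n) ℚ./ 1)                         ≈⟨ toℚᵘ-/1 (ℤ.- n) ⟩
      ℚᵘ.- mkℚᵘ n 0                                ≈⟨ ℚᵘₚ.-‿cong (toℚᵘ-/1 n) ⟨
      ℚᵘ.- toℚᵘ (n ℚ./ 1)                          ≈⟨ toℚᵘ-homo‿- (n ℚ./ 1) ⟨
      toℚᵘ (ℚ.- (n ℚ./ 1))                         ∎)
  ; 0-homo = ≡.refl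
  ; 1-homo = ≡.refl }
  where
  open ℚₚ using (toℚᵘ-injective; toℚᵘ-homo-+; toℚᵘ-homo-*; toℚᵘ-homo‿-)
  open import Relation.Binary.Reasoning.Setoid ℚᵘₚ.≃-setoid
  toℚᵘ-/1 : ∀ n → toℚᵘ (n ℚ./ 1) ≃ mkℚᵘ n 0
  toℚᵘ-/1 n = ℚₚ.toℚᵘ-fromℚᵘ (mkℚᵘ n 0)

/1-reflects-0 : ∀ a → a ℚ./ 1 ≡ 0ℚ → a ≡ ℤ.0ℤ
/1-reflects-0 a eq with ℚₚ./-injective-≃ (mkℚᵘ a 0) (mkℚᵘ ℤ.0ℤ 0) eq
... | *≡* e = ≡.trans (≡.sym (ℤₚ.*-identityʳ a)) e

ℚ[i] : Set
ℚ[i] = ℚ × ℚ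

ℚ[i]⇒ℂ : ℚ[i] → ℂ
ℚ[i]⇒ℂ (a , b) = ℚ⇒ℝ a +i ℚ⇒ℝ b

module Rℝ = CommutativeRing ℝ-commutativeRing
module Rℂ = CommutativeRing ℂ-commutativeRing

ℤ⇒ℂ-isHom : IsRawHom ℤ.+-*-rawRing ℂ-rawRing ℤ⇒ℂ
ℤ⇒ℂ-isHom = record
  { +-homo = λ m n → ≡⇒≈ʳ (+-homo m n) , ≈ʳ-refl {0ʳ}
  ; *-homo = λ m n → Rℝ.trans {ℚ⇒ℝ ((m ℤ.* n) ℚ./ 1)} {ℚ⇒ℝ ((m ℚ./ 1) ℚ.* (n ℚ./ 1))}
        {(ℚ⇒ℝ (m ℚ./ 1) *ʳ ℚ⇒ℝ (n ℚ./ 1)) +ʳ (-ʳ (0ʳ *ʳ 0ʳ))} (≡⇒≈ʳ (*-homo m n))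
      (pointwise λ _ → solve 2 (λ a b → a :* b := a :* b :- con 0ℚ :* con 0ℚ) ≡.refl (m ℚ./ 1) (n ℚ./ 1)) ,
      pointwise λ _ → solve 2 (λ a b → con 0ℚ := a :* con 0ℚ :+ con 0ℚ :* b) ≡.refl (m ℚ./ 1) (n ℚ./ 1)
  ; -‿homo = λ n → ≡⇒≈ʳ (-‿homo n) , ≈ʳ-refl {0ʳ}
  ; 0-homo = ≈ʳ-refl {0ʳ} , ≈ʳ-refl {0ʳ}
  ; 1-homo = ≈ʳ-refl {1ʳ} , ≈ʳ-refl {0ʳ} }
  where
  open IsRawHom /1-isHom
  open ℚSolver

null-const : ∀ q → Null (const q) → q ≡ 0ℚ
null-const q null with q ℚₚ.≟ 0ℚ
... | yes q≡0 = q≡0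
... | no q≢0 with null ∣ q ∣ (ℚₚ.≰⇒> λ ∣q∣≤0 → q≢0 (ℚₚ.∣p∣≡0⇒p≡0 q (ℚₚ.≤-antisym ∣q∣≤0 (ℚₚ.0≤∣p∣ q))))
... | N , h = contradiction (h N ℕₚ.≤-refl) (ℚₚ.<-irrefl ≡.refl)

ℚ[i]⇒ℂ-reflects-0 : ∀ q → ℚ[i]⇒ℂ q ≈ᶜ ℝ⇒ℂ 0ʳ → q ≡ (0ℚ , 0ℚ)
ℚ[i]⇒ℂ-reflects-0 (a , b) (e , f) = ≡.cong₂ _,_
  (null-const a (≈0⇒null {ℚ⇒ℝ a} e)) (null-const b (≈0⇒null {ℚ⇒ℝ b} f))

p≤∣p∣ : ∀ p → p ℚ.≤ ∣ p ∣
p≤∣p∣ p with ℚₚ.≤-total 0ℚ p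
... | inj₁ 0≤p = ℚₚ.≤-reflexive (≡.sym (ℚₚ.0≤p⇒∣p∣≡p 0≤p))
... | inj₂ p≤0 = ℚₚ.≤-trans p≤0 (ℚₚ.0≤∣p∣ p)

∣p∣*∣p∣≡p*p : ∀ p → ∣ p ∣ ℚ.* ∣ p ∣ ≡ p ℚ.* p
∣p∣*∣p∣≡p*p p with ℚₚ.∣p∣≡p∨∣p∣≡-p p
... | inj₁ e rewrite e = ≡.refl
... | inj₂ e rewrite e = solve 1 (λ p → (:- p) :* (:- p) := p :* p) ≡.refl p
  where open ℚSolver

0≤p*p : ∀ p → 0ℚ ℚ.≤ p ℚ.* p
0≤p*p p = ≡.subst (0ℚ ℚ.≤_) (≡.trans (ℚₚ.∣p*q∣≡∣p∣*∣q∣ p p) (∣p∣*∣p∣≡p*p p)) (ℚₚ.0≤∣p∣ (p ℚ.* p))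

p*p≤p*p+q*q : ∀ p q → p ℚ.* p ℚ.≤ p ℚ.* p ℚ.+ q ℚ.* q
p*p≤p*p+q*q p q = ≡.subst (ℚ._≤ p ℚ.* p ℚ.+ q ℚ.* q) (ℚₚ.+-identityʳ (p ℚ.* p)) (ℚₚ.+-monoʳ-≤ (p ℚ.* p) (0≤p*p q))

square-mono-< : ∀ {p q} → 0ℚ ℚ.< p → p ℚ.< q → p ℚ.* p ℚ.< q ℚ.* q
square-mono-< {p} {q} 0<p p<q = ℚₚ.<-trans
  (ℚₚ.*-monoʳ-<-pos p {{ℚ.positive 0<p}} p<q) (ℚₚ.*-monoˡ-<-pos q {{ℚ.positive (ℚₚ.<-trans 0<p p<q)}} p<q)

-- Where `y` exceeds `δ`, the product of `∣ x ∣` and `δ` is at most `∣ x y ∣`, so the bound `ε δ` on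
-- the product bounds `x` by `ε`.
positive-cancel : ∀ {x y} → Positive y → x *ʳ y ≈ʳ 0ʳ → x ≈ʳ 0ʳ
positive-cancel {x} {y} (δ , M , 0<δ , δ<y) xy≈0 = null⇒≈0 {x} λ ε 0<ε →
  bound ε (≈0⇒null {x *ʳ y} xy≈0 (ε ℚ.* δ) (0<* 0<ε 0<δ))
  where
  bound : ∀ ε → (∃ λ N → ∀ n → N ≤ n → ∣ seq x n ℚ.* seq y n ∣ ℚ.< ε ℚ.* δ) →
    ∃ λ N → ∀ n → N ≤ n → ∣ seq x n ∣ ℚ.< ε
  bound ε (N , h) = M ⊔ N , λ n ≤n → ℚₚ.*-cancelʳ-<-nonNeg δ {{ℚ.nonNegative (ℚₚ.<⇒≤ 0<δ)}} (begin-strict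
    ∣ seq x n ∣ ℚ.* δ              ≤⟨ ℚₚ.*-monoˡ-≤-nonNeg ∣ seq x n ∣ {{ℚₚ.∣-∣-nonNeg (seq x n)}}
                                        (ℚₚ.≤-trans (ℚₚ.<⇒≤ (δ<y n (ℕₚ.m⊔n≤o⇒m≤o M N ≤n))) (p≤∣p∣ (seq y n))) ⟩
    ∣ seq x n ∣ ℚ.* ∣ seq y n ∣    ≡⟨ ℚₚ.∣p*q∣≡∣p∣*∣q∣ (seq x n) (seq y n) ⟨
    ∣ seq x n ℚ.* seq y n ∣        <⟨ h n (ℕₚ.m⊔n≤o⇒n≤o M N ≤n) ⟩
    ε ℚ.* δ                        ∎)
    where open ℚₚ.≤-Reasoning

positive-sumOfSquares : ∀ x y → Positive x → Positive ((x *ʳ x) +ʳ (y *ʳ y))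
positive-sumOfSquares x y (δ , N , 0<δ , δ<x) = δ ℚ.* δ , N , 0<* 0<δ 0<δ , λ n N≤n →
  ℚₚ.<-≤-trans (square-mono-< 0<δ (δ<x n N≤n)) (p*p≤p*p+q*q (seq x n) (seq y n))

-- If `∣ x ∣` were at least `ε` at a late index, the sum of squares would be at least `ε²` there; at
-- a single index this is a decidable comparison of rationals.
sumOfSquares≈0 : ∀ x y → (x *ʳ x) +ʳ (y *ʳ y) ≈ʳ 0ʳ → x ≈ʳ 0ʳ
sumOfSquares≈0 x y eq = null⇒≈0 {x} λ ε 0<ε →
  bound ε 0<ε (≈0⇒null {(x *ʳ x) +ʳ (y *ʳ y)} eq (ε ℚ.* ε) (0<* 0<ε 0<ε))
  where
  bound : ∀ ε → 0ℚ ℚ.< ε →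
    (∃ λ N → ∀ n → N ≤ n → ∣ seq x n ℚ.* seq x n ℚ.+ seq y n ℚ.* seq y n ∣ ℚ.< ε ℚ.* ε) →
    ∃ λ N → ∀ n → N ≤ n → ∣ seq x n ∣ ℚ.< ε
  bound ε 0<ε (N , h) = N , λ n N≤n → ℚₚ.≰⇒> λ ε≤∣x∣ → ℚₚ.<-irrefl ≡.refl (begin-strict
    ε ℚ.* ε
      ≤⟨ ℚₚ.*-monoˡ-≤-nonNeg ε {{ℚ.nonNegative (ℚₚ.<⇒≤ 0<ε)}} ε≤∣x∣ ⟩
    ε ℚ.* ∣ seq x n ∣
      ≤⟨ ℚₚ.*-monoʳ-≤-nonNeg ∣ seq x n ∣ {{ℚₚ.∣-∣-nonNeg (seq x n)}} ε≤∣x∣ ⟩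
    ∣ seq x n ∣ ℚ.* ∣ seq x n ∣                        ≡⟨ ∣p∣*∣p∣≡p*p (seq x n) ⟩
    seq x n ℚ.* seq x n                                ≤⟨ p*p≤p*p+q*q (seq x n) (seq y n) ⟩
    seq x n ℚ.* seq x n ℚ.+ seq y n ℚ.* seq y n        ≤⟨ p≤∣p∣ _ ⟩
    ∣ seq x n ℚ.* seq x n ℚ.+ seq y n ℚ.* seq y n ∣    <⟨ h n N≤n ⟩
    ε ℚ.* ε                                            ∎)
    where open ℚₚ.≤-Reasoning

-- Positivity of a real is undecidable, but one of `0 < x` and `x < 1` can be established: an
-- approximation of `x` to within 1/4 is compared with ½, which leaves a margin of 1/4 in either
-- case.
positive-or-positive : ∀ x → Positive x ⊎ Positive (1ʳ +ʳ (-ʳ x))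
positive-or-positive x with cauchy x (+ 1 ℚ./ 4) (ℚₚ.positive⁻¹ (+ 1 ℚ./ 4))
... | N , h with ½ ℚₚ.≤? seq x N
... | yes ½≤x = inj₁ (+ 1 ℚ./ 8 , N , ℚₚ.positive⁻¹ (+ 1 ℚ./ 8) , λ n N≤n → begin-strict
  + 1 ℚ./ 8                              <⟨ from-yes (+ 1 ℚ./ 8 ℚₚ.<? + 1 ℚ./ 4) ⟩
  ½ ℚ.- + 1 ℚ./ 4                        ≤⟨ ℚₚ.+-monoˡ-≤ (ℚ.- (+ 1 ℚ./ 4)) ½≤x ⟩
  seq x N ℚ.- + 1 ℚ./ 4                  <⟨ ℚₚ.+-monoʳ-< (seq x N) (ℚₚ.neg-antimono-<
                                              (ℚₚ.≤-<-trans (p≤∣p∣ (seq x N ℚ.- seq x n)) (h N n ℕₚ.≤-refl N≤n))) ⟩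
  seq x N ℚ.- (seq x N ℚ.- seq x n)      ≡⟨ solve 2 (λ a b → a :- (a :- b) := b) ≡.refl (seq x N) (seq x n) ⟩
  seq x n                                ∎)
  where
  open ℚₚ.≤-Reasoning
  open ℚSolver
... | no ½≰x = inj₂ (+ 1 ℚ./ 8 , N , ℚₚ.positive⁻¹ (+ 1 ℚ./ 8) , λ n N≤n → begin-strict
  + 1 ℚ./ 8                                      <⟨ from-yes (+ 1 ℚ./ 8 ℚₚ.<? + 1 ℚ./ 4) ⟩
  (1ℚ ℚ.- ½) ℚ.- + 1 ℚ./ 4
    <⟨ ℚₚ.+-mono-< (ℚₚ.+-monoʳ-< 1ℚ (ℚₚ.neg-antimono-< (ℚₚ.≰⇒> ½≰x)))
      (ℚₚ.neg-antimono-< (ℚₚ.≤-<-trans (p≤∣p∣ (seq x n ℚ.- seq x N)) (h n N N≤n ℕₚ.≤-refl))) ⟩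
  (1ℚ ℚ.- seq x N) ℚ.- (seq x n ℚ.- seq x N)
    ≡⟨ solve 2 (λ a b → (con 1ℚ :- a) :- (b :- a) := con 1ℚ :- b) ≡.refl (seq x N) (seq x n) ⟩
  1ℚ ℚ.- seq x n                                 ∎)
  where
  open ℚₚ.≤-Reasoning
  open ℚSolver

module _ where
  open Rℂ using (_*_; _+_; -_; _≈_; 0#; 1#)

  -- Multiply e d ≈ 0 by the conjugate of e.
  positive-re-cancel : ∀ e d → Positive (re e) → e * d ≈ 0# → d ≈ 0#
  positive-re-cancel (a +i b) (c +i d) a>0 (u≈0 , v≈0) =
    positive-cancel {c} {(a *ʳ a) +ʳ (b *ʳ b)} (positive-sumOfSquares a b a>0) (combine c (a *ʳ u) (b *ʳ v)
      (λ n → solve 4 (λ a b c d → c :* (a :* a :+ b :* b) := a :* (a :* c :- b :* d) :+ b :* (a :* d :+ b :* c))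
          ≡.refl (seq a n) (seq b n) (seq c n) (seq d n))
      (null-left a u u≈0) (null-left b v v≈0)) ,
    positive-cancel {d} {(a *ʳ a) +ʳ (b *ʳ b)} (positive-sumOfSquares a b a>0) (combine d (a *ʳ v) (-ʳ (b *ʳ u))
      (λ n → solve 4 (λ a b c d → d :* (a :* a :+ b :* b) := a :* (a :* d :+ b :* c) :+ :- (b :* (a :* c :- b :* d)))
          ≡.refl (seq a n) (seq b n) (seq c n) (seq d n))
      (null-left a v v≈0) (null-neg (null-left b u u≈0)))
    where
    open ℚSolver
    u v : ℝ
    u = (a *ʳ c) +ʳ (-ʳ (b *ʳ d))
    v = (a *ʳ d) +ʳ (b *ʳ c)
    null-left : ∀ x y → y ≈ʳ 0ʳ → Null (seq (x *ʳ y))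
    null-left x y y≈0 = null-≗ (λ n → ℚₚ.*-comm (seq y n) (seq x n)) (null-* (≈0⇒null {y} y≈0) (bounded x))
    combine : ∀ x y z → (∀ n → seq (x *ʳ ((a *ʳ a) +ʳ (b *ʳ b))) n ≡ seq y n ℚ.+ seq z n) →
      Null (seq y) → Null (seq z) → x *ʳ ((a *ʳ a) +ʳ (b *ʳ b)) ≈ʳ 0ʳ
    combine x y z eq ny nz = null⇒≈0 {x *ʳ ((a *ʳ a) +ʳ (b *ʳ b))} (null-≗ (λ n → ≡.sym (eq n)) (null-+ ny nz))

  -- By the identity `∣z²∣² = ∣z∣⁴`, the square of `norm` vanishes. The lemma on two squares is then
  -- used twice, with `0ʳ` as second term to pass from the square of `norm` to `norm`, and on `norm`
  -- itself.
  square≈0 : ∀ z → z * z ≈ 0# → z ≈ 0#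
  square≈0 (a +i b) (u≈0 , v≈0) =
    sumOfSquares≈0 a b norm≈0 , sumOfSquares≈0 b a
      (Rℝ.trans {(b *ʳ b) +ʳ (a *ʳ a)} {norm} {0ʳ} (Rℝ.+-comm (b *ʳ b) (a *ʳ a)) norm≈0)
    where
    open ℚSolver
    norm : ℝ
    norm = (a *ʳ a) +ʳ (b *ʳ b)
    u v : ℝ
    u = (a *ʳ a) +ʳ (-ʳ (b *ʳ b))
    v = (a *ʳ b) +ʳ (b *ʳ a)
    norm≈0 : norm ≈ʳ 0ʳ
    norm≈0 = sumOfSquares≈0 norm 0ʳ (null⇒≈0 {(norm *ʳ norm) +ʳ (0ʳ *ʳ 0ʳ)} (null-≗
      (λ n → solve 2 (λ a b → (a :* a :- b :* b) :* (a :* a :- b :* b) :+ (a :* b :+ b :* a) :* (a :* b :+ b :* a) :=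
        (a :* a :+ b :* b) :* (a :* a :+ b :* b) :+ con 0ℚ :* con 0ℚ) ≡.refl (seq a n) (seq b n))
      (null-+ (null-* (≈0⇒null {u} u≈0) (bounded u)) (null-* (≈0⇒null {v} v≈0) (bounded v)))))

  -- The real parts of `e` and `1 - e` add up to 1, so one of them is positive, and a factor with
  -- positive real part can be cancelled.
  zero-or-one : ∀ e → e * (1# + - e) ≈ 0# → (1# + - e) ≈ 0# ⊎ e ≈ 0#
  zero-or-one e ed≈0 with positive-or-positive (re e)
  ... | inj₁ e>0 = inj₁ (positive-re-cancel e (1# + - e) e>0 ed≈0)
  ... | inj₂ d>0 = inj₂ (positive-re-cancel (1# + - e) e d>0
    (Rℂ.trans {(1# + - e) * e} {e * (1# + - e)} {0#} (Rℂ.*-comm (1# + - e) e) ed≈0))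

-- Roots of integer polynomials

module _ (R : CommutativeRing 0ℓ 0ℓ) where
  open CommutativeRing R hiding (zero; _-_)

  Reduced Connected : Set
  Reduced   = ∀ z → z * z ≈ 0# → z ≈ 0#
  Connected = ∀ e → e * (1# + - e) ≈ 0# → 1# + - e ≈ 0# ⊎ e ≈ 0#

  Invertible : Carrier → Set
  Invertible x = ∃ λ y → x * y ≈ 1#

module InvertibleRoots (R : CommutativeRing 0ℓ 0ℓ) (reduced : Reduced R) (connected : Connected R)
  (ι : ℤ → CommutativeRing.Carrier R) (ι-isHom : IsRawHom ℤ.+-*-rawRing (CommutativeRing.rawRing R) ι)
  (invertible : ∀ c → c ≢ + 0 → Invertible R (ι c)) where
  open CommutativeRing R hiding (zero; _-_)
  open RawSemiringDefs (RawRing.rawSemiring rawRing) using (_^_)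
  open RingProperties ring using (-‿distribʳ-*; -‿involutive)
  open import Relation.Binary.Reasoning.Setoid setoid
  open SemiringSolver commutativeSemiring using (solve; _:+_; _:*_; _:=_)
  open ExpProperties commutativeSemiring using (^-distrib-*)
  private module ℤ[X] = Polynomials ℤ.+-*-rawRing

  -- The square of `z^(n+1)` is a multiple of `z^(n+2)`, so reducedness lowers the exponent by one.
  ^≈0 : ∀ z n → z ^ n ≈ 0# → z ≈ 0#
  ^≈0 z zero          e = trans (sym (*-identityʳ z)) (trans (*-congˡ e) (zeroʳ z))
  ^≈0 z (suc zero)    e = trans (sym (*-identityʳ z)) e
  ^≈0 z (suc (suc n)) e = ^≈0 z (suc n) (reduced (z ^ suc n) (trans
    (solve 2 (λ z w → (z :* w) :* (z :* w) := (z :* (z :* w)) :* w) refl z (z ^ n))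
    (trans (*-congʳ e) (zeroˡ _))))

  -- (zw)^(n+1) is an idempotent, hence 0 or 1.
  stronglyπRegular⇒invertible : ∀ z n w → (z ^ n) * (1# + - (z * w)) ≈ 0# → ¬ (z ≈ 0#) → Invertible R z
  stronglyπRegular⇒invertible z n w eq z≉0 = conclude (connected e idempotent)
    where
    t e : Carrier
    t = z * w
    e = t ^ suc n
    difference : ∀ x y → x * (1# + - y) ≈ 0# → x * y ≈ x
    difference x y h = begin
      x * y                                 ≈⟨ +-identityˡ _ ⟨
      0# + x * y                            ≈⟨ +-congʳ h ⟨
      x * (1# + - y) + x * y                ≈⟨ distribˡ x _ y ⟨
      x * (1# + - y + y)
        ≈⟨ *-congˡ (trans (+-assoc _ _ _) (trans (+-congˡ (-‿inverseˡ y)) (+-identityʳ 1#))) ⟩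
      x * 1#                                ≈⟨ *-identityʳ x ⟩
      x                                     ∎
    absorb : ∀ m → (z ^ n) * (t ^ m) ≈ z ^ n
    absorb zero    = *-identityʳ _
    absorb (suc m) = trans (sym (*-assoc _ _ _)) (trans (*-congʳ (difference (z ^ n) t eq)) (absorb m))
    vanish : (z ^ n) * (1# + - e) ≈ 0#
    vanish = begin
      (z ^ n) * (1# + - e)                 ≈⟨ distribˡ _ _ _ ⟩
      (z ^ n) * 1# + (z ^ n) * - e
        ≈⟨ +-cong (*-identityʳ _) (trans (sym (-‿distribʳ-* _ _)) (-‿cong (absorb (suc n)))) ⟩
      (z ^ n) + - (z ^ n)                  ≈⟨ -‿inverseʳ _ ⟩
      0#                                   ∎
    idempotent : e * (1# + - e) ≈ 0#
    idempotent = begin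
      e * (1# + - e)                               ≈⟨ *-congʳ (^-distrib-* z w (suc n)) ⟩
      (z ^ suc n) * (w ^ suc n) * (1# + - e)
        ≈⟨ solve 4 (λ z Z W d → z :* Z :* W :* d := z :* W :* (Z :* d)) refl z (z ^ n) (w ^ suc n) (1# + - e) ⟩
      z * (w ^ suc n) * ((z ^ n) * (1# + - e))     ≈⟨ *-congˡ vanish ⟩
      z * (w ^ suc n) * 0#                         ≈⟨ zeroʳ _ ⟩
      0#                                           ∎
    conclude : 1# + - e ≈ 0# ⊎ e ≈ 0# → Invertible R z
    conclude (inj₁ 1-e≈0) = w * (t ^ n) , (begin
      z * (w * (t ^ n))    ≈⟨ *-assoc z w _ ⟨
      e                    ≈⟨ *-identityˡ e ⟨
      1# * e               ≈⟨ difference 1# e (trans (*-identityˡ _) 1-e≈0) ⟩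
      1#                   ∎)
    conclude (inj₂ e≈0) = contradiction
      (^≈0 z n (trans (sym (absorb (suc n))) (trans (*-congˡ e≈0) (zeroʳ _)))) z≉0

  module _ (z : Carrier) where
    open PolynomialRing.Evaluation R z using (ev)

    -- `m` counts the low coefficients found to be 0, whose powers of `z` have been split off.
    -- Equality of integers is decidable, so the lowest nonzero coefficient can be searched for;
    -- position `n` ensures that it is found. With `d` inverse to this coefficient `c`, the equation
    -- `z^m (c + z g) = 0` becomes `z^m (1 - z w) = 0` for `w = - d g`.
    root⇒invertible : ∀ l n → ℤ[X].coeff l n ≢ + 0 → ∀ m → (z ^ m) * ev (map ι l) ≈ 0# →
      ¬ (z ≈ 0#) → Invertible R z
    root⇒invertible []      n       c≢0 m root z≉0 = contradiction ≡.refl c≢0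
    root⇒invertible (c ∷ l) n       c≢0 m root z≉0 with c ℤₚ.≟ + 0
    root⇒invertible (c ∷ l) zero    c≢0 m root z≉0 | yes c≡0 = contradiction c≡0 c≢0
    root⇒invertible (c ∷ l) (suc n) c≢0 m root z≉0 | yes ≡.refl =
      root⇒invertible l n c≢0 (suc m) (begin
        z * (z ^ m) * ev (map ι l)
          ≈⟨ solve 3 (λ z Z x → z :* Z :* x := Z :* (z :* x)) refl z (z ^ m) (ev (map ι l)) ⟩
        (z ^ m) * (z * ev (map ι l))
          ≈⟨ *-congˡ (trans (+-congʳ (IsRawHom.0-homo ι-isHom)) (+-identityˡ _)) ⟨
        (z ^ m) * (ι (+ 0) + z * ev (map ι l))     ≈⟨ root ⟩
        0#                                         ∎) z≉0
    root⇒invertible (c ∷ l) n       c≢0 m root z≉0 | no c≢0′ with invertible c c≢0′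
    ... | d , cd≈1 = stronglyπRegular⇒invertible z m (- (d * g)) (begin
        (z ^ m) * (1# + - (z * - (d * g)))
          ≈⟨ *-congˡ (+-cong (sym cd≈1) (trans (-‿cong (sym (-‿distribʳ-* _ _))) (-‿involutive _))) ⟩
        (z ^ m) * (ι c * d + z * (d * g))
          ≈⟨ solve 5 (λ z Z c d g → Z :* (c :* d :+ z :* (d :* g)) := d :* (Z :* (c :+ z :* g))) refl z (z ^ m) (ι c) d g ⟩
        d * ((z ^ m) * (ι c + z * g))         ≈⟨ trans (*-congˡ root) (zeroʳ d) ⟩
        0#                                    ∎) z≉0
      where
      g : Carrier
      g = ev (map ι l)

ℤ⇒ℂ-invertible : ∀ c → c ≢ + 0 → Invertible ℂ-commutativeRing (ℤ⇒ℂ c)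
ℤ⇒ℂ-invertible c c≢0 = ℚ[i]⇒ℂ (1/q , 0ℚ) ,
  (pointwise λ _ → ≡.trans (solve 2 (λ a b → a :* b :- con 0ℚ :* con 0ℚ := a :* b) ≡.refl q 1/q) (ℚₚ.*-inverseʳ q {{q≢0}})) ,
  pointwise λ _ → solve 2 (λ a b → a :* con 0ℚ :+ con 0ℚ :* b := con 0ℚ) ≡.refl q 1/q
  where
  open ℚSolver
  q : ℚ
  q = c ℚ./ 1
  q≢0 : ℚ.NonZero q
  q≢0 = ℚ.≢-nonZero (c≢0 ∘ /1-reflects-0 c)
  1/q : ℚ
  1/q = (ℚ.1/ q) {{q≢0}}

module PolynomialMap (A : RawRing 0ℓ 0ℓ) (R : CommutativeRing 0ℓ 0ℓ)
  {h : RawRing.Carrier A → CommutativeRing.Carrier R}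
  (isHom : IsRawHom A (CommutativeRing.rawRing R) h) where
  private
    module A where
      open RawRing A public
      open Polynomials A public
      open MatrixOps (Polynomials.polyRawRing A) public using (_⊟_; diag)
  open CommutativeRing R hiding (zero; _-_)
  open Polynomials rawRing
  open PolynomialRing R using (polynomialRing)
  open MatrixOps polyRawRing using (_⊟_; diag)
  open IsRawHom isHom

  private
    map-+ : ∀ p q → map h (p A.+ₚ q) ≈ₚ map h p +ₚ map h q
    map-+ []      q       n       = refl
    map-+ (a ∷ p) []      n       = refl
    map-+ (a ∷ p) (b ∷ q) zero    = +-homo a b
    map-+ (a ∷ p) (b ∷ q) (suc n) = map-+ p q n

    map-scale : ∀ a p → map h (map (a A.*_) p) ≈ₚ map (h a *_) (map h p)
    map-scale a []      n       = refl
    map-scale a (b ∷ p) zero    = *-homo a b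
    map-scale a (b ∷ p) (suc n) = map-scale a p n

    map-* : ∀ p q → map h (p A.*ₚ q) ≈ₚ map h p *ₚ map h q
    map-* []      q = λ _ → refl
    map-* (a ∷ p) q = CommutativeRing.trans polynomialRing
      {map h (map (a A.*_) q A.+ₚ (A.0# ∷ p A.*ₚ q))}
      {map h (map (a A.*_) q) +ₚ map h (A.0# ∷ p A.*ₚ q)}
      {map (h a *_) (map h q) +ₚ (0# ∷ map h p *ₚ map h q)}
      (map-+ (map (a A.*_) q) (A.0# ∷ p A.*ₚ q))
      (CommutativeRing.+-cong polynomialRing
        {map h (map (a A.*_) q)} {map (h a *_) (map h q)}
        {map h (A.0# ∷ p A.*ₚ q)} {0# ∷ map h p *ₚ map h q}
        (map-scale a q) λ { zero → 0-homo ; (suc n) → map-* p q n })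

    map-neg : ∀ p → map h (map A.-_ p) ≈ₚ map -_ (map h p)
    map-neg []      n       = refl
    map-neg (a ∷ p) zero    = -‿homo a
    map-neg (a ∷ p) (suc n) = map-neg p n

  map-isHom : IsRawHom A.polyRawRing polyRawRing (map h)
  map-isHom = record
    { +-homo = map-+ ; *-homo = map-* ; -‿homo = map-neg ; 0-homo = λ _ → refl
    ; 1-homo = λ { zero → 1-homo ; (suc n) → refl } }

  map-X : map h A.X ≈ₚ X
  map-X zero          = 0-homo
  map-X (suc zero)    = 1-homo
  map-X (suc (suc n)) = refl

  map-characteristic : ∀ {n} (M : Matrix A.Carrier n n) i j →
    map h ((A.diag (const A.X) A.⊟ mapMatrix A.constant M) i j) ≈ₚ
    (diag (const X) ⊟ mapMatrix constant (mapMatrix h M)) i j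
  map-characteristic M i j with i ≟ j
  ... | yes _ = λ
    { zero → trans (+-homo _ _) (+-cong 0-homo (-‿homo _))
    ; (suc zero) → 1-homo
    ; (suc (suc n)) → refl }
  ... | no _ = λ { zero → -‿homo _ ; (suc n) → refl }

-- Algebraic multiplicities

module Multiplicity (R : CommutativeRing 0ℓ 0ℓ) where
  open CommutativeRing R hiding (zero; _-_)
  open Polynomials rawRing
  open PolynomialRing R
  open MatrixOps rawRing using (diag; det; _⊟_)
  open MatrixOps polyRawRing using () renaming (det to detₚ)
  open CharacteristicPolynomial R using (characteristic)
  open Coprimality polynomialRing
  open RawSemiringDefs (RawRing.rawSemiring polyRawRing) using (_∣_; _∤_; _^_)
  open RawMagmaDefs (RawRing.*-rawMagma polyRawRing) using (_,_)
  private module P = CommutativeRing polynomialRing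

  module _ (z : Carrier) where
    open Evaluation z

    HasMultiplicity : Poly → ℕ → Set
    HasMultiplicity p k = (X-z ^ k) ∣ p × (X-z ^ suc k) ∤ p

    -- The identity `(X - z)(- v) + X v = z v`.
    comaximal-X : Invertible R z → Comaximal X-z X
    comaximal-X (v , zv≈1) = constant (- v) , constant v , λ
      { zero → begin
          (0# + - z) * - v + 0# + (0# * v + 0#)    ≈⟨ +-cong (+-identityʳ _) (trans (+-identityʳ _) (zeroˡ v)) ⟩
          (0# + - z) * - v + 0#                    ≈⟨ +-identityʳ _ ⟩
          (0# + - z) * - v                         ≈⟨ *-congʳ (+-identityˡ _) ⟩
          - z * - v
            ≈⟨ trans (sym (-‿distribˡ-* z (- v))) (-‿cong (sym (-‿distribʳ-* z v))) ⟩
          - (- (z * v))                            ≈⟨ -‿involutive _ ⟩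
          z * v                                    ≈⟨ zv≈1 ⟩
          1#                                       ∎
      ; (suc zero) → trans (+-cong (trans (+-identityʳ _) (*-identityˡ _)) (trans (+-identityʳ _) (*-identityˡ _)))
          (-‿inverseˡ v)
      ; (suc (suc n)) → refl }
      where
      open import Relation.Binary.Reasoning.Setoid setoid
      open RingProperties ring using (-‿distribˡ-*; -‿distribʳ-*; -‿involutive)

    private
      X-z∣ : ∀ k p → (X-z ^ suc k) ∣ p → X-z ∣ p
      X-z∣ k p (q , e) = q *ₚ (X-z ^ k) , P.trans {(q *ₚ (X-z ^ k)) *ₚ X-z} {q *ₚ (X-z *ₚ (X-z ^ k))} {p}
        (P.trans {(q *ₚ (X-z ^ k)) *ₚ X-z} {q *ₚ ((X-z ^ k) *ₚ X-z)} {q *ₚ (X-z *ₚ (X-z ^ k))}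
          (P.*-assoc q (X-z ^ k) X-z) (P.*-congˡ {q} {(X-z ^ k) *ₚ X-z} {X-z *ₚ (X-z ^ k)} (P.*-comm (X-z ^ k) X-z))) e

      ∣-transfer : ∀ {d} p q a b → Comaximal d X → (X ^ a) *ₚ p ≈ₚ (X ^ b) *ₚ q → d ∣ p → d ∣ q
      ∣-transfer {d} p q a b comax eq (u , ud≈p) = ∣-cancel-^ {d} {X} {q} comax b ((X ^ a) *ₚ u ,
        P.trans {((X ^ a) *ₚ u) *ₚ d} {(X ^ a) *ₚ (u *ₚ d)} {(X ^ b) *ₚ q} (P.*-assoc (X ^ a) u d)
          (P.trans {(X ^ a) *ₚ (u *ₚ d)} {(X ^ a) *ₚ p} {(X ^ b) *ₚ q} (P.*-congˡ {X ^ a} {u *ₚ d} {p} ud≈p) eq))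

    -- For invertible `z`, the powers of `X - z` are comaximal with `X`, so powers of `X` can be
    -- cancelled. Invertibility may be assumed only once `X - z` is known to divide `p` or `q`. That
    -- is enough: exponent 0 always divides, and non-divisibility of `q` is proved by carrying a
    -- supposed divisor of `q` back to `p`.
    multiplicity-transfer : ∀ p q a b → (X ^ a) *ₚ p ≈ₚ (X ^ b) *ₚ q →
      (X-z ∣ p → Invertible R z) → (X-z ∣ q → Invertible R z) →
      ∀ k → HasMultiplicity p k → HasMultiplicity q k
    multiplicity-transfer p q a b eq unit-p unit-q k (d∣p , d∤p) = divides k d∣p , λ d∣q →
      d∤p (∣-transfer q p b a (comaximal-^ {X-z} {X} (comaximal-X (unit-q (X-z∣ k q d∣q))) (suc k))
        (P.sym {(X ^ a) *ₚ p} {(X ^ b) *ₚ q} eq) d∣q)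
      where
      divides : ∀ k → (X-z ^ k) ∣ p → (X-z ^ k) ∣ q
      divides zero    _   = q , P.*-identityʳ q
      divides (suc k) d∣p = ∣-transfer p q a b (comaximal-^ {X-z} {X} (comaximal-X (unit-p (X-z∣ k p d∣p))) (suc k)) eq d∣p

    ∣⇒root : ∀ p → X-z ∣ p → ev p ≈ 0#
    ∣⇒root p (q , e) = trans (sym (ev-cong (q *ₚ X-z) p e))
      (trans (IsRawHom.*-homo ev-isHom q X-z) (trans (*-congˡ ev-X-z) (zeroʳ _)))

    private
      ^1 : X-z ^ 1 ≈ₚ X-z
      ^1 = P.*-identityʳ X-z

    -- Together with the next lemma: multiplicity 0 tells nonroots from roots, so two spectra can be
    -- separated without finding any positive multiplicity.
    nonroot⇒multiplicity-0 : ∀ p → ¬ (ev p ≈ 0#) → HasMultiplicity p 0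
    nonroot⇒multiplicity-0 p nonroot = (p , P.*-identityʳ p) , λ { (q , e) → nonroot (∣⇒root p
      (q , P.trans {q *ₚ X-z} {q *ₚ (X-z ^ 1)} {p} (P.*-congˡ {q} {X-z} {X-z ^ 1} (P.sym {X-z ^ 1} {X-z} ^1)) e)) }

    root⇒¬multiplicity-0 : ∀ p → ev p ≈ 0# → ¬ HasMultiplicity p 0
    root⇒¬multiplicity-0 p root (_ , ∤p) = ∤p (quotient p ,
      P.trans {quotient p *ₚ (X-z ^ 1)} {quotient p *ₚ X-z} {p} (P.*-congˡ {quotient p} {X-z ^ 1} {X-z} ^1)
        (division-root p root))

    ev-charPoly : ∀ {n} (M : Matrix Carrier n n) → ev (detₚ (characteristic M)) ≈ det (diag (const z) ⊟ M)
    ev-charPoly M = trans (MatrixHom.det-homo polyRawRing R ev-isHom (characteristic M))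
      (Determinants.det-cong R entry)
      where
      entry : ∀ i j → ev (characteristic M i j) ≈ (diag (const z) ⊟ M) i j
      entry i j with i ≟ j
      ... | yes _ = trans (IsRawHom.+-homo ev-isHom X (constant (- M i j))) (+-cong ev-X (ev-constant _))
      ... | no _  = trans (ev-constant _) (sym (+-identityˡ _))

≋-sym : ∀ {F G} → F ≋ G → G ≋ F
≋-sym F≋G z z≉0 k = mk⇔ (Equivalence.from (F≋G z z≉0 k)) (Equivalence.to (F≋G z z≉0 k))

≋-trans : ∀ {F G H} → F ≋ G → G ≋ H → F ≋ H
≋-trans F≋G G≋H z z≉0 k = mk⇔
  (Equivalence.to (G≋H z z≉0 k) ∘ Equivalence.to (F≋G z z≉0 k))
  (Equivalence.from (F≋G z z≉0 k) ∘ Equivalence.from (G≋H z z≉0 k))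

module _ where
  private
    module ℂ[X] where
      open Polynomials ℂ-rawRing public
      open PolynomialRing ℂ-commutativeRing public
      open CharacteristicPolynomial ℂ-commutativeRing public
      open MatrixOps polyRawRing public using (det)
      open RawSemiringDefs (RawRing.rawSemiring polyRawRing) public using (_^_; _∣_)
      open CommutativeRing polynomialRing public using (_≈_; trans; sym; *-cong)
    module ℤ[X] where
      open Polynomials ℤ.+-*-rawRing public
      open CharacteristicPolynomial ℤₚ.+-*-commutativeRing public
      open MatrixOps polyRawRing public using (det)
      open RawSemiringDefs (RawRing.rawSemiring polyRawRing) public using (_^_)
    open PolynomialMap ℤ.+-*-rawRing ℂ-commutativeRing ℤ⇒ℂ-isHom
    open InvertibleRoots ℂ-commutativeRing square≈0 zero-or-one ℤ⇒ℂ ℤ⇒ℂ-isHom ℤ⇒ℂ-invertible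
    open Multiplicity ℂ-commutativeRing
    open MatrixOps ℤ.+-*-rawRing using (_⊠_)

    charPolyℤ : ∀ {n} → Matrix ℤ n n → ℤ[X].Poly
    charPolyℤ M = ℤ[X].det (ℤ[X].characteristic M)

    charPoly-map : ∀ {n} (M : Matrix ℤ n n) → charPoly (mapMatrix ℤ⇒ℂ M) ℂ[X].≈ₚ map ℤ⇒ℂ (charPolyℤ M)
    charPoly-map M = ℂ[X].sym {map ℤ⇒ℂ (charPolyℤ M)} {charPoly (mapMatrix ℤ⇒ℂ M)}
      (ℂ[X].trans {map ℤ⇒ℂ (charPolyℤ M)} {ℂ[X].det (mapMatrix (map ℤ⇒ℂ) (ℤ[X].characteristic M))} {charPoly (mapMatrix ℤ⇒ℂ M)}
        (MatrixHom.det-homo ℤ[X].polyRawRing ℂ[X].polynomialRing map-isHom (ℤ[X].characteristic M))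
        (Determinants.det-cong ℂ[X].polynomialRing (map-characteristic M)))

  -- The characteristic polynomial comes from ℤ[X], where its coefficient of order `n` is 1. The
  -- search for the lowest nonzero coefficient starts with no power of `z` split off, hence the
  -- exponent 0.
  root-invertible : ∀ {n} (M : Matrix ℤ n n) z → ¬ (z ≈ᶜ ℝ⇒ℂ 0ʳ) →
    PolynomialRing.Evaluation.X-z ℂ-commutativeRing z ℂ[X].∣ charPoly (mapMatrix ℤ⇒ℂ M) →
    Invertible ℂ-commutativeRing z
  root-invertible {n} M z z≉0 d = root⇒invertible z (charPolyℤ M) n
    (λ lead≡0 → contradiction (≡.trans (≡.sym lead≡0) (ℤ[X].charPoly-monic M)) (λ ())) 0
    (Rℂ.trans {Rℂ._*_ Rℂ.1# (ev (map ℤ⇒ℂ (charPolyℤ M)))} {ev (map ℤ⇒ℂ (charPolyℤ M))} {Rℂ.0#}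
      (Rℂ.*-identityˡ (ev (map ℤ⇒ℂ (charPolyℤ M))))
      (Rℂ.trans {ev (map ℤ⇒ℂ (charPolyℤ M))} {ev (charPoly (mapMatrix ℤ⇒ℂ M))} {Rℂ.0#}
        (Rℂ.sym {ev (charPoly (mapMatrix ℤ⇒ℂ M))} {ev (map ℤ⇒ℂ (charPolyℤ M))}
          (ev-cong (charPoly (mapMatrix ℤ⇒ℂ M)) (map ℤ⇒ℂ (charPolyℤ M)) (charPoly-map M)))
        (∣⇒root z (charPoly (mapMatrix ℤ⇒ℂ M)) d))) z≉0
    where open PolynomialRing.Evaluation ℂ-commutativeRing z using (ev; ev-cong)

  private
    swap-ℂ : ∀ {m n} (A : Matrix ℤ m n) (B : Matrix ℤ n m) →
      (ℂ[X].X ℂ[X].^ n) ℂ[X].*ₚ charPoly (mapMatrix ℤ⇒ℂ (A ⊠ B)) ℂ[X].≈ₚ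
      (ℂ[X].X ℂ[X].^ m) ℂ[X].*ₚ charPoly (mapMatrix ℤ⇒ℂ (B ⊠ A))
    swap-ℂ {m} {n} A B = begin
      (ℂ[X].X ℂ[X].^ n) ℂ[X].*ₚ charPoly (mapMatrix ℤ⇒ℂ (A ⊠ B))      ≈⟨ shift n (A ⊠ B) ⟩
      map ℤ⇒ℂ ((ℤ[X].X ℤ[X].^ n) ℤ[X].*ₚ charPolyℤ (A ⊠ B))
        ≈⟨ map-cong ((ℤ[X].X ℤ[X].^ n) ℤ[X].*ₚ charPolyℤ (A ⊠ B))
          ((ℤ[X].X ℤ[X].^ m) ℤ[X].*ₚ charPolyℤ (B ⊠ A)) (ℤ[X].charPoly-swap A B) ⟩
      map ℤ⇒ℂ ((ℤ[X].X ℤ[X].^ m) ℤ[X].*ₚ charPolyℤ (B ⊠ A))           ≈⟨ shift m (B ⊠ A) ⟨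
      (ℂ[X].X ℂ[X].^ m) ℂ[X].*ₚ charPoly (mapMatrix ℤ⇒ℂ (B ⊠ A))      ∎
      where
      open import Relation.Binary.Reasoning.Setoid (CommutativeRing.setoid ℂ[X].polynomialRing)
      coeff-map : ∀ p n → ℂ[X].coeff (map ℤ⇒ℂ p) n ≈ᶜ ℤ⇒ℂ (ℤ[X].coeff p n)
      coeff-map []      n       = Rℂ.sym {ℤ⇒ℂ (+ 0)} {Rℂ.0#} (IsRawHom.0-homo ℤ⇒ℂ-isHom)
      coeff-map (a ∷ p) zero    = Rℂ.refl {ℤ⇒ℂ a}
      coeff-map (a ∷ p) (suc n) = coeff-map p n
      map-cong : ∀ p q → p ℤ[X].≈ₚ q → map ℤ⇒ℂ p ℂ[X].≈ₚ map ℤ⇒ℂ q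
      map-cong p q e n = Rℂ.trans {ℂ[X].coeff (map ℤ⇒ℂ p) n} {ℤ⇒ℂ (ℤ[X].coeff p n)} {ℂ[X].coeff (map ℤ⇒ℂ q) n}
        (coeff-map p n)
        (≡.subst (λ c → ℤ⇒ℂ c ≈ᶜ ℂ[X].coeff (map ℤ⇒ℂ q) n) (≡.sym (e n))
          (Rℂ.sym {ℂ[X].coeff (map ℤ⇒ℂ q) n} {ℤ⇒ℂ (ℤ[X].coeff q n)} (coeff-map q n)))
      X^ : ∀ j → map ℤ⇒ℂ (ℤ[X].X ℤ[X].^ j) ℂ[X].≈ₚ ℂ[X].X ℂ[X].^ j
      X^ j = ℂ[X].trans {map ℤ⇒ℂ (ℤ[X].X ℤ[X].^ j)} {map ℤ⇒ℂ ℤ[X].X ℂ[X].^ j} {ℂ[X].X ℂ[X].^ j}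
        (MatrixHom.^-homo ℤ[X].polyRawRing ℂ[X].polynomialRing map-isHom ℤ[X].X j)
        (ExpProperties.^-congˡ (CommutativeRing.commutativeSemiring ℂ[X].polynomialRing) j {map ℤ⇒ℂ ℤ[X].X} {ℂ[X].X} map-X)
      shift : ∀ j {l} (M : Matrix ℤ l l) → (ℂ[X].X ℂ[X].^ j) ℂ[X].*ₚ charPoly (mapMatrix ℤ⇒ℂ M) ℂ[X].≈ₚ
        map ℤ⇒ℂ ((ℤ[X].X ℤ[X].^ j) ℤ[X].*ₚ charPolyℤ M)
      shift j M = ℂ[X].trans {(ℂ[X].X ℂ[X].^ j) ℂ[X].*ₚ charPoly (mapMatrix ℤ⇒ℂ M)}
        {map ℤ⇒ℂ (ℤ[X].X ℤ[X].^ j) ℂ[X].*ₚ map ℤ⇒ℂ (charPolyℤ M)} {map ℤ⇒ℂ ((ℤ[X].X ℤ[X].^ j) ℤ[X].*ₚ charPolyℤ M)}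
        (ℂ[X].*-cong {ℂ[X].X ℂ[X].^ j} {map ℤ⇒ℂ (ℤ[X].X ℤ[X].^ j)} {charPoly (mapMatrix ℤ⇒ℂ M)} {map ℤ⇒ℂ (charPolyℤ M)}
          (ℂ[X].sym {map ℤ⇒ℂ (ℤ[X].X ℤ[X].^ j)} {ℂ[X].X ℂ[X].^ j} (X^ j)) (charPoly-map M))
        (ℂ[X].sym {map ℤ⇒ℂ ((ℤ[X].X ℤ[X].^ j) ℤ[X].*ₚ charPolyℤ M)} {map ℤ⇒ℂ (ℤ[X].X ℤ[X].^ j) ℂ[X].*ₚ map ℤ⇒ℂ (charPolyℤ M)}
          (IsRawHom.*-homo map-isHom (ℤ[X].X ℤ[X].^ j) (charPolyℤ M)))

  specℤ-swap : ∀ {m n} (A : Matrix ℤ m n) (B : Matrix ℤ n m) → specℤ (A ⊠ B) ≋ specℤ (B ⊠ A)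
  specℤ-swap {m} {n} A B z z≉0 k = mk⇔ (transfer A B) (transfer B A)
    where
    transfer : ∀ {m n} (A : Matrix ℤ m n) (B : Matrix ℤ n m) → specℤ (A ⊠ B) z k → specℤ (B ⊠ A) z k
    transfer {m} {n} A B = multiplicity-transfer z (charPoly (mapMatrix ℤ⇒ℂ (A ⊠ B))) (charPoly (mapMatrix ℤ⇒ℂ (B ⊠ A))) n m
      (swap-ℂ A B) (root-invertible (A ⊠ B) z z≉0) (root-invertible (B ⊠ A) z z≉0) k

open SumProperties (CommutativeRing.semiring ℤₚ.+-*-commutativeRing)
  using (sum; sum-cong-≗; ∑-comm; ∑-distrib-+; sum-permute; *-distribˡ-sum)
open Determinants ℤₚ.+-*-commutativeRing using (sum-single; sum-zero; sum-↑)

module ℤMatrix = MatrixOps ℤ.+-*-rawRing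

-- Equal entries give equal characteristic polynomials, and the transfer of multiplicities applies
-- with both exponents 0.
specℤ-cong : ∀ {n} {M N : Matrix ℤ n n} → (∀ i j → M i j ≡ N i j) → specℤ M ≋ specℤ N
specℤ-cong {n} {M} {N} M≡N z z≉0 k = mk⇔ (transfer M N M≡N) (transfer N M λ i j → ≡.sym (M≡N i j))
  where
  open CommutativeRing (PolynomialRing.polynomialRing ℂ-commutativeRing) using (*-congˡ; 1#)
  open RawRing (Polynomials.polyRawRing ℂ-rawRing) using (_≈_)
  open CharacteristicPolynomial ℂ-commutativeRing using (characteristic)
  transfer : ∀ M N → (∀ i j → M i j ≡ N i j) → specℤ M z k → specℤ N z k
  transfer M N M≡N = Multiplicity.multiplicity-transfer ℂ-commutativeRing z
    (charPoly (mapMatrix ℤ⇒ℂ M)) (charPoly (mapMatrix ℤ⇒ℂ N)) 0 0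
    (*-congˡ {1#} {charPoly (mapMatrix ℤ⇒ℂ M)} {charPoly (mapMatrix ℤ⇒ℂ N)}
      (Determinants.det-cong (PolynomialRing.polynomialRing ℂ-commutativeRing)
        {M = characteristic (mapMatrix ℤ⇒ℂ M)} {N = characteristic (mapMatrix ℤ⇒ℂ N)} entry))
    (root-invertible M z z≉0) (root-invertible N z z≉0) k
    where
    entry : ∀ i j → characteristic (mapMatrix ℤ⇒ℂ M) i j ≈ characteristic (mapMatrix ℤ⇒ℂ N) i j
    entry i j rewrite M≡N i j = λ n → Rℂ.refl {Polynomials.coeff ℂ-rawRing (characteristic (mapMatrix ℤ⇒ℂ N) i j) n}

specℤ-factor : ∀ {m n} (M : Matrix ℤ m m) (N : Matrix ℤ n n) (A : Matrix ℤ m n) (B : Matrix ℤ n m) →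
  (∀ i j → (A ℤMatrix.⊠ B) i j ≡ M i j) → (∀ i j → (B ℤMatrix.⊠ A) i j ≡ N i j) → specℤ M ≋ specℤ N
specℤ-factor M N A B AB BA = ≋-trans {specℤ M} {specℤ (A ℤMatrix.⊠ B)} {specℤ N}
  (specℤ-cong (λ i j → ≡.sym (AB i j)))
  (≋-trans {specℤ (A ℤMatrix.⊠ B)} {specℤ (B ℤMatrix.⊠ A)} {specℤ N} (specℤ-swap A B) (specℤ-cong BA))

-- Moves that preserve a spectrum

indicator : ∀ {P : Set} → Dec P → ℤ
indicator P? = if does P? then ℤ.1ℤ else ℤ.0ℤ

indicator-yes : ∀ {P : Set} (P? : Dec P) → P → indicator P? ≡ ℤ.1ℤ
indicator-yes P? p rewrite dec-true P? p = ≡.refl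

indicator-no : ∀ {P : Set} (P? : Dec P) → ¬ P → indicator P? ≡ ℤ.0ℤ
indicator-no P? ¬p rewrite dec-false P? ¬p = ≡.refl

indicator-⇔ : ∀ {P Q : Set} (P? : Dec P) (Q? : Dec Q) → P ⇔ Q → indicator P? ≡ indicator Q?
indicator-⇔ P? Q? P⇔Q = ≡.cong (if_then ℤ.1ℤ else ℤ.0ℤ) (does-⇔ P⇔Q P? Q?)

indicator-× : ∀ {P Q : Set} (P? : Dec P) (Q? : Dec Q) → indicator (P? ×-dec Q?) ≡ indicator P? ℤ.* indicator Q?
indicator-× (yes _) (yes _) = ≡.refl
indicator-× (yes _) (no _)  = ≡.refl
indicator-× (no _)  _       = ≡.refl

*-indicator-no : ∀ {P : Set} c (P? : Dec P) → ¬ P → c ℤ.* indicator P? ≡ ℤ.0ℤ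
*-indicator-no c P? ¬p = ≡.trans (≡.cong (c ℤ.*_) (indicator-no P? ¬p)) (ℤₚ.*-zeroʳ c)

*-indicator-yes : ∀ {P : Set} c (P? : Dec P) → P → c ℤ.* indicator P? ≡ c
*-indicator-yes c P? p = ≡.trans (≡.cong (c ℤ.*_) (indicator-yes P? p)) (ℤₚ.*-identityʳ c)

-- An entry of a product of 0/1 matrices is again 0 or 1 if at most one index contributes, and it is
-- 1 exactly when such an index exists. All the factorizations of line adjacency matrices are
-- checked this way.
sum-indicator-unique : ∀ {n} {P Q : Fin n → Set} {R′ : Set} (P? : ∀ i → Dec (P i)) (Q? : ∀ i → Dec (Q i)) (R? : Dec R′) →
  (∀ i → P i → Q i → R′) → (R′ → ∃ λ i → P i × Q i) → (∀ i j → P i → Q i → P j → Q j → i ≡ j) →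
  sum (λ i → indicator (P? i) ℤ.* indicator (Q? i)) ≡ indicator R?
sum-indicator-unique P? Q? R? sound complete unique with R?
... | no ¬r = sum-zero _ λ i → ≡.trans (≡.sym (indicator-× (P? i) (Q? i)))
  (indicator-no (P? i ×-dec Q? i) λ (p , q) → ¬r (sound i p q))
... | yes r with complete r
... | i , p , q = ≡.trans
  (sum-single _ i λ j j≢i → ≡.trans (≡.sym (indicator-× (P? j) (Q? j)))
    (indicator-no (P? j ×-dec Q? j) λ (p′ , q′) → j≢i (unique j i p′ q′ p q)))
  (≡.cong₂ ℤ._*_ (indicator-yes (P? i) p) (indicator-yes (Q? i) q))

sum-single-indicator : ∀ {n} (f : Fin n → ℤ) k → sum (λ i → f i ℤ.* indicator (i ≟ k)) ≡ f k
sum-single-indicator f k = ≡.trans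
  (sum-single _ k λ i i≢k → *-indicator-no (f i) (i ≟ k) i≢k) (*-indicator-yes (f k) (k ≟ k) ≡.refl)

♯-sum : ∀ {n} {P : Fin n → Set} (P? : ∀ i → Dec (P i)) → + ♯ P? ≡ sum (λ i → indicator (P? i))
♯-sum {n} P? = count-tabulate n id
  where
  open import Data.Vec.Base using (count; tabulate)
  count-tabulate : ∀ k (f : Fin k → Fin n) → + count P? (tabulate f) ≡ sum (λ i → indicator (P? (f i)))
  count-tabulate zero    f = ≡.refl
  count-tabulate (suc k) f with P? (f zero)
  ... | yes _ = ≡.cong (ℤ._+_ (+ 1)) (count-tabulate k (f ∘ suc))
  ... | no _  = ≡.trans (count-tabulate k (f ∘ suc)) (≡.sym (ℤₚ.+-identityˡ _))

module _ (D : FiniteDigraph) where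
  open FiniteDigraph D
  open DigraphNotions D
  open DigraphMatrices D

  adjacency-sum : ∀ v w → adjacency v w ≡ sum (λ e → indicator (s e ≟ v) ℤ.* indicator (r e ≟ w))
  adjacency-sum v w = ≡.trans (♯-sum (λ e → (s e ≟ v) ×-dec (r e ≟ w)))
    (sum-cong-≗ λ e → indicator-× (s e ≟ v) (r e ≟ w))

  Spec-A≋Spec-L : Spec-A D ≋ Spec-L D
  Spec-A≋Spec-L = specℤ-factor adjacency lineAdjacency
    (λ v e → indicator (s e ≟ v)) (λ e w → indicator (r e ≟ w))
    (λ v w → ≡.sym (adjacency-sum v w))
    (λ e f → sum-indicator-unique (r e ≟_) (s f ≟_) (r e ≟ s f)
      (λ v p q → ≡.trans p (≡.sym q)) (λ p → r e , ≡.refl , ≡.sym p) (λ v w p _ q _ → ≡.trans (≡.sym p) q))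

-- The common form of Moves (S) and (I): o sends an edge to the edge it comes from, and the new
-- range of an edge depends only on the edge it comes from.  Move (O) is the dual.
record SourceCover (D : FiniteDigraph) (G : Digraph) : Set where
  private
    module D = FiniteDigraph D
    module G = Digraph G
  field
    origin   : G.E → D.E
    newRange : D.E → G.V
    range    : ∀ e → G.r e ≡ newRange (origin e)
    sound    : ∀ e f → newRange e ≡ G.s f → D.r e ≡ D.s (origin f)
    complete : ∀ e f → D.r e ≡ D.s f → ∃ λ f′ → newRange e ≡ G.s f′ × origin f′ ≡ f
    unique   : ∀ f f′ → origin f ≡ origin f′ → G.s f ≡ G.s f′ → f ≡ f′

record RangeCover (D : FiniteDigraph) (G : Digraph) : Set where
  private
    module D = FiniteDigraph D
    module G = Digraph G
  field
    origin    : G.E → D.E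
    newSource : D.E → G.V
    source    : ∀ e → G.s e ≡ newSource (origin e)
    sound     : ∀ e f → G.r e ≡ newSource f → D.r (origin e) ≡ D.s f
    complete  : ∀ e f → D.r e ≡ D.s f → ∃ λ e′ → origin e′ ≡ e × G.r e′ ≡ newSource f
    unique    : ∀ e e′ → origin e ≡ origin e′ → G.r e ≡ G.r e′ → e ≡ e′

module _ {G H : Digraph} (iso : G ≅ H) where
  private
    module G = Digraph G
    module H = Digraph H
    open _≅_ iso
    toV : G.V → H.V
    toV = Inverse.to vertices
    toE : G.E → H.E
    toE = Inverse.to edges
    fromE : H.E → G.E
    fromE = Inverse.from edges
    toE-fromE : ∀ e → toE (fromE e) ≡ e
    toE-fromE e = Inverse.inverseˡ edges ≡.refl
    fromE-toE : ∀ e → fromE (toE e) ≡ e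
    fromE-toE e = Inverse.inverseʳ edges ≡.refl
    toV-injective : ∀ {v w} → toV v ≡ toV w → v ≡ w
    toV-injective = Injection.injective (↔⇒↣ vertices)
    s-to : ∀ e → H.s e ≡ toV (G.s (fromE e))
    s-to e = ≡.trans (≡.cong H.s (≡.sym (toE-fromE e))) (source (fromE e))
    r-to : ∀ e → H.r e ≡ toV (G.r (fromE e))
    r-to e = ≡.trans (≡.cong H.r (≡.sym (toE-fromE e))) (range (fromE e))
    fromE-injective : ∀ {e f} → fromE e ≡ fromE f → e ≡ f
    fromE-injective = Injection.injective (↔⇒↣ (↔-sym edges))

  sourceCover-≅ : ∀ {D} → SourceCover D G → SourceCover D H
  sourceCover-≅ c = record
    { origin   = c.origin ∘ fromE
    ; newRange = toV ∘ c.newRange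
    ; range    = λ e → ≡.trans (r-to e) (≡.cong toV (c.range (fromE e)))
    ; sound    = λ e f eq → c.sound e (fromE f) (toV-injective (≡.trans eq (s-to f)))
    ; complete = λ e f eq → let f′ , eq₁ , eq₂ = c.complete e f eq in
        toE f′ , ≡.trans (≡.cong toV eq₁) (≡.sym (source f′)) , ≡.trans (≡.cong c.origin (fromE-toE f′)) eq₂
    ; unique   = λ f f′ eq eq′ → fromE-injective (c.unique (fromE f) (fromE f′) eq
        (toV-injective (≡.trans (≡.sym (s-to f)) (≡.trans eq′ (s-to f′)))))
    }
    where module c = SourceCover c

  rangeCover-≅ : ∀ {D} → RangeCover D G → RangeCover D H
  rangeCover-≅ c = record
    { origin    = c.origin ∘ fromE
    ; newSource = toV ∘ c.newSource
    ; source    = λ e → ≡.trans (s-to e) (≡.cong toV (c.source (fromE e)))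
    ; sound     = λ e f eq → c.sound (fromE e) f (toV-injective (≡.trans (≡.sym (r-to e)) eq))
    ; complete  = λ e f eq → let e′ , eq₁ , eq₂ = c.complete e f eq in
        toE e′ , ≡.trans (≡.cong c.origin (fromE-toE e′)) eq₁ , ≡.trans (range e′) (≡.cong toV eq₂)
    ; unique    = λ e e′ eq eq′ → fromE-injective (c.unique (fromE e) (fromE e′) eq
        (toV-injective (≡.trans (≡.sym (r-to e)) (≡.trans eq′ (r-to e′)))))
    }
    where module c = RangeCover c

module _ (D D′ : FiniteDigraph) where
  private
    module D = FiniteDigraph D
    module D′ = FiniteDigraph D′
  open DigraphMatrices using (lineAdjacency)

  -- Let B record which edges of `D′` start at the new range of an edge of `D`, and C the origin of
  -- an edge of `D′`. Then `sound`, `complete` and `unique` say that BC is the line adjacency matrix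
  -- of `D`, and `range` says that CB is that of `D′`.
  sourceCover-Spec-L : SourceCover D ⟦ D′ ⟧ → Spec-L D ≋ Spec-L D′
  sourceCover-Spec-L c = specℤ-factor (lineAdjacency D) (lineAdjacency D′)
    (λ e f → indicator (newRange e ≟ D′.s f)) (λ e f → indicator (origin e ≟ f))
    (λ e f → sum-indicator-unique (λ f′ → newRange e ≟ D′.s f′) (λ f′ → origin f′ ≟ f) (D.r e ≟ D.s f)
      (λ f′ p q → ≡.trans (sound e f′ p) (≡.cong D.s q)) (complete e f)
      (λ f′ f″ p q p′ q′ → unique f′ f″ (≡.trans q (≡.sym q′)) (≡.trans (≡.sym p) p′)))
    (λ e f → sum-indicator-unique (origin e ≟_) (λ e′ → newRange e′ ≟ D′.s f) (D′.r e ≟ D′.s f)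
      (λ e′ p q → ≡.trans (range e) (≡.trans (≡.cong newRange p) q))
      (λ p → origin e , ≡.refl , ≡.trans (≡.sym (range e)) p)
      (λ e′ e″ p _ p′ _ → ≡.trans (≡.sym p) p′))
    where open SourceCover c

  rangeCover-Spec-L : RangeCover D ⟦ D′ ⟧ → Spec-L D ≋ Spec-L D′
  rangeCover-Spec-L c = specℤ-factor (lineAdjacency D) (lineAdjacency D′)
    (λ e e′ → indicator (origin e′ ≟ e)) (λ e f → indicator (D′.r e ≟ newSource f))
    (λ e f → sum-indicator-unique (λ e′ → origin e′ ≟ e) (λ e′ → D′.r e′ ≟ newSource f) (D.r e ≟ D.s f)
      (λ e′ p q → ≡.trans (≡.cong D.r (≡.sym p)) (sound e′ f q)) (complete e f)
      (λ e′ e″ p q p′ q′ → unique e′ e″ (≡.trans p (≡.sym p′)) (≡.trans q (≡.sym q′))))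
    (λ e f → sum-indicator-unique (λ f′ → D′.r e ≟ newSource f′) (origin f ≟_) (D′.r e ≟ D′.s f)
      (λ f′ p q → ≡.trans p (≡.trans (≡.cong newSource (≡.sym q)) (≡.sym (source f))))
      (λ p → origin f , ≡.trans p (source f) , ≡.refl)
      (λ f′ f″ _ q _ q′ → ≡.trans (≡.sym q) q′))
    where open RangeCover c

refinement-≡ : ∀ {A : Set} {P : A → Set} {x y : Refinement A P} → value x ≡ value y → x ≡ y
refinement-≡ ≡.refl = ≡.refl

-- A removed edge starts at the source `v`, so it follows no edge: whatever follows an edge
-- survives. Ranges survive too, none being `v`, even those of removed edges.
sourceRemoval-cover : ∀ {D} (a : SourceRemoval D) → SourceCover D (SourceRemoval.result a)
sourceRemoval-cover {D} a = record
  { origin   = value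
  ; newRange = λ e → r e , [ source e ]
  ; range    = λ _ → ≡.refl
  ; sound    = λ e f eq → ≡.cong value eq
  ; complete = λ e f eq → (f , [ (λ sf≡v → source e (≡.trans eq sf≡v)) ]) , refinement-≡ eq , ≡.refl
  ; unique   = λ f f′ eq _ → refinement-≡ eq }
  where
  open FiniteDigraph D
  open SourceRemoval a using (source)

-- If `e` ends at `v`, exactly one copy of each edge from `v` follows it, namely the copy starting
-- at the vertex of the block of `e`; copies are told apart by their sources. `parent` merges the
-- copies of `v` again.
insplit-cover : ∀ {D} (a : Insplit D) → SourceCover D (Insplit.result a)
insplit-cover {D} a = record
  { origin   = original
  ; newRange = λ e → splitRange e (r e ≟ v)
  ; range    = λ _ → ≡.refl
  ; sound    = λ e f eq → ≡.trans (≡.sym (parent-range e (r e ≟ v))) (≡.trans (≡.cong parent eq) (parent-source f))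
  ; complete = complete
  ; unique   = unique }
  where
  open FiniteDigraph D
  open Insplit a
  parent : V′ → V
  parent (inj₁ w) = value w
  parent (inj₂ _) = v
  parent-range : ∀ e d → parent (splitRange e d) ≡ r e
  parent-range e (yes p) = ≡.sym p
  parent-range e (no _)  = ≡.refl
  parent-source : ∀ f → parent (s′ f) ≡ s (original f)
  parent-source (inj₁ _)                = ≡.refl
  parent-source (inj₂ ((e , [ p ]) , _)) = ≡.sym (recompute (s e ≟ v) p)
  complete : ∀ e f → r e ≡ s f → ∃ λ f′ → splitRange e (r e ≟ v) ≡ s′ f′ × original f′ ≡ f
  complete e f eq with s f ≟ v | r e ≟ v
  ... | yes p | yes q = inj₂ ((f , [ p ]) , block (e , [ q ])) , ≡.refl , ≡.refl
  ... | yes p | no ¬q = contradiction (≡.trans eq p) ¬q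
  ... | no ¬p | yes q = contradiction (≡.trans (≡.sym eq) q) ¬p
  ... | no ¬p | no ¬q = inj₁ (f , [ ¬p ]) , ≡.cong inj₁ (refinement-≡ eq) , ≡.refl
  unique : ∀ f f′ → original f ≡ original f′ → s′ f ≡ s′ f′ → f ≡ f′
  unique (inj₁ _)       (inj₁ _)        eq eq′    = ≡.cong inj₁ (refinement-≡ eq)
  unique (inj₂ (_ , j)) (inj₂ (_ , .j)) eq ≡.refl = ≡.cong (λ e → inj₂ (e , j)) (refinement-≡ eq)

-- The mirror image: an edge `f` from `v` starts at the vertex of its block, and among the copies of
-- an edge into `v` exactly the one ending there precedes `f`.
outsplit-cover : ∀ {D} (a : Outsplit D) → RangeCover D (Outsplit.result a)
outsplit-cover {D} a = record
  { origin    = original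
  ; newSource = λ e → splitSource e (s e ≟ v)
  ; source    = λ _ → ≡.refl
  ; sound     = λ e f eq → ≡.trans (≡.sym (parent-range e)) (≡.trans (≡.cong parent eq) (parent-source f (s f ≟ v)))
  ; complete  = complete
  ; unique    = unique }
  where
  open FiniteDigraph D
  open Outsplit a
  parent : V′ → V
  parent (inj₁ w) = value w
  parent (inj₂ _) = v
  parent-source : ∀ e d → parent (splitSource e d) ≡ s e
  parent-source e (yes p) = ≡.sym p
  parent-source e (no _)  = ≡.refl
  parent-range : ∀ f → parent (r′ f) ≡ r (original f)
  parent-range (inj₁ _)                = ≡.refl
  parent-range (inj₂ ((e , [ p ]) , _)) = ≡.sym (recompute (r e ≟ v) p)
  complete : ∀ e f → r e ≡ s f → ∃ λ e′ → original e′ ≡ e × r′ e′ ≡ splitSource f (s f ≟ v)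
  complete e f eq with r e ≟ v | s f ≟ v
  ... | yes p | yes q = inj₂ ((e , [ p ]) , block (f , [ q ])) , ≡.refl , ≡.refl
  ... | yes p | no ¬q = contradiction (≡.trans (≡.sym eq) p) ¬q
  ... | no ¬p | yes q = contradiction (≡.trans eq q) ¬p
  ... | no ¬p | no ¬q = inj₁ (e , [ ¬p ]) , ≡.refl , ≡.cong inj₁ (refinement-≡ eq)
  unique : ∀ e e′ → original e ≡ original e′ → r′ e ≡ r′ e′ → e ≡ e′
  unique (inj₁ _)       (inj₁ _)        eq eq′    = ≡.cong inj₁ (refinement-≡ eq)
  unique (inj₂ (_ , j)) (inj₂ (_ , .j)) eq ≡.refl = ≡.cong (λ e → inj₂ (e , j)) (refinement-≡ eq)

module _ (𝒞 : FiniteDigraph → Set) where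
  S-preserves-L : Preserves 𝒞 Spec-L S
  S-preserves-L D D′ _ _ (a , iso) = sourceCover-Spec-L D D′ (sourceCover-≅ iso (sourceRemoval-cover a))

  O-preserves-L : Preserves 𝒞 Spec-L O
  O-preserves-L D D′ _ _ (a , iso) = rangeCover-Spec-L D D′ (rangeCover-≅ iso (outsplit-cover a))

  I-preserves-L : Preserves 𝒞 Spec-L I
  I-preserves-L D D′ _ _ (a , iso) = sourceCover-Spec-L D D′ (sourceCover-≅ iso (insplit-cover a))

  preserves-L⇒preserves-A : ∀ {μ} → Preserves 𝒞 Spec-L μ → Preserves 𝒞 Spec-A μ
  preserves-L⇒preserves-A h D D′ c c′ move = ≋-trans {Spec-A D} {Spec-L D} {Spec-A D′} (Spec-A≋Spec-L D)
    (≋-trans {Spec-L D} {Spec-L D′} {Spec-A D′} (h D D′ c c′ move) (≋-sym {Spec-A D′} {Spec-L D′} (Spec-A≋Spec-L D′)))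

-- Zeros are demanded in the columns outside the image of `ι`, while the rows there may be nonzero,
-- as is the row of a removed source in the binary adjacency matrix.
record CornerOf {m n} (M : Matrix ℤ m m) (N : Matrix ℤ n n) (ι : Fin n → Fin m) : Set where
  field
    injective : ∀ {i j} → ι i ≡ ι j → i ≡ j
    inside    : ∀ i j → M (ι i) (ι j) ≡ N i j
    outside   : ∀ i j → (∀ k → ι k ≢ j) → M i j ≡ ℤ.0ℤ

module _ {m n} (ι : Fin n → Fin m) (ι-injective : ∀ {i j} → ι i ≡ ι j → i ≡ j) where
  sum-image-indicator : (f : Fin m → ℤ) → (∀ j → (∀ k → ι k ≢ j) → f j ≡ ℤ.0ℤ) →
    ∀ j → sum (λ k → f (ι k) ℤ.* indicator (ι k ≟ j)) ≡ f j
  sum-image-indicator f f≡0 j with any? (λ k → ι k ≟ j)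
  ... | no ∄k = ≡.trans
    (sum-zero (λ k → f (ι k) ℤ.* indicator (ι k ≟ j)) λ k → *-indicator-no (f (ι k)) (ι k ≟ j) λ p → ∄k (k , p))
    (≡.sym (f≡0 j λ k p → ∄k (k , p)))
  ... | yes (k , ≡.refl) = ≡.trans
    (sum-single (λ l → f (ι l) ℤ.* indicator (ι l ≟ ι k)) k λ l l≢k → *-indicator-no (f (ι l)) (ι l ≟ ι k) (l≢k ∘ ι-injective))
    (*-indicator-yes (f (ι k)) (ι k ≟ ι k) ≡.refl)

  sum-image : (f : Fin m → ℤ) → (∀ j → (∀ k → ι k ≢ j) → f j ≡ ℤ.0ℤ) → sum f ≡ sum (f ∘ ι)
  sum-image f f≡0 = begin
    sum f
      ≡⟨ sum-cong-≗ (sum-image-indicator f f≡0) ⟨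
    sum (λ j → sum (λ k → f (ι k) ℤ.* indicator (ι k ≟ j)))
      ≡⟨ ∑-comm (λ j k → f (ι k) ℤ.* indicator (ι k ≟ j)) ⟩
    sum (λ k → sum (λ j → f (ι k) ℤ.* indicator (ι k ≟ j)))           ≡⟨ sum-cong-≗ (λ k → sum-cong-≗ λ j →
      ≡.cong (f (ι k) ℤ.*_) (indicator-⇔ (ι k ≟ j) (j ≟ ι k) (mk⇔ ≡.sym ≡.sym))) ⟩
    sum (λ k → sum (λ j → f (ι k) ℤ.* indicator (j ≟ ι k)))
      ≡⟨ sum-cong-≗ (λ k → sum-single-indicator (const (f (ι k))) (ι k)) ⟩
    sum (f ∘ ι)                                                       ∎
    where open ≡.≡-Reasoning

-- `M` is the product of its columns in the image of `ι` with the 0/1 matrix selecting that image.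
-- In the other order the product keeps only the rows in the image, which leaves `N`.
specℤ-corner : ∀ {m n} {M : Matrix ℤ m m} {N : Matrix ℤ n n} {ι} → CornerOf M N ι → specℤ M ≋ specℤ N
specℤ-corner {M = M} {N} {ι} c = specℤ-factor M N (λ i k → M i (ι k)) (λ k j → indicator (ι k ≟ j))
  (λ i j → sum-image-indicator ι injective (M i) (outside i) j)
  (λ k l → ≡.trans (sum-cong-≗ λ j → ≡.trans (ℤₚ.*-comm (indicator (ι k ≟ j)) (M j (ι l)))
      (≡.cong (M j (ι l) ℤ.*_) (indicator-⇔ (ι k ≟ j) (j ≟ ι k) (mk⇔ ≡.sym ≡.sym))))
    (≡.trans (sum-single-indicator (λ j → M j (ι l)) (ι k)) (inside k l)))
  where open CornerOf c

module _ (𝒞 : FiniteDigraph → Set) where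
  -- No edge ends at the removed source, so its column is zero; every deleted edge starts there, so
  -- adjacency among the other vertices is unchanged.
  S-preserves-Ab : Preserves 𝒞 Spec-Ab S
  S-preserves-Ab D D′ _ _ (a , iso) = specℤ-corner {ι = ι} record
    { injective = λ eq → from-injective (refinement-≡ eq)
    ; inside    = λ v w → indicator-⇔ (adjacent? D (ι v) (ι w)) (adjacent? D′ v w) (mk⇔ (to′ v w) (from′ v w))
    ; outside   = λ x y y∉ι → indicator-no (adjacent? D x y) λ (e , _ , re≡y) → case-v y y∉ι (y ≟ v) e re≡y }
    where
    open SourceRemoval a
    open DigraphNotions
    open _≅_ iso using (vertices; edges) renaming (source to source-≅; range to range-≅)
    module D = FiniteDigraph D
    module D′ = FiniteDigraph D′
    ι : D′.V → D.V
    ι w = value (Inverse.from vertices w)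
    from-injective : ∀ {w w′} → Inverse.from vertices w ≡ Inverse.from vertices w′ → w ≡ w′
    from-injective = Injection.injective (↔⇒↣ (↔-sym vertices))
    to-≡ : ∀ x w → value x ≡ ι w → Inverse.to vertices x ≡ w
    to-≡ x w eq = ≡.trans (≡.cong (Inverse.to vertices) (refinement-≡ eq)) (Inverse.inverseˡ vertices ≡.refl)
    avoid : ∀ {x} (w : Refinement D.V (_≢ v)) → x ≡ value w → Irrelevant (x ≢ v)
    avoid (_ , [ w≢v ]) ≡.refl = [ w≢v ]
    to′ : ∀ w w′ → Adjacent D (ι w) (ι w′) → Adjacent D′ w w′
    to′ w w′ (e , se , re) = Inverse.to edges e′ ,
      ≡.trans (source-≅ e′) (to-≡ _ w se) , ≡.trans (range-≅ e′) (to-≡ _ w′ re)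
      where
      e′ : Digraph.E (SourceRemoval.result a)
      e′ = e , avoid (Inverse.from vertices w) se
    from′ : ∀ w w′ → Adjacent D′ w w′ → Adjacent D (ι w) (ι w′)
    from′ w w′ (e , se , re) = value e₀ ,
      ≡.trans (≡.cong value (≡.sym (Inverse.inverseʳ vertices (source-≅ e₀)))) (≡.cong ι (≡.trans (≡.cong D′.s e₀-e) se)) ,
      ≡.trans (≡.cong value (≡.sym (Inverse.inverseʳ vertices (range-≅ e₀)))) (≡.cong ι (≡.trans (≡.cong D′.r e₀-e) re))
      where
      e₀ : Digraph.E (SourceRemoval.result a)
      e₀ = Inverse.from edges e
      e₀-e : Inverse.to edges e₀ ≡ e
      e₀-e = Inverse.inverseˡ edges ≡.refl
    case-v : ∀ y → (∀ w → ι w ≢ y) → Dec (y ≡ v) → ∀ e → D.r e ≢ y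
    case-v y y∉ι (yes ≡.refl) e re≡y = source e re≡y
    case-v y y∉ι (no y≢v) e _ = y∉ι (Inverse.to vertices (y , [ y≢v ]))
      (≡.cong value (Inverse.inverseʳ vertices ≡.refl))

skewPart : ∀ {n} → Matrix ℤ n n → Matrix ℤ n n
skewPart N = N ℤMatrix.⊟ transpose N

rowSumLaplacian : ∀ {n} → Matrix ℤ n n → Matrix ℤ n n
rowSumLaplacian M = ℤMatrix.diag (λ v → sum (M v)) ℤMatrix.⊟ M

Antisymmetric : ∀ {n} → Matrix ℤ n n → Set
Antisymmetric M = ∀ i j → M i j ≡ ℤ.- M j i

skewPart-antisymmetric : ∀ {n} (N : Matrix ℤ n n) → Antisymmetric (skewPart N)
skewPart-antisymmetric N i j = solve 2 (λ a b → a :- b := :- (b :- a)) ≡.refl (N i j) (N j i)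
  where open ℤSolver

-- Outside the image the columns of `M` vanish, hence by antisymmetry the rows as well, and with
-- them the row sums on the diagonal. Inside, a row sum of `M` only sees columns in the image.
rowSumLaplacian-corner : ∀ {m n} {M : Matrix ℤ m m} {N : Matrix ℤ n n} {ι} → Antisymmetric M →
  CornerOf M N ι → CornerOf (rowSumLaplacian M) (rowSumLaplacian N) ι
rowSumLaplacian-corner {m} {M = M} {N} {ι} antisymmetric c = record
  { injective = injective
  ; inside = λ i j → ≡.cong₂ (λ a b → a ℤ.+ ℤ.- b) (diag-inside i j) (inside i j)
  ; outside = λ i j j∉ι → ≡.cong₂ (λ a b → a ℤ.+ ℤ.- b) (diag-outside i j j∉ι) (outside i j j∉ι) }
  where
  open CornerOf c
  diag-inside : ∀ i j → ℤMatrix.diag (λ v → sum (M v)) (ι i) (ι j) ≡ ℤMatrix.diag (λ v → sum (N v)) i j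
  diag-inside i j with i ≟ j | ι i ≟ ι j
  ... | yes _   | yes _   = ≡.trans (sum-image ι injective (M (ι i)) (outside (ι i))) (sum-cong-≗ (inside i))
  ... | yes i≡j | no ιi≢ιj = contradiction (≡.cong ι i≡j) ιi≢ιj
  ... | no i≢j  | yes ιi≡ιj = contradiction (injective ιi≡ιj) i≢j
  ... | no _    | no _    = ≡.refl
  diag-outside : ∀ i j → (∀ k → ι k ≢ j) → ℤMatrix.diag (λ v → sum (M v)) i j ≡ ℤ.0ℤ
  diag-outside i j j∉ι with i ≟ j
  ... | yes ≡.refl = sum-zero (M i) λ l → ≡.trans (antisymmetric i l) (≡.cong ℤ.-_ (outside l i j∉ι))
  ... | no _ = ≡.refl

module _ (D : FiniteDigraph) where
  open FiniteDigraph D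
  open DigraphNotions D
  open DigraphMatrices D

  -- Each edge is counted at its range: insert `1 = Σ_w [w = r e]` and exchange the sums.
  outdeg-sum : ∀ v → + outdeg v ≡ sum (λ w → adjacency v w)
  outdeg-sum v = begin
    + outdeg v                                                                    ≡⟨ ♯-sum (λ e → s e ≟ v) ⟩
    sum (λ e → indicator (s e ≟ v))
      ≡⟨ sum-cong-≗ (λ e → sum-single-indicator (const (indicator (s e ≟ v))) (r e)) ⟨
    sum (λ e → sum (λ w → indicator (s e ≟ v) ℤ.* indicator (w ≟ r e)))
      ≡⟨ ∑-comm (λ e w → indicator (s e ≟ v) ℤ.* indicator (w ≟ r e)) ⟩
    sum (λ w → sum (λ e → indicator (s e ≟ v) ℤ.* indicator (w ≟ r e)))
      ≡⟨ sum-cong-≗ (λ w → ≡.trans (adjacency-sum D v w)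
      (sum-cong-≗ λ e → ≡.cong (indicator (s e ≟ v) ℤ.*_) (indicator-⇔ (r e ≟ w) (w ≟ r e) (mk⇔ ≡.sym ≡.sym)))) ⟨
    sum (λ w → adjacency v w)                                                     ∎
    where open ≡.≡-Reasoning

  indeg-sum : ∀ v → + indeg v ≡ sum (λ w → adjacency w v)
  indeg-sum v = begin
    + indeg v                                                                     ≡⟨ ♯-sum (λ e → r e ≟ v) ⟩
    sum (λ e → indicator (r e ≟ v))
      ≡⟨ sum-cong-≗ (λ e → sum-single-indicator (const (indicator (r e ≟ v))) (s e)) ⟨
    sum (λ e → sum (λ w → indicator (r e ≟ v) ℤ.* indicator (w ≟ s e)))
      ≡⟨ ∑-comm (λ e w → indicator (r e ≟ v) ℤ.* indicator (w ≟ s e)) ⟩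
    sum (λ w → sum (λ e → indicator (r e ≟ v) ℤ.* indicator (w ≟ s e)))
      ≡⟨ sum-cong-≗ (λ w → ≡.trans (adjacency-sum D w v)
      (sum-cong-≗ λ e → ≡.trans (ℤₚ.*-comm (indicator (s e ≟ w)) (indicator (r e ≟ v)))
        (≡.cong (indicator (r e ≟ v) ℤ.*_) (indicator-⇔ (s e ≟ w) (w ≟ s e) (mk⇔ ≡.sym ≡.sym))))) ⟨
    sum (λ w → adjacency w v)                                                     ∎
    where open ≡.≡-Reasoning

  sum-difference : ∀ {n} (f g : Fin n → ℤ) → sum f ℤ.- sum g ≡ sum (λ i → f i ℤ.- g i)
  sum-difference f g = ≡.sym (≡.trans (∑-distrib-+ f (λ i → ℤ.- g i)) (≡.cong (ℤ._+_ (sum f)) (≡.trans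
    (sum-cong-≗ (λ i → ≡.sym (ℤₚ.-1*i≡-i (g i)))) (≡.trans (≡.sym (*-distribˡ-sum ℤ.-1ℤ g)) (ℤₚ.-1*i≡-i (sum g))))))

  private
    laplacian-≗ : (d : Fin ∣V∣ → ℤ) (N : Matrix ℤ ∣V∣ ∣V∣) → (∀ v → d v ≡ sum (skewPart N v)) →
      ∀ v w → (ℤMatrix.diag d ℤMatrix.⊟ skewPart N) v w ≡ rowSumLaplacian (skewPart N) v w
    laplacian-≗ d N eq v w = ≡.cong (ℤ._+ ℤ.- skewPart N v w) (entry v w)
      where
      entry : ∀ v w → ℤMatrix.diag d v w ≡ ℤMatrix.diag (λ v → sum (skewPart N v)) v w
      entry v w with v ≟ w
      ... | yes _ = eq v
      ... | no _  = ≡.refl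

  skewLaplacian-≗ : ∀ v w → skewLaplacian v w ≡ rowSumLaplacian skew v w
  skewLaplacian-≗ = laplacian-≗ _ adjacency λ v → ≡.trans
    (≡.cong₂ ℤ._-_ (outdeg-sum v) (indeg-sum v)) (sum-difference (adjacency v) (λ w → adjacency w v))

  binarySkewLaplacian-≗ : ∀ v w → binarySkewLaplacian v w ≡ rowSumLaplacian binarySkew v w
  binarySkewLaplacian-≗ = laplacian-≗ _ binaryAdjacency λ v → ≡.trans
    (≡.cong₂ ℤ._-_ (♯-sum (λ w → adjacent? v w)) (♯-sum (λ w → adjacent? w v)))
    (sum-difference (binaryAdjacency v) (λ w → binaryAdjacency w v))

spliceEdges : Fin 6 ↔ SpliceEdge
spliceEdges = mk↔ₛ′ to from to-from from-to
  where
  to : Fin 6 → SpliceEdge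
  to 0F = e₁
  to 1F = e₂
  to 2F = f₁
  to 3F = f₂
  to 4F = h₁
  to 5F = h₂
  from : SpliceEdge → Fin 6
  from e₁ = 0F
  from e₂ = 1F
  from f₁ = 2F
  from f₂ = 3F
  from h₁ = 4F
  from h₂ = 5F
  to-from : ∀ e → to (from e) ≡ e
  to-from e₁ = ≡.refl
  to-from e₂ = ≡.refl
  to-from f₁ = ≡.refl
  to-from f₂ = ≡.refl
  to-from h₁ = ≡.refl
  to-from h₂ = ≡.refl
  from-to : ∀ i → from (to i) ≡ i
  from-to 0F = ≡.refl
  from-to 1F = ≡.refl
  from-to 2F = ≡.refl
  from-to 3F = ≡.refl
  from-to 4F = ≡.refl
  from-to 5F = ≡.refl

module _ (D D′ : FiniteDigraph) (a : CuntzSplice D) (iso : CuntzSplice.result a ≅ ⟦ D′ ⟧) where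
  private
    module D = FiniteDigraph D
    module D′ = FiniteDigraph D′
    open CuntzSplice a using (v; V′; E′; s′; r′)
    open _≅_ iso
    open DigraphMatrices using (adjacency; binaryAdjacency; skew; binarySkew)
    open DigraphNotions using (Adjacent; adjacent?)

    toV : V′ → D′.V
    toV = Inverse.to vertices
    toE : E′ → D′.E
    toE = Inverse.to edges

    ι : D.V → D′.V
    ι w = toV (inj₁ w)

    toV-injective : ∀ {x y} → toV x ≡ toV y → x ≡ y
    toV-injective = Injection.injective (↔⇒↣ vertices)

    ι-injective : ∀ {w w′} → ι w ≡ ι w′ → w ≡ w′
    ι-injective eq with toV-injective eq
    ... | ≡.refl = ≡.refl

    ι≢u : ∀ {w x} → ι w ≢ toV (inj₂ x)
    ι≢u eq with toV-injective eq
    ... | ()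

    -- Lists the old edges first and the six new ones last, so that a sum over the edges of `D′`
    -- splits into two.
    enumeration : Permutation (D.∣E∣ ℕ.+ 6) D′.∣E∣
    enumeration = ↔-trans Finₚ.+↔⊎ (↔-trans
      (↔-refl ⊎-↔ ↔-trans spliceEdges (mk↔ₛ′ (tt ,_) proj₂ (λ _ → ≡.refl) (λ _ → ≡.refl))) edges)

    oldEdges spliceEdges′ : D′.V → D′.V → ℤ
    oldEdges x y = sum (λ e → indicator (ι (D.s e) ≟ x) ℤ.* indicator (ι (D.r e) ≟ y))
    spliceEdges′ x y = sum (λ k → let e = inj₂ (tt , Inverse.to spliceEdges k) in
      indicator (toV (s′ e) ≟ x) ℤ.* indicator (toV (r′ e) ≟ y))

    adjacency-split : ∀ x y → adjacency D′ x y ≡ oldEdges x y ℤ.+ spliceEdges′ x y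
    adjacency-split x y = begin
      adjacency D′ x y                                         ≡⟨ adjacency-sum D′ x y ⟩
      sum (λ e → term (D′.s e) (D′.r e))
        ≡⟨ sum-permute (λ e → term (D′.s e) (D′.r e)) enumeration ⟩
      sum (λ k → term (D′.s (enum k)) (D′.r (enum k)))
        ≡⟨ sum-↑ D.∣E∣ (λ k → term (D′.s (enum k)) (D′.r (enum k))) ⟩
      sum (λ e → term (D′.s (enum (e ↑ˡ 6))) (D′.r (enum (e ↑ˡ 6)))) ℤ.+
      sum (λ k → term (D′.s (enum (D.∣E∣ ↑ʳ k))) (D′.r (enum (D.∣E∣ ↑ʳ k))))
        ≡⟨ ≡.cong₂ ℤ._+_
             (sum-cong-≗ λ e → ≡.trans (≡.cong₂ term (≡.cong D′.s (enum-↑ˡ e)) (≡.cong D′.r (enum-↑ˡ e)))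
                 (≡.cong₂ term (source (inj₁ e)) (range (inj₁ e))))
             (sum-cong-≗ λ k → ≡.trans (≡.cong₂ term (≡.cong D′.s (enum-↑ʳ k)) (≡.cong D′.r (enum-↑ʳ k)))
               (≡.cong₂ term (source (inj₂ (tt , Inverse.to spliceEdges k))) (range (inj₂ (tt , Inverse.to spliceEdges k))))) ⟩
      oldEdges x y ℤ.+ spliceEdges′ x y    ∎
      where
      open ≡.≡-Reasoning
      term : D′.V → D′.V → ℤ
      term p q = indicator (p ≟ x) ℤ.* indicator (q ≟ y)
      enum : Fin (D.∣E∣ ℕ.+ 6) → D′.E
      enum = Inverse.to enumeration
      enum-↑ˡ : ∀ e → enum (e ↑ˡ 6) ≡ toE (inj₁ e)
      enum-↑ˡ e rewrite Finₚ.splitAt-↑ˡ D.∣E∣ e 6 = ≡.refl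
      enum-↑ʳ : ∀ k → enum (D.∣E∣ ↑ʳ k) ≡ toE (inj₂ (tt , Inverse.to spliceEdges k))
      enum-↑ʳ k rewrite Finₚ.splitAt-↑ʳ D.∣E∣ 6 k = ≡.refl

    -- Reversing edges permutes e₁, …, h₂.
    spliceEdges-symmetric : ∀ x y → spliceEdges′ x y ≡ spliceEdges′ y x
    spliceEdges-symmetric x y = solve 6 (λ a b c a′ b′ c′ →
      a :* b′ :+ (b :* a′ :+ (b :* b′ :+ (b :* c′ :+ (c :* b′ :+ (c :* c′ :+ con (+ 0)))))) :=
      a′ :* b :+ (b′ :* a :+ (b′ :* b :+ (b′ :* c :+ (c′ :* b :+ (c′ :* c :+ con (+ 0))))))) ≡.refl
      (indicator (ι v ≟ x)) (indicator (toV (inj₂ (tt , u₁)) ≟ x)) (indicator (toV (inj₂ (tt , u₂)) ≟ x))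
      (indicator (ι v ≟ y)) (indicator (toV (inj₂ (tt , u₁)) ≟ y)) (indicator (toV (inj₂ (tt , u₂)) ≟ y))
      where open ℤSolver

    skew-old : ∀ x y → skew D′ x y ≡ oldEdges x y ℤ.- oldEdges y x
    skew-old x y rewrite adjacency-split x y | adjacency-split y x | spliceEdges-symmetric x y =
      solve 3 (λ a b c → (a :+ c) :- (b :+ c) := a :- b) ≡.refl (oldEdges x y) (oldEdges y x) (spliceEdges′ y x)
      where open ℤSolver

    oldEdges-ι : ∀ w w′ → oldEdges (ι w) (ι w′) ≡ adjacency D w w′
    oldEdges-ι w w′ = ≡.sym (≡.trans (adjacency-sum D w w′) (sum-cong-≗ λ e → ≡.cong₂ ℤ._*_
      (indicator-⇔ (D.s e ≟ w) (ι (D.s e) ≟ ι w) (mk⇔ (≡.cong ι) ι-injective))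
      (indicator-⇔ (D.r e ≟ w′) (ι (D.r e) ≟ ι w′) (mk⇔ (≡.cong ι) ι-injective))))

    skew-corner : CornerOf (skew D′) (skew D) ι
    skew-corner = record
      { injective = ι-injective
      ; inside    = λ w w′ → ≡.trans (skew-old (ι w) (ι w′)) (≡.cong₂ ℤ._-_ (oldEdges-ι w w′) (oldEdges-ι w′ w))
      ; outside   = λ x y y∉ι → ≡.trans (skew-old x y) (≡.cong₂ ℤ._-_
          (sum-zero (λ e → indicator (ι (D.s e) ≟ x) ℤ.* indicator (ι (D.r e) ≟ y)) λ e → *-indicator-no
              (indicator (ι (D.s e) ≟ x)) (ι (D.r e) ≟ y) (y∉ι (D.r e)))
          (sum-zero (λ e → indicator (ι (D.s e) ≟ y) ℤ.* indicator (ι (D.r e) ≟ x)) λ e → ≡.trans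
              (≡.cong (ℤ._* indicator (ι (D.r e) ≟ x)) (indicator-no (ι (D.s e) ≟ y) (y∉ι (D.s e))))
                  (ℤₚ.*-zeroˡ (indicator (ι (D.r e) ≟ x))))) }

    reverse : SpliceEdge → SpliceEdge
    reverse e₁ = e₂
    reverse e₂ = e₁
    reverse f₁ = f₁
    reverse f₂ = h₁
    reverse h₁ = f₂
    reverse h₂ = h₂

    s-reverse : ∀ e → s′ (inj₂ (tt , reverse e)) ≡ r′ (inj₂ (tt , e))
    s-reverse e₁ = ≡.refl
    s-reverse e₂ = ≡.refl
    s-reverse f₁ = ≡.refl
    s-reverse f₂ = ≡.refl
    s-reverse h₁ = ≡.refl
    s-reverse h₂ = ≡.refl

    r-reverse : ∀ e → r′ (inj₂ (tt , reverse e)) ≡ s′ (inj₂ (tt , e))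
    r-reverse e₁ = ≡.refl
    r-reverse e₂ = ≡.refl
    r-reverse f₁ = ≡.refl
    r-reverse f₂ = ≡.refl
    r-reverse h₁ = ≡.refl
    r-reverse h₂ = ≡.refl

    adjacent⇒edge : ∀ {x y} → Adjacent D′ x y → ∃ λ e → toV (s′ e) ≡ x × toV (r′ e) ≡ y
    adjacent⇒edge (e , se , re) = Inverse.from edges e ,
      ≡.trans (≡.sym (source _)) (≡.trans (≡.cong D′.s (Inverse.inverseˡ edges ≡.refl)) se) ,
      ≡.trans (≡.sym (range _)) (≡.trans (≡.cong D′.r (Inverse.inverseˡ edges ≡.refl)) re)

    edge⇒adjacent : ∀ {x y} e → toV (s′ e) ≡ x → toV (r′ e) ≡ y → Adjacent D′ x y
    edge⇒adjacent e se re = toE e , ≡.trans (source e) se , ≡.trans (range e) re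

    -- Every new edge has an end at `u₁` or `u₂`, so no adjacency arises between old vertices.
    adjacent-ι : ∀ {w w′} → Adjacent D′ (ι w) (ι w′) → Adjacent D w w′
    adjacent-ι adj with adjacent⇒edge adj
    ... | inj₁ e , se , re = e , ι-injective se , ι-injective re
    ... | inj₂ (_ , e₁) , se , re = contradiction (≡.sym re) ι≢u
    ... | inj₂ (_ , e₂) , se , re = contradiction (≡.sym se) ι≢u
    ... | inj₂ (_ , f₁) , se , re = contradiction (≡.sym se) ι≢u
    ... | inj₂ (_ , f₂) , se , re = contradiction (≡.sym se) ι≢u
    ... | inj₂ (_ , h₁) , se , re = contradiction (≡.sym se) ι≢u
    ... | inj₂ (_ , h₂) , se , re = contradiction (≡.sym se) ι≢u

    binaryAdjacency-ι : ∀ w w′ → binaryAdjacency D′ (ι w) (ι w′) ≡ binaryAdjacency D w w′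
    binaryAdjacency-ι w w′ = indicator-⇔ (adjacent? D′ (ι w) (ι w′)) (adjacent? D w w′)
      (mk⇔ adjacent-ι λ (e , se , re) → edge⇒adjacent (inj₁ e) (≡.cong ι se) (≡.cong ι re))

    -- Only new edges touch a new vertex, and each has its reverse among them. The presence of
    -- edges, unlike their number, does not split as a sum over old and new edges, hence an argument
    -- with the edges themselves.
    adjacent-reverse : ∀ {x y} → (∀ w → ι w ≢ x) ⊎ (∀ w → ι w ≢ y) → Adjacent D′ x y → Adjacent D′ y x
    adjacent-reverse new adj with adjacent⇒edge adj
    adjacent-reverse (inj₁ x∉ι) adj | inj₁ e , se , re = contradiction se (x∉ι (D.s e))
    adjacent-reverse (inj₂ y∉ι) adj | inj₁ e , se , re = contradiction re (y∉ι (D.r e))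
    ... | inj₂ (_ , e) , se , re = edge⇒adjacent (inj₂ (tt , reverse e))
      (≡.trans (≡.cong toV (s-reverse e)) re) (≡.trans (≡.cong toV (r-reverse e)) se)

    binarySkew-corner : CornerOf (binarySkew D′) (binarySkew D) ι
    binarySkew-corner = record
      { injective = ι-injective
      ; inside    = λ w w′ → ≡.cong₂ ℤ._-_ (binaryAdjacency-ι w w′) (binaryAdjacency-ι w′ w)
      ; outside   = λ x y y∉ι → ≡.trans
          (≡.cong (ℤ._- binaryAdjacency D′ y x) (indicator-⇔ (adjacent? D′ x y) (adjacent? D′ y x)
            (mk⇔ (adjacent-reverse (inj₂ y∉ι)) (adjacent-reverse (inj₁ y∉ι)))))
          (ℤₚ.+-inverseʳ (binaryAdjacency D′ y x)) }

  splice-Spec-S : Spec-S D ≋ Spec-S D′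
  splice-Spec-S = ≋-sym {Spec-S D′} {Spec-S D} (specℤ-corner skew-corner)

  splice-Spec-Sb : Spec-Sb D ≋ Spec-Sb D′
  splice-Spec-Sb = ≋-sym {Spec-Sb D′} {Spec-Sb D} (specℤ-corner binarySkew-corner)

  splice-Spec-ΔS : Spec-ΔS D ≋ Spec-ΔS D′
  splice-Spec-ΔS = ≋-trans {Spec-ΔS D} {specℤ (rowSumLaplacian (skew D))} {Spec-ΔS D′} (specℤ-cong (skewLaplacian-≗ D))
    (≋-sym {Spec-ΔS D′} {specℤ (rowSumLaplacian (skew D))}
      (≋-trans {Spec-ΔS D′} {specℤ (rowSumLaplacian (skew D′))} {specℤ (rowSumLaplacian (skew D))}
          (specℤ-cong (skewLaplacian-≗ D′))
        (specℤ-corner (rowSumLaplacian-corner (skewPart-antisymmetric (adjacency D′)) skew-corner))))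

  splice-Spec-ΔbS : Spec-ΔbS D ≋ Spec-ΔbS D′
  splice-Spec-ΔbS = ≋-trans {Spec-ΔbS D} {specℤ (rowSumLaplacian (binarySkew D))} {Spec-ΔbS D′}
    (specℤ-cong (binarySkewLaplacian-≗ D))
    (≋-sym {Spec-ΔbS D′} {specℤ (rowSumLaplacian (binarySkew D))}
      (≋-trans {Spec-ΔbS D′} {specℤ (rowSumLaplacian (binarySkew D′))} {specℤ (rowSumLaplacian (binarySkew D))}
          (specℤ-cong (binarySkewLaplacian-≗ D′))
        (specℤ-corner (rowSumLaplacian-corner (skewPart-antisymmetric (binaryAdjacency D′)) binarySkew-corner))))

-- Finite digraphs obtained by moves

-- A concrete enumeration, since moved digraphs have to compute: the determinants of their matrices
-- are evaluated during type checking.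
record Finite (A : Set) : Set where
  field
    size        : ℕ
    enumeration : A ↔ Fin size
open Finite

finite-Fin : ∀ n → Finite (Fin n)
finite-Fin n = record { size = n ; enumeration = ↔-refl }

finite-⊎ : ∀ {A B : Set} → Finite A → Finite B → Finite (A ⊎ B)
finite-⊎ a b = record
  { size = size a ℕ.+ size b
  ; enumeration = ↔-trans (enumeration a ⊎-↔ enumeration b) (↔-sym Finₚ.+↔⊎) }

finite-× : ∀ {A B : Set} → Finite A → Finite B → Finite (A × B)
finite-× a b = record
  { size = size a ℕ.* size b
  ; enumeration = ↔-trans (enumeration a ×-↔ enumeration b) (↔-sym Finₚ.*↔×) }

finite-Refinement : ∀ {n} {T : Fin n → Set} → (∀ i → Dec (T i)) → Finite (Refinement (Fin n) T)
finite-Refinement {zero} T? = record { size = 0 ; enumeration = mk↔ₛ′ (λ ()) (λ ()) (λ ()) (λ ()) }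
finite-Refinement {suc n} {T} T? with finite-Refinement (T? ∘ suc) | T? zero
... | fin | yes t = record
  { size = suc (size fin)
  ; enumeration = mk↔ₛ′ to from to-from from-to }
  where
  to : Refinement (Fin (suc n)) T → Fin (suc (size fin))
  to (zero , _)  = zero
  to (suc i , p) = suc (Inverse.to (enumeration fin) (i , p))
  shift : Refinement (Fin n) (T ∘ suc) → Refinement (Fin (suc n)) T
  shift (i , p) = suc i , p
  from : Fin (suc (size fin)) → Refinement (Fin (suc n)) T
  from zero    = zero , [ t ]
  from (suc k) = shift (Inverse.from (enumeration fin) k)
  to-from : ∀ k → to (from k) ≡ k
  to-from zero    = ≡.refl
  to-from (suc k) = ≡.cong suc (Inverse.inverseˡ (enumeration fin) ≡.refl)
  from-to : ∀ x → from (to x) ≡ x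
  from-to (zero , _)  = refinement-≡ ≡.refl
  from-to (suc i , p) = ≡.cong shift (Inverse.inverseʳ (enumeration fin) ≡.refl)
... | fin | no ¬t = record
  { size = size fin
  ; enumeration = mk↔ₛ′ to (shift ∘ Inverse.from (enumeration fin))
      (λ k → Inverse.inverseˡ (enumeration fin) ≡.refl) from-to }
  where
  to : Refinement (Fin (suc n)) T → Fin (size fin)
  to (zero , [ t ]) = ⊥-elim-irr (¬t t)
  to (suc i , p) = Inverse.to (enumeration fin) (i , p)
  shift : Refinement (Fin n) (T ∘ suc) → Refinement (Fin (suc n)) T
  shift (i , p) = suc i , p
  from-to : ∀ x → shift (Inverse.from (enumeration fin) (to x)) ≡ x
  from-to (zero , [ t ]) = ⊥-elim-irr (¬t t)
  from-to (suc i , p) = ≡.cong shift (Inverse.inverseʳ (enumeration fin) ≡.refl)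

finite-⊤ : Finite ⊤
finite-⊤ = record { size = 1 ; enumeration = mk↔ₛ′ (const zero) (const tt) (λ { zero → ≡.refl }) (λ _ → ≡.refl) }

finite-SpliceVertex : Finite SpliceVertex
finite-SpliceVertex = record
  { size = 2
  ; enumeration = mk↔ₛ′ (λ { u₁ → 0F ; u₂ → 1F }) (λ { 0F → u₁ ; 1F → u₂ })
      (λ { 0F → ≡.refl ; 1F → ≡.refl }) (λ { u₁ → ≡.refl ; u₂ → ≡.refl }) }

finite-SpliceEdge : Finite SpliceEdge
finite-SpliceEdge = record { size = 6 ; enumeration = ↔-sym spliceEdges }

module _ {D : FiniteDigraph} (a : Eclosing D) where
  open Eclosing a using (Copy; bar; tilde)
  finite-Copy : Finite Copy
  finite-Copy = record
    { size = 2
    ; enumeration = mk↔ₛ′ (λ { bar → 0F ; tilde → 1F }) (λ { 0F → bar ; 1F → tilde })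
        (λ { 0F → ≡.refl ; 1F → ≡.refl }) (λ { bar → ≡.refl ; tilde → ≡.refl }) }

-- The vertex orders chosen here are those in which vectors and matrices of moved digraphs are
-- written below: surviving vertices first, then the blocks in order, or `u₁` before `u₂`.
finite-result : ∀ μ {D} (a : Admissible μ D) → Finite (Digraph.V (result μ a)) × Finite (Digraph.E (result μ a))
finite-result S {D} a =
  finite-Refinement (λ w → ¬? (w ≟ v)) , finite-Refinement (λ e → ¬? (s e ≟ v))
  where
  open FiniteDigraph D
  open SourceRemoval a
finite-result R {D} a =
  finite-Refinement (λ w → ¬? (w ≟ v)) ,
  finite-⊎ (finite-Refinement λ e → ¬? (e ≟ f) ×-dec ¬? (r e ≟ v)) (finite-Refinement λ e → r e ≟ v)
  where
  open FiniteDigraph D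
  open Reduction a
finite-result O {D} a =
  finite-⊎ (finite-Refinement λ w → ¬? (w ≟ v)) (finite-Fin blocks) ,
  finite-⊎ (finite-Refinement λ e → ¬? (r e ≟ v)) (finite-× (finite-Refinement λ e → r e ≟ v) (finite-Fin blocks))
  where
  open FiniteDigraph D
  open Outsplit a
finite-result I {D} a =
  finite-⊎ (finite-Refinement λ w → ¬? (w ≟ v)) (finite-Fin blocks) ,
  finite-⊎ (finite-Refinement λ e → ¬? (s e ≟ v)) (finite-× (finite-Refinement λ e → s e ≟ v) (finite-Fin blocks))
  where
  open FiniteDigraph D
  open Insplit a
finite-result C {D} a =
  finite-⊎ (finite-Fin ∣V∣) (finite-× finite-⊤ finite-SpliceVertex) ,
  finite-⊎ (finite-Fin ∣E∣) (finite-× finite-⊤ finite-SpliceEdge)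
  where open FiniteDigraph D
finite-result P {D} a =
  finite-⊎ (finite-Fin ∣V∣) (finite-× finite-S finite-SpliceVertex) ,
  finite-⊎ (finite-⊎ (finite-Fin ∣E∣) (finite-× finite-S finite-SpliceEdge))
    (finite-× (finite-Refinement λ e → (s e ≟ v) ×-dec ¬? (r e ≟ v)) (finite-Copy a))
  where
  open FiniteDigraph D
  open DigraphNotions D
  open Eclosing a renaming (S to Successor)
  finite-S : Finite Successor
  finite-S = finite-Refinement λ w → ¬? (w ≟ v) ×-dec adjacent? v w

module _ (G : Digraph) (finV : Finite (Digraph.V G)) (finE : Finite (Digraph.E G)) where
  open Digraph G

  finitize : FiniteDigraph
  finitize = record
    { ∣V∣ = size finV ; ∣E∣ = size finE
    ; s = Inverse.to (enumeration finV) ∘ s ∘ Inverse.from (enumeration finE)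
    ; r = Inverse.to (enumeration finV) ∘ r ∘ Inverse.from (enumeration finE) }

  ≅-finitize : G ≅ ⟦ finitize ⟧
  ≅-finitize = record
    { vertices = enumeration finV
    ; edges    = enumeration finE
    ; source   = λ e → ≡.cong (Inverse.to (enumeration finV) ∘ s) (Inverse.inverseʳ (enumeration finE) ≡.refl)
    ; range    = λ e → ≡.cong (Inverse.to (enumeration finV) ∘ r) (Inverse.inverseʳ (enumeration finE) ≡.refl) }

module _ μ {D} (a : Admissible μ D) where
  moved : FiniteDigraph
  moved = finitize (result μ a) (proj₁ (finite-result μ a)) (proj₂ (finite-result μ a))

  move : D ⟶[ μ ] moved
  move = a , ≅-finitize (result μ a) (proj₁ (finite-result μ a)) (proj₂ (finite-result μ a))

fromEdges : ∀ {n m} → Vec (Fin n × Fin n) m → FiniteDigraph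
fromEdges {n} {m} es = record { ∣V∣ = n ; ∣E∣ = m ; s = proj₁ ∘ Vec.lookup es ; r = proj₂ ∘ Vec.lookup es }

module _ (D : FiniteDigraph) where
  open FiniteDigraph D
  open DigraphNotions D using (IsPath)

  -- At most `k` edges: the bound turns strong connectedness of the examples into a finite search.
  Walk : ℕ → V → V → Set
  Walk zero    v w = v ≡ w
  Walk (suc k) v w = v ≡ w ⊎ ∃ λ e → s e ≡ v × Walk k (r e) w

  walk? : ∀ k v w → Dec (Walk k v w)
  walk? zero    v w = v ≟ w
  walk? (suc k) v w = (v ≟ w) ⊎-dec any? (λ e → (s e ≟ v) ×-dec walk? k (r e) w)

  private
    NonemptyPathFrom : E → V → Set
    NonemptyPathFrom e w = ∃₂ λ n (p : Vec E (suc n)) → IsPath p × Vec.head p ≡ e × r (Vec.last p) ≡ w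

    cons : ∀ {e f w} → r e ≡ s f → NonemptyPathFrom f w → NonemptyPathFrom e w
    cons {e} eq (n , f ∷ p , isPath , ≡.refl , rp) = suc n , e ∷ f ∷ p , eq ∷ isPath , ≡.refl , rp

    walk⇒path : ∀ k e {w} → Walk k (r e) w → NonemptyPathFrom e w
    walk⇒path zero    e re≡w                    = 0 , e ∷ [] , [-] , ≡.refl , re≡w
    walk⇒path (suc k) e (inj₁ re≡w)             = 0 , e ∷ [] , [-] , ≡.refl , re≡w
    walk⇒path (suc k) e (inj₂ (f , sf≡re , wk)) = cons (≡.sym sf≡re) (walk⇒path k f wk)

  walks⇒stronglyConnected : ∀ k → (∀ v w → Walk k v w) → StronglyConnected D
  walks⇒stronglyConnected zero    walk v w = inj₁ (walk v w)
  walks⇒stronglyConnected (suc k) walk v w with walk v w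
  ... | inj₁ v≡w = inj₁ v≡w
  ... | inj₂ (e , se≡v , wk) with walk⇒path k e wk
  ... | n , p , isPath , ≡.refl , rp = inj₂ (n , p , isPath , se≡v , rp)

  stronglyConnected? : ∀ k → Dec (∀ v w → Walk k v w)
  stronglyConnected? k = all? λ v → all? λ w → walk? k v w

-- Moves that change a spectrum

ℤ[i]-rawRing : RawRing 0ℓ 0ℓ
ℤ[i]-rawRing = record
  { Carrier = ℤ × ℤ ; _≈_ = _≡_
  ; _+_ = λ (a , b) (c , d) → a ℤ.+ c , b ℤ.+ d
  ; _*_ = λ (a , b) (c , d) → a ℤ.* c ℤ.+ (ℤ.- (b ℤ.* d)) , a ℤ.* d ℤ.+ b ℤ.* c
  ; -_ = λ (a , b) → ℤ.- a , ℤ.- b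
  ; 0# = ℤ.0ℤ , ℤ.0ℤ ; 1# = ℤ.1ℤ , ℤ.0ℤ }

-- `reflects` is what turns a nonzero exact determinant into a nonzero complex number.
record ComplexEmbedding : Set₁ where
  field
    ring      : RawRing 0ℓ 0ℓ
    embed     : RawRing.Carrier ring → ℂ
    isHom     : IsRawHom ring ℂ-rawRing embed
    reflects  : ∀ x → embed x ≈ᶜ ℝ⇒ℂ 0ʳ → x ≡ RawRing.0# ring

module RootTest (emb : ComplexEmbedding) where
  open ComplexEmbedding emb
  open RawRing ring
  open MatrixOps ring
  open Multiplicity ℂ-commutativeRing
  private module Mℂ = MatrixOps ℂ-rawRing

  characteristicValue : ∀ {n} → Matrix Carrier n n → Carrier → Carrier
  characteristicValue M z = det (diag (const z) ⊟ M)

  module _ {n} (M : Matrix ℂ n n) (M₀ : Matrix Carrier n n) (M≈M₀ : ∀ i j → M i j ≈ᶜ embed (M₀ i j)) (z : Carrier) where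
    private
      open PolynomialRing.Evaluation ℂ-commutativeRing (embed z) using (ev)

      ev-value : ev (charPoly M) ≈ᶜ embed (characteristicValue M₀ z)
      ev-value = Rℂ.trans {ev (charPoly M)} {Mℂ.det (Mℂ.diag (const (embed z)) Mℂ.⊟ M)} {embed (characteristicValue M₀ z)}
        (ev-charPoly (embed z) M)
        (Rℂ.sym {embed (characteristicValue M₀ z)} {Mℂ.det (Mℂ.diag (const (embed z)) Mℂ.⊟ M)}
          (Rℂ.trans {embed (characteristicValue M₀ z)} {Mℂ.det (mapMatrix embed (diag (const z) ⊟ M₀))}
            {Mℂ.det (Mℂ.diag (const (embed z)) Mℂ.⊟ M)}
            (MatrixHom.det-homo ring ℂ-commutativeRing isHom (diag (const z) ⊟ M₀))
            (Determinants.det-cong ℂ-commutativeRing {M = mapMatrix embed (diag (const z) ⊟ M₀)}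
              {N = Mℂ.diag (const (embed z)) Mℂ.⊟ M} entry)))
        where
        entry : ∀ i j → embed ((diag (const z) ⊟ M₀) i j) ≈ᶜ (Mℂ.diag (const (embed z)) Mℂ.⊟ M) i j
        entry i j = Rℂ.trans {embed ((diag (const z) ⊟ M₀) i j)}
          {embed (diag (const z) i j) Rℂ.+ embed (- M₀ i j)} {(Mℂ.diag (const (embed z)) Mℂ.⊟ M) i j}
          (IsRawHom.+-homo isHom (diag (const z) i j) (- M₀ i j))
          (Rℂ.+-cong {embed (diag (const z) i j)} {Mℂ.diag (const (embed z)) i j} {embed (- M₀ i j)} {Rℂ.- M i j}
            (MatrixHom.diag-homo ring ℂ-commutativeRing isHom (const z) i j)
            (Rℂ.trans {embed (- M₀ i j)} {Rℂ.- embed (M₀ i j)} {Rℂ.- M i j} (IsRawHom.-‿homo isHom (M₀ i j))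
              (Rℂ.-‿cong {embed (M₀ i j)} {M i j} (Rℂ.sym {M i j} {embed (M₀ i j)} (M≈M₀ i j)))))

    root : characteristicValue M₀ z ≡ 0# → ¬ AlgMult M (embed z) 0
    root eq = root⇒¬multiplicity-0 (embed z) (charPoly M)
      (Rℂ.trans {ev (charPoly M)} {embed (characteristicValue M₀ z)} {Rℂ.0#} ev-value
        (≡.subst (λ x → embed x ≈ᶜ ℝ⇒ℂ 0ʳ) (≡.sym eq) (IsRawHom.0-homo isHom)))

    nonroot : characteristicValue M₀ z ≢ 0# → AlgMult M (embed z) 0
    nonroot neq = nonroot⇒multiplicity-0 (embed z) (charPoly M) λ ev≈0 → neq (reflects _
      (Rℂ.trans {embed (characteristicValue M₀ z)} {ev (charPoly M)} {Rℂ.0#}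
        (Rℂ.sym {ev (charPoly M)} {embed (characteristicValue M₀ z)} ev-value) ev≈0))

ℤ[i]⇒ℚ[i] : ℤ × ℤ → ℚ[i]
ℤ[i]⇒ℚ[i] (a , b) = a ℚ./ 1 , b ℚ./ 1

gaussianIntegers : ComplexEmbedding
gaussianIntegers = record
  { ring     = ℤ[i]-rawRing
  ; embed    = ℚ[i]⇒ℂ ∘ ℤ[i]⇒ℚ[i]
  ; isHom    = record
    { +-homo = λ (a , b) (c , d) → ≡⇒≈ʳ (+-homo a c) , ≡⇒≈ʳ (+-homo b d)
    ; *-homo = λ (a , b) (c , d) →
        ≡⇒≈ʳ (≡.trans (+-homo (a ℤ.* c) (ℤ.- (b ℤ.* d)))
          (≡.cong₂ ℚ._+_ (*-homo a c) (≡.trans (-‿homo (b ℤ.* d)) (≡.cong ℚ.-_ (*-homo b d))))) ,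
        ≡⇒≈ʳ (≡.trans (+-homo (a ℤ.* d) (b ℤ.* c)) (≡.cong₂ ℚ._+_ (*-homo a d) (*-homo b c)))
    ; -‿homo = λ (a , b) → ≡⇒≈ʳ (-‿homo a) , ≡⇒≈ʳ (-‿homo b)
    ; 0-homo = ≈ʳ-refl {0ʳ} , ≈ʳ-refl {0ʳ}
    ; 1-homo = ≈ʳ-refl {1ʳ} , ≈ʳ-refl {0ʳ} }
  ; reflects = λ (a , b) eq → let e = ℚ[i]⇒ℂ-reflects-0 _ eq in
      ≡.cong₂ _,_ (/1-reflects-0 a (≡.cong proj₁ e)) (/1-reflects-0 b (≡.cong proj₂ e)) }
  where open IsRawHom /1-isHom

module _ (emb : ComplexEmbedding) where
  open ComplexEmbedding emb
  open RawRing ring using (Carrier; 0#)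
  open RootTest emb

  -- Stated with Booleans, so that a separating eigenvalue is confirmed by evaluation: `refl` shows
  -- that exactly one of the two determinants is zero.
  ≋⇒same-roots : ∀ {m n} (M : Matrix ℂ m m) (N : Matrix ℂ n n) → AlgMult M ≋ AlgMult N →
    (M₀ : Matrix Carrier m m) (N₀ : Matrix Carrier n n) →
    (∀ i j → M i j ≈ᶜ embed (M₀ i j)) → (∀ i j → N i j ≈ᶜ embed (N₀ i j)) →
    ∀ z → z ≢ 0# → (_≟₀ : ∀ x → Dec (x ≡ 0#)) →
    does (characteristicValue M₀ z ≟₀) ≢ not (does (characteristicValue N₀ z ≟₀))
  ≋⇒same-roots M N M≋N M₀ N₀ M≈M₀ N≈N₀ z z≢0 _≟₀ with characteristicValue M₀ z ≟₀ | characteristicValue N₀ z ≟₀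
  ... | yes eq | no neq = λ _ → root M M₀ M≈M₀ z eq
    (Equivalence.from (M≋N (embed z) (z≢0 ∘ reflects z) 0) (nonroot N N₀ N≈N₀ z neq))
  ... | no neq | yes eq = λ _ → root N N₀ N≈N₀ z eq
    (Equivalence.to (M≋N (embed z) (z≢0 ∘ reflects z) 0) (nonroot M M₀ M≈M₀ z neq))
  ... | yes _ | yes _ = λ ()
  ... | no _ | no _ = λ ()

record GaussianSpectrum (X : Spectrum) : Set₁ where
  open FiniteDigraph using (∣V∣)
  field
    matrix   : ∀ D → Matrix ℂ (∣V∣ D) (∣V∣ D)
    spectrum : ∀ D → X D ≡ AlgMult (matrix D)
    gaussian : ∀ D → Matrix (ℤ × ℤ) (∣V∣ D) (∣V∣ D)
    exact    : ∀ D v w → matrix D v w ≈ᶜ ℚ[i]⇒ℂ (ℤ[i]⇒ℚ[i] (gaussian D v w))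

gaussianℤ : (M : ∀ D → Matrix ℤ (FiniteDigraph.∣V∣ D) (FiniteDigraph.∣V∣ D)) → GaussianSpectrum (λ D → specℤ (M D))
gaussianℤ M = record
  { matrix   = λ D → mapMatrix ℤ⇒ℂ (M D)
  ; spectrum = λ D → ≡.refl
  ; gaussian = λ D v w → M D v w , ℤ.0ℤ
  ; exact    = λ D v w → Rℂ.refl {ℤ⇒ℂ (M D v w)} }

gaussianH : GaussianSpectrum Spec-H
gaussianH = record
  { matrix   = DigraphMatrices.hermitian
  ; spectrum = λ D → ≡.refl
  ; gaussian = λ D v w → entry (does (adjacent? D v w)) (does (adjacent? D w v))
  ; exact    = exact }
  where
  open DigraphNotions using (adjacent?)
  entry : Bool → Bool → ℤ × ℤ
  entry true  true  = + 1 , + 0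
  entry true  false = + 0 , + 1
  entry false true  = + 0 , ℤ.-1ℤ
  entry false false = + 0 , + 0
  exact : ∀ D v w → DigraphMatrices.hermitian D v w ≈ᶜ
    ℚ[i]⇒ℂ (ℤ[i]⇒ℚ[i] (entry (does (adjacent? D v w)) (does (adjacent? D w v))))
  exact D v w with does (adjacent? D v w) | does (adjacent? D w v)
  ... | true  | true  = Rℂ.refl {ℝ⇒ℂ 1ʳ}
  ... | true  | false = Rℂ.refl {𝕚}
  ... | false | true  = pointwise {const 0ℚ} (λ _ → ≡.refl) , pointwise {const (ℚ.- 1ℚ)} (λ _ → ≡.refl)
  ... | false | false = Rℂ.refl {ℝ⇒ℂ 0ʳ}

_≟0ℤ[i] : ∀ (x : ℤ × ℤ) → Dec (x ≡ (ℤ.0ℤ , ℤ.0ℤ))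
x ≟0ℤ[i] = ≡-dec ℤₚ._≟_ ℤₚ._≟_ x (ℤ.0ℤ , ℤ.0ℤ)

-- Equal to M, but evaluated only once at each entry when type checking.
memoize : ∀ {A : Set} {m n} → Matrix A m n → Matrix A m n
memoize M = lookup′ (Vec.tabulate λ i → Vec.tabulate (M i))
  where
  lookup′ : ∀ {A : Set} {m n} → Vec (Vec A n) m → Matrix A m n
  lookup′ t i j = Vec.lookup (Vec.lookup t i) j

memoize-≡ : ∀ {A : Set} {m n} (M : Matrix A m n) i j → memoize M i j ≡ M i j
memoize-≡ M i j = ≡.trans (≡.cong (λ row → Vec.lookup row j) (lookup∘tabulate (λ i → Vec.tabulate (M i)) i))
  (lookup∘tabulate (M i) j)

module _ {X : Spectrum} (g : GaussianSpectrum X) where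
  open GaussianSpectrum g
  open RootTest gaussianIntegers using (characteristicValue)

  isEigenvalue : ℤ × ℤ → FiniteDigraph → Bool
  isEigenvalue z D = does (characteristicValue (memoize (gaussian D)) z ≟0ℤ[i])

  separated : ∀ D D′ z → z ≢ (ℤ.0ℤ , ℤ.0ℤ) → isEigenvalue z D ≡ not (isEigenvalue z D′) → ¬ (X D ≋ X D′)
  separated D D′ z z≢0 differ X≋X′ rewrite spectrum D | spectrum D′ =
    ≋⇒same-roots gaussianIntegers (matrix D) (matrix D′) X≋X′ (memoize (gaussian D)) (memoize (gaussian D′))
      (exact-memo D) (exact-memo D′) z z≢0 _≟0ℤ[i] differ
    where
    exact-memo : ∀ D v w → matrix D v w ≈ᶜ ℚ[i]⇒ℂ (ℤ[i]⇒ℚ[i] (memoize (gaussian D) v w))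
    exact-memo D v w = ≡.subst (λ x → matrix D v w ≈ᶜ ℚ[i]⇒ℂ (ℤ[i]⇒ℚ[i] x)) (≡.sym (memoize-≡ (gaussian D) v w)) (exact D v w)

record Example (𝒞 : FiniteDigraph → Set) (μ : Move) : Set where
  field
    before     : FiniteDigraph
    admissible : Admissible μ before
  after : FiniteDigraph
  after = moved μ admissible
  field
    before∈𝒞 : 𝒞 before
    after∈𝒞  : 𝒞 after

  refutes : ∀ {X} → ¬ (X before ≋ X after) → DoesNotPreserve 𝒞 X μ
  refutes ¬≋ = before , after , before∈𝒞 , after∈𝒞 , move μ admissible , ¬≋

refute : ∀ {𝒞 μ X} (ex : Example 𝒞 μ) (g : GaussianSpectrum X) (z : ℤ × ℤ) {z≢0 : False (z ≟0ℤ[i])} →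
  isEigenvalue g z (Example.before ex) ≡ not (isEigenvalue g z (Example.after ex)) → DoesNotPreserve 𝒞 X μ
refute ex g z {z≢0} differ = Example.refutes ex (separated g _ _ z (toWitnessFalse z≢0) differ)

⇔? : ∀ {A B : Set} → Dec A → Dec B → Dec (A ⇔ B)
⇔? A? B? = Dec.map′ (λ (f , g) → mk⇔ f g) (λ e → Equivalence.to e , Equivalence.from e) ((A? →-dec B?) ×-dec (B? →-dec A?))

module _ (D : FiniteDigraph) where
  open FiniteDigraph D
  open DigraphNotions D

  reduction : ∀ v f u →
    {True (all? λ e → ⇔? (s e ≟ v) (e ≟ f))} →
    {True (all? λ w → ⇔? (any? λ e → (r e ≟ v) ×-dec (s e ≟ w)) (w ≟ u))} →
    {False (u ≟ v)} → Reduction D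
  reduction v f u {s⁻¹v} {sr⁻¹v} {u≢v} = record
    { v = v ; regular = f , Equivalence.from (toWitness s⁻¹v f) ≡.refl ; f = f ; s⁻¹v = toWitness s⁻¹v
    ; u = u ; sr⁻¹v = toWitness sr⁻¹v ; u≢v = toWitnessFalse u≢v }

  outsplitting : ∀ v {n} (block : E → Fin n) → Regular v → (∀ j → ∃ λ e → s e ≡ v × block e ≡ j) → Outsplit D
  outsplitting v {n} block (e , se≡v) onto = record
    { v = v ; nonSink = λ sink → sink e se≡v ; blocks = n ; block = block ∘ value
    ; nonempty = λ j → let e , se≡v , eq = onto j in (e , [ se≡v ]) , eq }

  insplitting : ∀ v {n} (block : E → Fin n) → Regular v → ¬ IsSource v → (∀ j → ∃ λ e → r e ≡ v × block e ≡ j) → Insplit D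
  insplitting v {n} block regular nonSource onto = record
    { v = v ; regular = regular ; nonSource = nonSource ; blocks = n ; block = block ∘ value
    ; nonempty = λ j → let e , re≡v , eq = onto j in (e , [ re≡v ]) , eq }

  module _ (v : V) (loop : E) (s-loop : s loop ≡ v) (r-loop : r loop ≡ v) (only : ∀ e → r e ≡ v → e ≡ loop) where
    private
      -- The last edge of a return path at `v` enters `v`, so it is the loop; then the edge before
      -- it ends at `v` too, which a return path forbids.
      no-longer : ∀ {n} (p : Vec E (suc (suc n))) → IsPath p →
        VecAll.All (λ e → r (Vec.last p) ≢ r e) (Vec.init p) → r (Vec.last p) ≡ v → ⊥
      no-longer (e ∷ f ∷ [])    (re≡sf ∷ _) (rf≢re ∷ _) rf≡v =
        rf≢re (≡.trans rf≡v (≡.sym (≡.trans re≡sf (≡.trans (≡.cong s (only f rf≡v)) s-loop))))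
      no-longer (e ∷ f ∷ g ∷ p) (_ ∷ isPath) (_ ∷ distinct) eq = no-longer (f ∷ g ∷ p) isPath distinct eq

    onlyLoop-isReturnPath : IsReturnPathAt v (0 , loop ∷ [])
    onlyLoop-isReturnPath = ([-] , ≡.trans r-loop (≡.sym s-loop)) , [] , r-loop

    onlyLoop-isOnlyReturnPath : ∀ p → IsReturnPathAt v p → p ≡ (0 , loop ∷ [])
    onlyLoop-isOnlyReturnPath (zero , e ∷ []) (_ , _ , re≡v) = ≡.cong (λ e → 0 , e ∷ []) (only e re≡v)
    onlyLoop-isOnlyReturnPath (suc n , p) ((isPath , _) , distinct , eq) = ⊥-elim (no-longer p isPath distinct eq)

stronglyConnected : ∀ D k {w : True (stronglyConnected? D k)} → StronglyConnected D
stronglyConnected D k {w} = walks⇒stronglyConnected D k (toWitness w)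

-- Example digraphs

exampleS : Example AllDigraphs S
exampleS = record
  { before = D
  ; admissible = record { v = 1F ; regular = 0F , ≡.refl ; source = from-yes (all? λ e → ¬? (FiniteDigraph.r D e ≟ 1F)) }
  ; before∈𝒞 = tt ; after∈𝒞 = tt }
  where
  D : FiniteDigraph
  D = fromEdges {3} ((1F , 0F) ∷ (2F , 0F) ∷ [])

-- The reduced digraph has one vertex and three loops, with adjacency eigenvalue 3, against 2 and -1
-- before the move.
exampleR : Example StronglyConnected R
exampleR = record
  { before = D
  ; admissible = reduction D 0F 0F 1F
  ; before∈𝒞 = stronglyConnected D 2 ; after∈𝒞 = stronglyConnected _ 1 }
  where
  D : FiniteDigraph
  D = fromEdges {2} ((0F , 1F) ∷ (1F , 0F) ∷ (1F , 0F) ∷ (1F , 1F) ∷ [])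

-- For `exampleR` the binary skew adjacency matrices are zero and the skew Laplacians nilpotent, so
-- the skew spectra other than `Spec-S` call for a second digraph.
exampleR′ : Example StronglyConnected R
exampleR′ = record
  { before = D
  ; admissible = reduction D 3F 7F 2F
  ; before∈𝒞 = stronglyConnected D 4 ; after∈𝒞 = stronglyConnected _ 3 }
  where
  D : FiniteDigraph
  D = fromEdges {4} ((0F , 0F) ∷ (0F , 1F) ∷ (0F , 2F) ∷ (1F , 0F) ∷ (2F , 0F) ∷ (2F , 1F) ∷ (2F , 3F) ∷ (3F , 1F) ∷ [])

threeLoops : FiniteDigraph
threeLoops = fromEdges {1} ((0F , 0F) ∷ (0F , 0F) ∷ (0F , 0F) ∷ [])

threeLoops-block : Fin 3 → Fin 2
threeLoops-block 2F = 1F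
threeLoops-block _  = 0F

exampleO : Example StronglyConnected O
exampleO = record
  { before = threeLoops
  ; admissible = outsplitting threeLoops 0F threeLoops-block (0F , ≡.refl)
      λ { 0F → 0F , ≡.refl , ≡.refl ; 1F → 2F , ≡.refl , ≡.refl }
  ; before∈𝒞 = stronglyConnected threeLoops 1 ; after∈𝒞 = stronglyConnected _ 2 }

exampleI : Example StronglyConnected I
exampleI = record
  { before = threeLoops
  ; admissible = insplitting threeLoops 0F threeLoops-block (0F , ≡.refl) (λ source → source 0F ≡.refl)
      λ { 0F → 0F , ≡.refl , ≡.refl ; 1F → 2F , ≡.refl , ≡.refl }
  ; before∈𝒞 = stronglyConnected threeLoops 1 ; after∈𝒞 = stronglyConnected _ 2 }

-- Splitting `threeLoops` again gives a zero binary skew adjacency matrix and a nilpotent skew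
-- Laplacian, for outsplit and insplit alike.
splitExample : FiniteDigraph
splitExample = fromEdges {3} ((0F , 2F) ∷ (1F , 0F) ∷ (1F , 2F) ∷ (2F , 0F) ∷ (2F , 1F) ∷ (2F , 2F) ∷ [])

splitExample-block : Fin 6 → Fin 2
splitExample-block 5F = 1F
splitExample-block _  = 0F

exampleO′ : Example StronglyConnected O
exampleO′ = record
  { before = splitExample
  ; admissible = outsplitting splitExample 2F splitExample-block (3F , ≡.refl)
      λ { 0F → 3F , ≡.refl , ≡.refl ; 1F → 5F , ≡.refl , ≡.refl }
  ; before∈𝒞 = stronglyConnected splitExample 3 ; after∈𝒞 = stronglyConnected _ 4 }

exampleI′ : Example StronglyConnected I
exampleI′ = record
  { before = splitExample
  ; admissible = insplitting splitExample 2F splitExample-block (3F , ≡.refl) (λ source → source 0F ≡.refl)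
      λ { 0F → 0F , ≡.refl , ≡.refl ; 1F → 5F , ≡.refl , ≡.refl }
  ; before∈𝒞 = stronglyConnected splitExample 3 ; after∈𝒞 = stronglyConnected _ 4 }

exampleC : Example StronglyConnected C
exampleC = record
  { before = D
  ; admissible = record
    { v = 0F ; regular = 0F , ≡.refl
    ; returnPaths = (0 , 0F ∷ []) , (1 , 1F ∷ 2F ∷ []) ,
        (([-] , ≡.refl) , [] , ≡.refl) , (((≡.refl ∷ [-]) , ≡.refl) , (λ ()) ∷ [] , ≡.refl) , λ () }
  ; before∈𝒞 = stronglyConnected D 2 ; after∈𝒞 = stronglyConnected _ 4 }
  where
  D : FiniteDigraph
  D = fromEdges {2} ((0F , 0F) ∷ (0F , 1F) ∷ (1F , 0F) ∷ (1F , 0F) ∷ (1F , 1F) ∷ (1F , 1F) ∷ [])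

exampleP : Example AllDigraphs P
exampleP = record
  { before = D
  ; admissible = record
    { v = 0F ; loop = 0F
    ; isReturn = onlyLoop-isReturnPath D 0F 0F ≡.refl ≡.refl only
    ; only = onlyLoop-isOnlyReturnPath D 0F 0F ≡.refl ≡.refl only
    ; exit = here (1F , (λ ()) , ≡.refl)
    ; S-regular = λ { (0F , [ p ]) → ⊥-elim-irr (proj₁ p ≡.refl) ; (1F , _) → 2F , ≡.refl }
    ; S-returnPaths = λ
      { (0F , [ p ]) → ⊥-elim-irr (proj₁ p ≡.refl)
      ; (1F , _) → (0 , 2F ∷ []) , (0 , 3F ∷ []) , (([-] , ≡.refl) , [] , ≡.refl) , (([-] , ≡.refl) , [] , ≡.refl) , λ () } }
  ; before∈𝒞 = tt ; after∈𝒞 = tt }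
  where
  D : FiniteDigraph
  D = fromEdges {2} ((0F , 0F) ∷ (0F , 1F) ∷ (1F , 1F) ∷ (1F , 1F) ∷ [])
  only : ∀ e → FiniteDigraph.r D e ≡ 0F → e ≡ 0F
  only = from-yes (all? λ e → (FiniteDigraph.r D e ≟ 0F) →-dec (e ≟ 0F))

-- In `exampleP` the move adds irrational eigenvalues in some spectra: 1 ± √2 to the binary
-- adjacency spectrum and ±√2 to the skew Laplace spectrum, all of them out of reach of a test at
-- Gaussian integers.
exampleP′ : Example AllDigraphs P
exampleP′ = record
  { before = D
  ; admissible = record
    { v = 2F ; loop = 4F
    ; isReturn = onlyLoop-isReturnPath D 2F 4F ≡.refl ≡.refl only
    ; only = onlyLoop-isOnlyReturnPath D 2F 4F ≡.refl ≡.refl only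
    ; exit = here (3F , (λ ()) , ≡.refl)
    ; S-regular = λ
      { (0F , [ p ]) → ⊥-elim-irr (0-not-successor (proj₂ p))
      ; (1F , _) → 2F , ≡.refl
      ; (2F , [ p ]) → ⊥-elim-irr (proj₁ p ≡.refl) }
    ; S-returnPaths = λ
      { (0F , [ p ]) → ⊥-elim-irr (0-not-successor (proj₂ p))
      ; (1F , _) → (1 , 2F ∷ 0F ∷ []) , (1 , 2F ∷ 1F ∷ []) ,
            ((≡.refl ∷ [-] , ≡.refl) , (λ ()) ∷ [] , ≡.refl) , ((≡.refl ∷ [-] , ≡.refl) , (λ ()) ∷ [] , ≡.refl) , λ ()
      ; (2F , [ p ]) → ⊥-elim-irr (proj₁ p ≡.refl) } }
  ; before∈𝒞 = tt ; after∈𝒞 = tt }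
  where
  D : FiniteDigraph
  D = fromEdges {3} ((0F , 1F) ∷ (0F , 1F) ∷ (1F , 0F) ∷ (2F , 1F) ∷ (2F , 2F) ∷ [])
  only : ∀ e → FiniteDigraph.r D e ≡ 2F → e ≡ 4F
  only = from-yes (all? λ e → (FiniteDigraph.r D e ≟ 2F) →-dec (e ≟ 4F))
  0-not-successor : ¬ DigraphNotions.Adjacent D 2F 0F
  0-not-successor = from-no (DigraphNotions.adjacent? D 2F 0F)

-- Gaussian integers that are eigenvalues on one side only

open DigraphMatrices

private
  real imaginary : ℤ → ℤ × ℤ
  real n      = n , + 0
  imaginary n = + 0 , n

S-S : DoesNotPreserve AllDigraphs Spec-S S
S-S = refute exampleS (gaussianℤ skew) (imaginary (+ 1)) ≡.refl

S-Sb : DoesNotPreserve AllDigraphs Spec-Sb S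
S-Sb = refute exampleS (gaussianℤ binarySkew) (imaginary (+ 1)) ≡.refl

S-ΔS : DoesNotPreserve AllDigraphs Spec-ΔS S
S-ΔS = refute exampleS (gaussianℤ skewLaplacian) (real ℤ.-1ℤ) ≡.refl

S-ΔbS : DoesNotPreserve AllDigraphs Spec-ΔbS S
S-ΔbS = refute exampleS (gaussianℤ binarySkewLaplacian) (real ℤ.-1ℤ) ≡.refl

S-Δ : DoesNotPreserve AllDigraphs Spec-Δ S
S-Δ = refute exampleS (gaussianℤ laplacian) (real (+ 2)) ≡.refl

S-SA : DoesNotPreserve AllDigraphs SymSpec-A S
S-SA = refute exampleS (gaussianℤ symAdjacency) (real (+ 1)) ≡.refl

S-SAb : DoesNotPreserve AllDigraphs SymSpec-Ab S
S-SAb = refute exampleS (gaussianℤ symBinaryAdjacency) (real (+ 1)) ≡.refl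

S-H : DoesNotPreserve AllDigraphs Spec-H S
S-H = refute exampleS gaussianH (real ℤ.-1ℤ) ≡.refl

R-A : DoesNotPreserve StronglyConnected Spec-A R
R-A = refute exampleR (gaussianℤ adjacency) (real (+ 3)) ≡.refl

R-Ab : DoesNotPreserve StronglyConnected Spec-Ab R
R-Ab = refute exampleR (gaussianℤ binaryAdjacency) (real (+ 1)) ≡.refl

R-S : DoesNotPreserve StronglyConnected Spec-S R
R-S = refute exampleR (gaussianℤ skew) (imaginary (+ 1)) ≡.refl

R-Sb : DoesNotPreserve StronglyConnected Spec-Sb R
R-Sb = refute exampleR′ (gaussianℤ binarySkew) (imaginary (+ 1)) ≡.refl

R-ΔS : DoesNotPreserve StronglyConnected Spec-ΔS R
R-ΔS = refute exampleR′ (gaussianℤ skewLaplacian) (real ℤ.-1ℤ) ≡.refl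

R-ΔbS : DoesNotPreserve StronglyConnected Spec-ΔbS R
R-ΔbS = refute exampleR′ (gaussianℤ binarySkewLaplacian) (real ℤ.-1ℤ) ≡.refl

R-Δ : DoesNotPreserve StronglyConnected Spec-Δ R
R-Δ = refute exampleR (gaussianℤ laplacian) (real (+ 6)) ≡.refl

R-SA : DoesNotPreserve StronglyConnected SymSpec-A R
R-SA = refute exampleR (gaussianℤ symAdjacency) (real (+ 9)) ≡.refl

R-SAb : DoesNotPreserve StronglyConnected SymSpec-Ab R
R-SAb = refute exampleR (gaussianℤ symBinaryAdjacency) (real (+ 1)) ≡.refl

R-H : DoesNotPreserve StronglyConnected Spec-H R
R-H = refute exampleR gaussianH (real (+ 1)) ≡.refl

O-Ab : DoesNotPreserve StronglyConnected Spec-Ab O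
O-Ab = refute exampleO (gaussianℤ binaryAdjacency) (real (+ 2)) ≡.refl

O-S : DoesNotPreserve StronglyConnected Spec-S O
O-S = refute exampleO (gaussianℤ skew) (imaginary (+ 1)) ≡.refl

O-Sb : DoesNotPreserve StronglyConnected Spec-Sb O
O-Sb = refute exampleO′ (gaussianℤ binarySkew) (imaginary (+ 1)) ≡.refl

O-ΔS : DoesNotPreserve StronglyConnected Spec-ΔS O
O-ΔS = refute exampleO′ (gaussianℤ skewLaplacian) (real (+ 1)) ≡.refl

O-ΔbS : DoesNotPreserve StronglyConnected Spec-ΔbS O
O-ΔbS = refute exampleO′ (gaussianℤ binarySkewLaplacian) (real (+ 1)) ≡.refl

O-Δ : DoesNotPreserve StronglyConnected Spec-Δ O
O-Δ = refute exampleO (gaussianℤ laplacian) (real (+ 6)) ≡.refl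

O-SA : DoesNotPreserve StronglyConnected SymSpec-A O
O-SA = refute exampleO (gaussianℤ symAdjacency) (real (+ 10)) ≡.refl

O-SAb : DoesNotPreserve StronglyConnected SymSpec-Ab O
O-SAb = refute exampleO (gaussianℤ symBinaryAdjacency) (real (+ 4)) ≡.refl

O-H : DoesNotPreserve StronglyConnected Spec-H O
O-H = refute exampleO gaussianH (real (+ 2)) ≡.refl

I-Ab : DoesNotPreserve StronglyConnected Spec-Ab I
I-Ab = refute exampleI (gaussianℤ binaryAdjacency) (real (+ 2)) ≡.refl

I-S : DoesNotPreserve StronglyConnected Spec-S I
I-S = refute exampleI (gaussianℤ skew) (imaginary (+ 1)) ≡.refl

I-Sb : DoesNotPreserve StronglyConnected Spec-Sb I
I-Sb = refute exampleI′ (gaussianℤ binarySkew) (imaginary (+ 1)) ≡.refl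

I-ΔS : DoesNotPreserve StronglyConnected Spec-ΔS I
I-ΔS = refute exampleI′ (gaussianℤ skewLaplacian) (real ℤ.-1ℤ) ≡.refl

I-ΔbS : DoesNotPreserve StronglyConnected Spec-ΔbS I
I-ΔbS = refute exampleI′ (gaussianℤ binarySkewLaplacian) (real ℤ.-1ℤ) ≡.refl

I-Δ : DoesNotPreserve StronglyConnected Spec-Δ I
I-Δ = refute exampleI (gaussianℤ laplacian) (real (+ 6)) ≡.refl

I-SA : DoesNotPreserve StronglyConnected SymSpec-A I
I-SA = refute exampleI (gaussianℤ symAdjacency) (real (+ 10)) ≡.refl

I-SAb : DoesNotPreserve StronglyConnected SymSpec-Ab I
I-SAb = refute exampleI (gaussianℤ symBinaryAdjacency) (real (+ 4)) ≡.refl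

I-H : DoesNotPreserve StronglyConnected Spec-H I
I-H = refute exampleI gaussianH (real (+ 2)) ≡.refl

C-A : DoesNotPreserve StronglyConnected Spec-A C
C-A = refute exampleC (gaussianℤ adjacency) (real (+ 2)) ≡.refl

C-Ab : DoesNotPreserve StronglyConnected Spec-Ab C
C-Ab = refute exampleC (gaussianℤ binaryAdjacency) (real (+ 2)) ≡.refl

C-Δ : DoesNotPreserve StronglyConnected Spec-Δ C
C-Δ = refute exampleC (gaussianℤ laplacian) (real (+ 8)) ≡.refl

C-SA : DoesNotPreserve StronglyConnected SymSpec-A C
C-SA = refute exampleC (gaussianℤ symAdjacency) (real (+ 10)) ≡.refl

C-SAb : DoesNotPreserve StronglyConnected SymSpec-Ab C
C-SAb = refute exampleC (gaussianℤ symBinaryAdjacency) (real (+ 4)) ≡.refl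

C-H : DoesNotPreserve StronglyConnected Spec-H C
C-H = refute exampleC gaussianH (real (+ 2)) ≡.refl

P-A : DoesNotPreserve AllDigraphs Spec-A P
P-A = refute exampleP (gaussianℤ adjacency) (real (+ 2)) ≡.refl

P-Ab : DoesNotPreserve AllDigraphs Spec-Ab P
P-Ab = refute exampleP′ (gaussianℤ binaryAdjacency) (real ℤ.-1ℤ) ≡.refl

P-S : DoesNotPreserve AllDigraphs Spec-S P
P-S = refute exampleP (gaussianℤ skew) (imaginary (+ 1)) ≡.refl

P-Sb : DoesNotPreserve AllDigraphs Spec-Sb P
P-Sb = refute exampleP (gaussianℤ binarySkew) (imaginary (+ 1)) ≡.refl

P-ΔS : DoesNotPreserve AllDigraphs Spec-ΔS P
P-ΔS = refute exampleP′ (gaussianℤ skewLaplacian) (real ℤ.-1ℤ) ≡.refl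

P-ΔbS : DoesNotPreserve AllDigraphs Spec-ΔbS P
P-ΔbS = refute exampleP (gaussianℤ binarySkewLaplacian) (real ℤ.-1ℤ) ≡.refl

P-Δ : DoesNotPreserve AllDigraphs Spec-Δ P
P-Δ = refute exampleP (gaussianℤ laplacian) (real (+ 4)) ≡.refl

P-SA : DoesNotPreserve AllDigraphs SymSpec-A P
P-SA = refute exampleP′ (gaussianℤ symAdjacency) (real (+ 1)) ≡.refl

P-SAb : DoesNotPreserve AllDigraphs SymSpec-Ab P
P-SAb = refute exampleP (gaussianℤ symBinaryAdjacency) (real (+ 1)) ≡.refl

P-H : DoesNotPreserve AllDigraphs Spec-H P
P-H = refute exampleP gaussianH (real ℤ.-1ℤ) ≡.refl

-- Spectra of rational transition matrices

ℝ⇒ℂ-isHom : IsRawHom ℝ-rawRing ℂ-rawRing ℝ⇒ℂ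
ℝ⇒ℂ-isHom = record
  { +-homo = λ x y → ≈ʳ-refl {x +ʳ y} , ≈ʳ-refl {0ʳ}
  ; *-homo = λ x y →
      pointwise (λ n → solve 2 (λ a b → a :* b := a :* b :- con 0ℚ :* con 0ℚ) ≡.refl (seq x n) (seq y n)) ,
      pointwise (λ n → solve 2 (λ a b → con 0ℚ := a :* con 0ℚ :+ con 0ℚ :* b) ≡.refl (seq x n) (seq y n))
  ; -‿homo = λ x → ≈ʳ-refl { -ʳ x} , ≈ʳ-refl {0ʳ}
  ; 0-homo = ≈ʳ-refl {0ʳ} , ≈ʳ-refl {0ʳ}
  ; 1-homo = ≈ʳ-refl {1ʳ} , ≈ʳ-refl {0ʳ} }
  where open ℚSolver

module ℝMatrix = MatrixOps ℝ-rawRing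
module ℚMatrix = MatrixOps ℚ-rawRing

module _ {n} (M : Matrix ℝ n n) (x : ℝ) where
  private
    module ℂMatrix = MatrixOps ℂ-rawRing
    open Multiplicity ℂ-commutativeRing
    open PolynomialRing.Evaluation ℂ-commutativeRing (ℝ⇒ℂ x) using (ev)
    M-x : Matrix ℝ n n
    M-x = ℝMatrix.diag (const x) ℝMatrix.⊟ M
    M-xᶜ : Matrix ℂ n n
    M-xᶜ = ℂMatrix.diag (const (ℝ⇒ℂ x)) ℂMatrix.⊟ mapMatrix ℝ⇒ℂ M

    value≈ : ev (charPoly (mapMatrix ℝ⇒ℂ M)) ≈ᶜ ℝ⇒ℂ (ℝMatrix.det M-x)
    value≈ = Rℂ.trans {ev (charPoly (mapMatrix ℝ⇒ℂ M))} {ℂMatrix.det M-xᶜ} {ℝ⇒ℂ (ℝMatrix.det M-x)}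
      (ev-charPoly (ℝ⇒ℂ x) (mapMatrix ℝ⇒ℂ M))
      (Rℂ.trans {ℂMatrix.det M-xᶜ} {ℂMatrix.det (mapMatrix ℝ⇒ℂ M-x)} {ℝ⇒ℂ (ℝMatrix.det M-x)}
        (Determinants.det-cong ℂ-commutativeRing {M = M-xᶜ} {N = mapMatrix ℝ⇒ℂ M-x} λ i j →
          Rℂ.+-congʳ {ℝ⇒ℂ (-ʳ M i j)} {ℂMatrix.diag (const (ℝ⇒ℂ x)) i j} {ℝ⇒ℂ (ℝMatrix.diag (const x) i j)}
            (Rℂ.sym {ℝ⇒ℂ (ℝMatrix.diag (const x) i j)} {ℂMatrix.diag (const (ℝ⇒ℂ x)) i j}
              (MatrixHom.diag-homo ℝ-rawRing ℂ-commutativeRing ℝ⇒ℂ-isHom (const x) i j)))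
        (Rℂ.sym {ℝ⇒ℂ (ℝMatrix.det M-x)} {ℂMatrix.det (mapMatrix ℝ⇒ℂ M-x)}
          (MatrixHom.det-homo ℝ-rawRing ℂ-commutativeRing ℝ⇒ℂ-isHom M-x)))

  -- The entries are arbitrary reals, because a normalized Laplacian involves unknown square roots;
  -- rational arithmetic enters only through the value of the determinant.
  realRoot : ℝMatrix.det (ℝMatrix.diag (const x) ℝMatrix.⊟ M) ≈ʳ 0ʳ → ¬ specℝ M (ℝ⇒ℂ x) 0
  realRoot det≈0 = root⇒¬multiplicity-0 (ℝ⇒ℂ x) (charPoly (mapMatrix ℝ⇒ℂ M))
    (Rℂ.trans {ev (charPoly (mapMatrix ℝ⇒ℂ M))} {ℝ⇒ℂ (ℝMatrix.det M-x)} {Rℂ.0#} value≈ (det≈0 , ≈ʳ-refl {0ʳ}))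

  realNonroot : ¬ (ℝMatrix.det (ℝMatrix.diag (const x) ℝMatrix.⊟ M) ≈ʳ 0ʳ) → specℝ M (ℝ⇒ℂ x) 0
  realNonroot det≉0 = nonroot⇒multiplicity-0 (ℝ⇒ℂ x) (charPoly (mapMatrix ℝ⇒ℂ M)) λ ev≈0 → det≉0
    (proj₁ (Rℂ.trans {ℝ⇒ℂ (ℝMatrix.det M-x)} {ev (charPoly (mapMatrix ℝ⇒ℂ M))} {Rℂ.0#}
      (Rℂ.sym {ev (charPoly (mapMatrix ℝ⇒ℂ M))} {ℝ⇒ℂ (ℝMatrix.det M-x)} value≈) ev≈0))

det-ℚ : ∀ {n} (M : Matrix ℝ n n) (M₀ : Matrix ℚ n n) q → (∀ i j → M i j ≈ʳ ℚ⇒ℝ (M₀ i j)) →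
  ℝMatrix.det (ℝMatrix.diag (const (ℚ⇒ℝ q)) ℝMatrix.⊟ M) ≈ʳ ℚ⇒ℝ (ℚMatrix.det (ℚMatrix.diag (const q) ℚMatrix.⊟ M₀))
det-ℚ {n} M M₀ q M≈M₀ = Rℝ.trans {ℝMatrix.det M-q} {ℝMatrix.det (mapMatrix ℚ⇒ℝ M₀-q)} {ℚ⇒ℝ (ℚMatrix.det M₀-q)}
  (Determinants.det-cong ℝ-commutativeRing {M = M-q} {N = mapMatrix ℚ⇒ℝ M₀-q} λ i j →
    Rℝ.trans {M-q i j} {ℚ⇒ℝ (ℚMatrix.diag (const q) i j) +ʳ (-ʳ ℚ⇒ℝ (M₀ i j))} {ℚ⇒ℝ (M₀-q i j)}
      (Rℝ.+-cong {ℝMatrix.diag (const (ℚ⇒ℝ q)) i j} {ℚ⇒ℝ (ℚMatrix.diag (const q) i j)} { -ʳ M i j} { -ʳ ℚ⇒ℝ (M₀ i j)}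
        (Rℝ.sym {ℚ⇒ℝ (ℚMatrix.diag (const q) i j)} {ℝMatrix.diag (const (ℚ⇒ℝ q)) i j}
          (MatrixHom.diag-homo ℚ-rawRing ℝ-commutativeRing ℚ⇒ℝ-isHom (const q) i j))
        (Rℝ.-‿cong {M i j} {ℚ⇒ℝ (M₀ i j)} (M≈M₀ i j)))
      (≈ʳ-refl {ℚ⇒ℝ (M₀-q i j)}))
  (Rℝ.sym {ℚ⇒ℝ (ℚMatrix.det M₀-q)} {ℝMatrix.det (mapMatrix ℚ⇒ℝ M₀-q)}
    (MatrixHom.det-homo ℚ-rawRing ℝ-commutativeRing ℚ⇒ℝ-isHom M₀-q))
  where
  M-q : Matrix ℝ n n
  M-q = ℝMatrix.diag (const (ℚ⇒ℝ q)) ℝMatrix.⊟ M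
  M₀-q : Matrix ℚ n n
  M₀-q = ℚMatrix.diag (const q) ℚMatrix.⊟ M₀

open RawSemiringDefs (RawRing.rawSemiring ℚ-rawRing) using () renaming (sum to sumℚ)
module ℚLaplacian = LaplacianEntries ℚ-rawRing ½
module ℝLaplacian = TransitionLaplacians ℝ-commutativeRing ½ʳ
open EntryHom ℚ-rawRing ℝ-commutativeRing ℚ⇒ℝ-isHom ½ using (entry-homo)
module Σℝ = SumProperties (CommutativeRing.semiring ℝ-commutativeRing)

1sℚ : ∀ {n} → Vector ℚ n
1sℚ = const 1ℚ

combinatorialℚ : ∀ {n} → Matrix ℚ n n → Vector ℚ n → Matrix ℚ n n
combinatorialℚ T φ = ℚLaplacian.entry φ φ 1sℚ 1sℚ φ T

conjugatedℚ : ∀ {n} → Matrix ℚ n n → (φ ψ : Vector ℚ n) → Matrix ℚ n n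
conjugatedℚ T φ ψ = ℚLaplacian.entry 1sℚ 1sℚ 1sℚ ψ φ T

normalizedℚ : ∀ {n} → Matrix ℚ n n → (σ τ : Vector ℚ n) → Matrix ℚ n n
normalizedℚ T σ τ = ℚLaplacian.entry 1sℚ σ τ τ σ T

determinantAt : ∀ {n} → Matrix ℚ n n → ℚ → ℚ
determinantAt M q = ℚMatrix.det (ℚMatrix.diag (const q) ℚMatrix.⊟ memoize M)

IsInvariantℚ : ∀ {n} → Matrix ℚ n n → Vector ℚ n → Set
IsInvariantℚ T φ = (∀ v → 0ℚ ℚ.< φ v) × sumℚ φ ≡ 1ℚ × (∀ w → sumℚ (λ v → φ v ℚ.* T v w) ≡ φ w)

-- A certificate for the hypotheses of `invariant-unique`: unit row sums, a right inverse `B` of the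
-- matrix 1 - T + J, and `φ` as the column sums of `B`.
IsUniqueInvariantℚ : ∀ {n} → Matrix ℚ n n → Vector ℚ n → Matrix ℚ n n → Set
IsUniqueInvariantℚ T φ B = (∀ v → sumℚ (T v) ≡ 1ℚ) ×
  (∀ v w → sumℚ (λ u → (ℚMatrix.1ᴹ v u ℚ.- T v u ℚ.+ 1ℚ) ℚ.* B u w) ≡ ℚMatrix.1ᴹ v w) × (∀ w → sumℚ (λ v → B v w) ≡ φ w)

positive-ℚ⇒ℝ : ∀ {q} → 0ℚ ℚ.< q → Positive (ℚ⇒ℝ q)
positive-ℚ⇒ℝ {q} 0<q = ½ ℚ.* q , 0 , 0<* (ℚₚ.positive⁻¹ ½) 0<q , λ _ _ →
  ≡.subst (½ ℚ.* q ℚ.<_) (ℚₚ.*-identityˡ q) (ℚₚ.*-monoˡ-<-pos q {{ℚ.positive 0<q}} (from-yes (½ ℚₚ.<? 1ℚ)))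

module RationalChain {n} (T : Matrix ℝ n n) (T₀ : Matrix ℚ n n) (T≡T₀ : ∀ v w → T v w ≡ ℚ⇒ℝ (T₀ v w)) where
  private
    open MatrixHom ℚ-rawRing ℝ-commutativeRing ℚ⇒ℝ-isHom using (sum-homo; diag-homo)

    T≈T₀ : ∀ v w → T v w ≈ʳ ℚ⇒ℝ (T₀ v w)
    T≈T₀ v w rewrite T≡T₀ v w = ≈ʳ-refl {ℚ⇒ℝ (T₀ v w)}

    memoized : ∀ {n} (M : Matrix ℝ n n) (M₀ : Matrix ℚ n n) → (∀ i j → M i j ≈ʳ ℚ⇒ℝ (M₀ i j)) →
      ∀ i j → M i j ≈ʳ ℚ⇒ℝ (memoize M₀ i j)
    memoized M M₀ M≈M₀ i j = ≡.subst (λ q → M i j ≈ʳ ℚ⇒ℝ q) (≡.sym (memoize-≡ M₀ i j)) (M≈M₀ i j)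

    sum-≈ : ∀ {m} (f : Vector ℝ m) (f₀ : Vector ℚ m) q → (∀ i → f i ≈ʳ ℚ⇒ℝ (f₀ i)) → sumℚ f₀ ≡ q → Σℝ.sum f ≈ʳ ℚ⇒ℝ q
    sum-≈ f f₀ q f≈f₀ eq = Rℝ.trans {Σℝ.sum f} {Σℝ.sum (ℚ⇒ℝ ∘ f₀)} {ℚ⇒ℝ q} (Σℝ.sum-cong-≋ f≈f₀)
      (Rℝ.trans {Σℝ.sum (ℚ⇒ℝ ∘ f₀)} {ℚ⇒ℝ (sumℚ f₀)} {ℚ⇒ℝ q}
        (Rℝ.sym {ℚ⇒ℝ (sumℚ f₀)} {Σℝ.sum (ℚ⇒ℝ ∘ f₀)} (sum-homo f₀)) (≡⇒≈ʳ eq))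

    *-≈ : ∀ {x y x₀ y₀} → x ≈ʳ ℚ⇒ℝ x₀ → y ≈ʳ ℚ⇒ℝ y₀ → x *ʳ y ≈ʳ ℚ⇒ℝ (x₀ ℚ.* y₀)
    *-≈ {x} {y} {x₀} {y₀} = Rℝ.*-cong {x} {ℚ⇒ℝ x₀} {y} {ℚ⇒ℝ y₀}

  module _ (φ₀ : Vector ℚ n) where
    isPerronVector : IsInvariantℚ T₀ φ₀ → IsPerronVector T (ℚ⇒ℝ ∘ φ₀)
    isPerronVector (φ₀>0 , total , invariant) = positive-ℚ⇒ℝ ∘ φ₀>0 ,
      sum-≈ (ℚ⇒ℝ ∘ φ₀) φ₀ 1ℚ (λ v → ≈ʳ-refl {ℚ⇒ℝ (φ₀ v)}) total ,
      1ʳ , λ w → Rℝ.trans {Σℝ.sum (λ v → ℚ⇒ℝ (φ₀ v) *ʳ T v w)} {ℚ⇒ℝ (φ₀ w)} {1ʳ *ʳ ℚ⇒ℝ (φ₀ w)}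
        (sum-≈ (λ v → ℚ⇒ℝ (φ₀ v) *ʳ T v w) (λ v → φ₀ v ℚ.* T₀ v w) (φ₀ w)
          (λ v → *-≈ {ℚ⇒ℝ (φ₀ v)} {T v w} (≈ʳ-refl {ℚ⇒ℝ (φ₀ v)}) (T≈T₀ v w)) (invariant w))
        (Rℝ.sym {1ʳ *ʳ ℚ⇒ℝ (φ₀ w)} {ℚ⇒ℝ (φ₀ w)} (Rℝ.*-identityˡ (ℚ⇒ℝ (φ₀ w))))

    perronVector-unique : ∀ {B} → IsUniqueInvariantℚ T₀ φ₀ B → ∀ φ → IsPerronVector T φ → ∀ w → φ w ≈ʳ ℚ⇒ℝ (φ₀ w)
    perronVector-unique {B} (stochastic , inverse , columns) φ (_ , total , ρ , invariant) w =
      Rℝ.trans {φ w} {Σℝ.sum (λ v → ℚ⇒ℝ (B v w))} {ℚ⇒ℝ (φ₀ w)}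
        (ℝLaplacian.invariant-unique T (mapMatrix ℚ⇒ℝ B) φ ρ
          (λ v → sum-≈ (T v) (T₀ v) 1ℚ (T≈T₀ v) (stochastic v)) total invariant
          (λ v w → Rℝ.trans {Σℝ.sum (λ u → ℝLaplacian.fundamental T v u *ʳ ℚ⇒ℝ (B u w))} {ℚ⇒ℝ (ℚMatrix.1ᴹ v w)} {ℝMatrix.1ᴹ v w}
            (sum-≈ (λ u → ℝLaplacian.fundamental T v u *ʳ ℚ⇒ℝ (B u w))
                (λ u → (ℚMatrix.1ᴹ v u ℚ.- T₀ v u ℚ.+ 1ℚ) ℚ.* B u w) (ℚMatrix.1ᴹ v w)
              (λ u → *-≈ {ℝLaplacian.fundamental T v u} {ℚ⇒ℝ (B u w)} (fundamental≈ v u) (≈ʳ-refl {ℚ⇒ℝ (B u w)})) (inverse v w))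
            (diag-homo 1sℚ v w))
          w)
        (sum-≈ (λ v → ℚ⇒ℝ (B v w)) (λ v → B v w) (φ₀ w) (λ v → ≈ʳ-refl {ℚ⇒ℝ (B v w)}) (columns w))
      where
      fundamental≈ : ∀ v u → ℝLaplacian.fundamental T v u ≈ʳ ℚ⇒ℝ (ℚMatrix.1ᴹ v u ℚ.- T₀ v u ℚ.+ 1ℚ)
      fundamental≈ v u = Rℝ.+-congʳ {1ʳ} {ℝMatrix.1ᴹ v u +ʳ (-ʳ T v u)} {ℚ⇒ℝ (ℚMatrix.1ᴹ v u ℚ.- T₀ v u)}
        (Rℝ.+-cong {ℝMatrix.1ᴹ v u} {ℚ⇒ℝ (ℚMatrix.1ᴹ v u)} { -ʳ T v u} { -ʳ ℚ⇒ℝ (T₀ v u)}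
          (Rℝ.sym {ℚ⇒ℝ (ℚMatrix.1ᴹ v u)} {ℝMatrix.1ᴹ v u} (diag-homo 1sℚ v u))
          (Rℝ.-‿cong {T v u} {ℚ⇒ℝ (T₀ v u)} (T≈T₀ v u)))

    private
      combinatorial≈ : ∀ φ → (∀ v → φ v ≈ʳ ℚ⇒ℝ (φ₀ v)) → ∀ v w →
        combinatorialLaplacian T φ v w ≈ʳ ℚ⇒ℝ (combinatorialℚ T₀ φ₀ v w)
      combinatorial≈ φ φ≈φ₀ v w = Rℝ.trans
        {combinatorialLaplacian T φ v w} {LaplacianEntries.entry ℝ-rawRing ½ʳ φ φ ℝLaplacian.1s ℝLaplacian.1s φ T v w}
        {ℚ⇒ℝ (combinatorialℚ T₀ φ₀ v w)}
        (ℝLaplacian.combinatorial-entry T φ v w)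
        (entry-homo {d = φ} {φ} {ℝLaplacian.1s} {ℝLaplacian.1s} {φ} {T} {φ₀} {φ₀} {1sℚ} {1sℚ} {φ₀} {T₀}
          φ≈φ₀ φ≈φ₀ one≈ one≈ φ≈φ₀ T≈T₀ v w)
        where
        one≈ : Fin n → 1ʳ ≈ʳ ℚ⇒ℝ 1ℚ
        one≈ _ = ≈ʳ-refl {1ʳ}

    -- An existential over Perron vectors is refuted here, so an arbitrary real `φ` is given;
    -- uniqueness replaces it by the rational `φ₀`.
    combinatorial-root : ∀ {B} q → IsUniqueInvariantℚ T₀ φ₀ B → determinantAt (combinatorialℚ T₀ φ₀) q ≡ 0ℚ →
      ¬ specCombinatorial T (ℝ⇒ℂ (ℚ⇒ℝ q)) 0
    combinatorial-root q unique det≡0 (φ , perron , spec) = realRoot (combinatorialLaplacian T φ) (ℚ⇒ℝ q)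
      (Rℝ.trans {ℝMatrix.det (ℝMatrix.diag (const (ℚ⇒ℝ q)) ℝMatrix.⊟ combinatorialLaplacian T φ)}
        {ℚ⇒ℝ (determinantAt (combinatorialℚ T₀ φ₀) q)} {0ʳ}
        (det-ℚ (combinatorialLaplacian T φ) (memoize (combinatorialℚ T₀ φ₀)) q
          (memoized (combinatorialLaplacian T φ) (combinatorialℚ T₀ φ₀)
              (combinatorial≈ φ (perronVector-unique unique φ perron))))
        (≡⇒≈ʳ det≡0)) spec

    -- Here the existential is to be inhabited, by `φ₀` itself, with `ρ` equal to 1.
    combinatorial-nonroot : ∀ q → IsInvariantℚ T₀ φ₀ → determinantAt (combinatorialℚ T₀ φ₀) q ≢ 0ℚ →
      specCombinatorial T (ℝ⇒ℂ (ℚ⇒ℝ q)) 0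
    combinatorial-nonroot q invariant det≢0 = ℚ⇒ℝ ∘ φ₀ , isPerronVector invariant ,
      realNonroot (combinatorialLaplacian T (ℚ⇒ℝ ∘ φ₀)) (ℚ⇒ℝ q) λ det≈0 → det≢0 (null-const _ (≈0⇒null {ℚ⇒ℝ D}
        (Rℝ.trans {ℚ⇒ℝ D} {ℝMatrix.det (ℝMatrix.diag (const (ℚ⇒ℝ q)) ℝMatrix.⊟ combinatorialLaplacian T (ℚ⇒ℝ ∘ φ₀))} {0ʳ}
          (Rℝ.sym {ℝMatrix.det (ℝMatrix.diag (const (ℚ⇒ℝ q)) ℝMatrix.⊟ combinatorialLaplacian T (ℚ⇒ℝ ∘ φ₀))} {ℚ⇒ℝ D}
            (det-ℚ (combinatorialLaplacian T (ℚ⇒ℝ ∘ φ₀)) (memoize (combinatorialℚ T₀ φ₀)) q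
              (memoized (combinatorialLaplacian T (ℚ⇒ℝ ∘ φ₀)) (combinatorialℚ T₀ φ₀)
                  (combinatorial≈ (ℚ⇒ℝ ∘ φ₀) λ v → ≈ʳ-refl {ℚ⇒ℝ (φ₀ v)})))) det≈0)))
      where
      D : ℚ
      D = determinantAt (combinatorialℚ T₀ φ₀) q

    private
      -- Removes the power of `x` that Sylvester's identity leaves in `normalized-det`; this is
      -- where `q` has to be positive.
      cancel-^ : ∀ {q} → 0ℚ ℚ.< q → ∀ m x → RawSemiringDefs._^_ (RawRing.rawSemiring ℝ-rawRing) (ℚ⇒ℝ q) m *ʳ x ≈ʳ 0ʳ → x ≈ʳ 0ʳ
      cancel-^ 0<q zero    x eq = Rℝ.trans {x} {1ʳ *ʳ x} {0ʳ} (Rℝ.sym {1ʳ *ʳ x} {x} (Rℝ.*-identityˡ x)) eq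
      cancel-^ {q} 0<q (suc m) x eq = cancel-^ 0<q m x (positive-cancel {qᵐ *ʳ x} {ℚ⇒ℝ q} (positive-ℚ⇒ℝ 0<q)
        (Rℝ.trans {(qᵐ *ʳ x) *ʳ ℚ⇒ℝ q} {(ℚ⇒ℝ q *ʳ qᵐ) *ʳ x} {0ʳ}
          (pointwise λ n → solve 3 (λ a b c → (b :* c) :* a := (a :* b) :* c) ≡.refl q (seq qᵐ n) (seq x n)) eq))
        where
        open ℚSolver
        qᵐ : ℝ
        qᵐ = RawSemiringDefs._^_ (RawRing.rawSemiring ℝ-rawRing) (ℚ⇒ℝ q) m

    -- `σ` and `τ` are arbitrary real roots. Conjugation eliminates them, and the matrix left over
    -- is rational once `φ` has been identified with `φ₀`.
    normalized-root : ∀ {B} (ψ₀ : Vector ℚ n) q → 0ℚ ℚ.< q → IsUniqueInvariantℚ T₀ φ₀ B → (∀ v → ψ₀ v ℚ.* φ₀ v ≡ 1ℚ) →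
      determinantAt (conjugatedℚ T₀ φ₀ ψ₀) q ≡ 0ℚ → ¬ specNormalized T (ℝ⇒ℂ (ℚ⇒ℝ q)) 0
    normalized-root ψ₀ q 0<q unique ψφ≡1 det≡0 (φ , perron , σ , τ , roots , spec) =
      realRoot (normalizedLaplacian T σ τ) (ℚ⇒ℝ q) (cancel-^ 0<q n (ℝMatrix.det N-q)
        (Rℝ.trans {qⁿ *ʳ ℝMatrix.det N-q} {qⁿ *ʳ ℝMatrix.det N′-q} {0ʳ}
          (Rℝ.*-congˡ {qⁿ} {ℝMatrix.det N-q} {ℝMatrix.det N′-q}
              (Determinants.det-cong ℝ-commutativeRing {M = N-q} {N = N′-q} λ v w →
            Rℝ.+-congˡ {ℝMatrix.diag (const (ℚ⇒ℝ q)) v w} { -ʳ normalizedLaplacian T σ τ v w} { -ʳ N′ v w}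
              (Rℝ.-‿cong {normalizedLaplacian T σ τ v w} {N′ v w} (ℝLaplacian.normalized-entry T σ τ v w))))
        (Rℝ.trans {qⁿ *ʳ ℝMatrix.det N′-q} {qⁿ *ʳ ℝMatrix.det Q-q} {0ʳ}
          (ℝLaplacian.normalized-det T φ ψ σ τ (ℚ⇒ℝ q) (λ v → proj₁ (proj₂ (roots v))) (λ v → proj₂ (proj₂ (roots v))) ψφ≈1)
        (Rℝ.trans {qⁿ *ʳ ℝMatrix.det Q-q} {qⁿ *ʳ 0ʳ} {0ʳ}
          (Rℝ.*-congˡ {qⁿ} {ℝMatrix.det Q-q} {0ʳ}
            (Rℝ.trans {ℝMatrix.det Q-q} {ℚ⇒ℝ (determinantAt (conjugatedℚ T₀ φ₀ ψ₀) q)} {0ʳ}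
              (det-ℚ Q (memoize (conjugatedℚ T₀ φ₀ ψ₀)) q (memoized Q (conjugatedℚ T₀ φ₀ ψ₀) Q≈))
              (≡⇒≈ʳ det≡0)))
          (Rℝ.zeroʳ qⁿ))))) spec
      where
      open LaplacianEntries ℝ-rawRing ½ʳ using (entry)
      qⁿ : ℝ
      qⁿ = RawSemiringDefs._^_ (RawRing.rawSemiring ℝ-rawRing) (ℚ⇒ℝ q) n
      ψ : Vector ℝ n
      ψ = ℚ⇒ℝ ∘ ψ₀
      N′ Q N-q N′-q Q-q : Matrix ℝ n n
      N′ = entry ℝLaplacian.1s σ τ τ σ T
      Q = entry ℝLaplacian.1s ℝLaplacian.1s ℝLaplacian.1s ψ φ T
      N-q = ℝMatrix.diag (const (ℚ⇒ℝ q)) ℝMatrix.⊟ normalizedLaplacian T σ τ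
      N′-q = ℝMatrix.diag (const (ℚ⇒ℝ q)) ℝMatrix.⊟ N′
      Q-q = ℝMatrix.diag (const (ℚ⇒ℝ q)) ℝMatrix.⊟ Q
      φ≈φ₀ : ∀ v → φ v ≈ʳ ℚ⇒ℝ (φ₀ v)
      φ≈φ₀ = perronVector-unique unique φ perron
      ψφ≈1 : ∀ v → ψ v *ʳ φ v ≈ʳ 1ʳ
      ψφ≈1 v = Rℝ.trans {ψ v *ʳ φ v} {ℚ⇒ℝ (ψ₀ v ℚ.* φ₀ v)} {1ʳ}
        (*-≈ {ψ v} {φ v} (≈ʳ-refl {ψ v}) (φ≈φ₀ v)) (≡⇒≈ʳ (ψφ≡1 v))
      one≈ : Fin n → 1ʳ ≈ʳ ℚ⇒ℝ 1ℚ
      one≈ _ = ≈ʳ-refl {1ʳ}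
      Q≈ : ∀ v w → Q v w ≈ʳ ℚ⇒ℝ (conjugatedℚ T₀ φ₀ ψ₀ v w)
      Q≈ = entry-homo {d = ℝLaplacian.1s} {ℝLaplacian.1s} {ℝLaplacian.1s} {ψ} {φ} {T} {1sℚ} {1sℚ} {1sℚ} {ψ₀} {φ₀} {T₀}
        one≈ one≈ one≈ (λ v → ≈ʳ-refl {ψ v}) φ≈φ₀ T≈T₀

    -- The roots have to be exhibited, and for an exact determinant they should be rational: hence
    -- `φ₀` consists of the squares of `σ₀`.
    normalized-nonroot : ∀ (σ₀ τ₀ : Vector ℚ n) q → IsInvariantℚ T₀ φ₀ →
      (∀ v → 0ℚ ℚ.< σ₀ v × σ₀ v ℚ.* σ₀ v ≡ φ₀ v × σ₀ v ℚ.* τ₀ v ≡ 1ℚ) →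
      determinantAt (normalizedℚ T₀ σ₀ τ₀) q ≢ 0ℚ → specNormalized T (ℝ⇒ℂ (ℚ⇒ℝ q)) 0
    normalized-nonroot σ₀ τ₀ q invariant roots det≢0 = ℚ⇒ℝ ∘ φ₀ , isPerronVector invariant , σ , τ ,
      (λ v → let σ>0 , σσ , στ = roots v in positive-ℚ⇒ℝ σ>0 , ≡⇒≈ʳ σσ , ≡⇒≈ʳ στ) ,
      realNonroot (normalizedLaplacian T σ τ) (ℚ⇒ℝ q) λ det≈0 → det≢0 (null-const _ (≈0⇒null {ℚ⇒ℝ D}
        (Rℝ.trans {ℚ⇒ℝ D} {ℝMatrix.det (ℝMatrix.diag (const (ℚ⇒ℝ q)) ℝMatrix.⊟ normalizedLaplacian T σ τ)} {0ʳ}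
          (Rℝ.sym {ℝMatrix.det (ℝMatrix.diag (const (ℚ⇒ℝ q)) ℝMatrix.⊟ normalizedLaplacian T σ τ)} {ℚ⇒ℝ D}
            (det-ℚ (normalizedLaplacian T σ τ) (memoize (normalizedℚ T₀ σ₀ τ₀)) q
              (memoized (normalizedLaplacian T σ τ) (normalizedℚ T₀ σ₀ τ₀) N≈))) det≈0)))
      where
      D : ℚ
      D = determinantAt (normalizedℚ T₀ σ₀ τ₀) q
      σ τ : Vector ℝ n
      σ = ℚ⇒ℝ ∘ σ₀
      τ = ℚ⇒ℝ ∘ τ₀
      N≈ : ∀ v w → normalizedLaplacian T σ τ v w ≈ʳ ℚ⇒ℝ (normalizedℚ T₀ σ₀ τ₀ v w)
      N≈ v w = Rℝ.trans {normalizedLaplacian T σ τ v w}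
        {LaplacianEntries.entry ℝ-rawRing ½ʳ ℝLaplacian.1s σ τ τ σ T v w} {ℚ⇒ℝ (normalizedℚ T₀ σ₀ τ₀ v w)}
        (ℝLaplacian.normalized-entry T σ τ v w)
        (entry-homo {d = ℝLaplacian.1s} {σ} {τ} {τ} {σ} {T} {1sℚ} {σ₀} {τ₀} {τ₀} {σ₀} {T₀}
          (λ _ → ≈ʳ-refl {1ʳ}) (λ v → ≈ʳ-refl {σ v}) (λ v → ≈ʳ-refl {τ v}) (λ v → ≈ʳ-refl {τ v}) (λ v → ≈ʳ-refl {σ v}) T≈T₀ v w)

-- Moves that change the spectra of a transition matrix

ratioℚ : ℕ → ℕ → ℚ
ratioℚ n zero    = 0ℚ
ratioℚ n (suc d) = + n ℚ./ suc d

-- The two spectra are fields so that type checking compares them by name.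
record Chain : Set₁ where
  open FiniteDigraph using (∣V∣)
  field
    normalized combinatorial : Spectrum
    matrix   : ∀ D → Matrix ℝ (∣V∣ D) (∣V∣ D)
    rational : ∀ D → Matrix ℚ (∣V∣ D) (∣V∣ D)
    exact    : ∀ D v w → matrix D v w ≡ ℚ⇒ℝ (rational D v w)
    normalized-spec    : ∀ D → normalized D ≡ specNormalized (matrix D)
    combinatorial-spec : ∀ D → combinatorial D ≡ specCombinatorial (matrix D)

  memoized : ∀ D → Matrix ℚ (∣V∣ D) (∣V∣ D)
  memoized D = memoize (rational D)

  memoized-exact : ∀ D v w → matrix D v w ≡ ℚ⇒ℝ (memoized D v w)
  memoized-exact D v w = ≡.trans (exact D v w) (≡.cong ℚ⇒ℝ (≡.sym (memoize-≡ (rational D) v w)))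

ratio-exact : ∀ D n d → DigraphMatrices.ratio D n d ≡ ℚ⇒ℝ (ratioℚ n d)
ratio-exact D n zero    = ≡.refl
ratio-exact D n (suc d) = ≡.refl

chain binaryChain : Chain
chain = record
  { normalized = Spec-ΔN
  ; combinatorial = Spec-ΔC
  ; normalized-spec = λ _ → ≡.refl
  ; combinatorial-spec = λ _ → ≡.refl
  ; matrix   = DigraphMatrices.transition
  ; rational = λ D v w → ratioℚ (DigraphNotions.n[_,_] D v w) (DigraphNotions.outdeg D v)
  ; exact    = λ D v w → ratio-exact D (DigraphNotions.n[_,_] D v w) (DigraphNotions.outdeg D v) }
binaryChain = record
  { normalized = Spec-ΔbN
  ; combinatorial = Spec-ΔbC
  ; normalized-spec = λ _ → ≡.refl
  ; combinatorial-spec = λ _ → ≡.refl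
  ; matrix   = DigraphMatrices.binaryTransition
  ; rational = λ D v w → if does (DigraphNotions.adjacent? D v w) then ratioℚ 1 (DigraphNotions.binaryOutdeg D v) else 0ℚ
  ; exact    = exact }
  where
  exact : ∀ D v w → DigraphMatrices.binaryTransition D v w ≡
    ℚ⇒ℝ (if does (DigraphNotions.adjacent? D v w) then ratioℚ 1 (DigraphNotions.binaryOutdeg D v) else 0ℚ)
  exact D v w with does (DigraphNotions.adjacent? D v w)
  ... | true  = ratio-exact D 1 (DigraphNotions.binaryOutdeg D v)
  ... | false = ≡.refl

isInvariant? : ∀ {n} (T : Matrix ℚ n n) φ → Dec (IsInvariantℚ T φ)
isInvariant? T φ = (all? λ v → 0ℚ ℚₚ.<? φ v) ×-dec (_ ℚₚ.≟ _) ×-dec (all? λ w → _ ℚₚ.≟ _)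

isUniqueInvariant? : ∀ {n} (T : Matrix ℚ n n) φ B → Dec (IsUniqueInvariantℚ T φ B)
isUniqueInvariant? T φ B = (all? λ v → _ ℚₚ.≟ _) ×-dec (all? λ v → all? λ w → _ ℚₚ.≟ _) ×-dec (all? λ w → _ ℚₚ.≟ _)

isSquareRoot? : ∀ {n} (φ σ τ : Vector ℚ n) → Dec (∀ v → 0ℚ ℚ.< σ v × σ v ℚ.* σ v ≡ φ v × σ v ℚ.* τ v ≡ 1ℚ)
isSquareRoot? φ σ τ = all? λ v → (0ℚ ℚₚ.<? σ v) ×-dec (_ ℚₚ.≟ _) ×-dec (_ ℚₚ.≟ _)

vector : ∀ {n} d .{{_ : ℕ.NonZero d}} → Vec ℤ n → Vector ℚ n
vector d xs i = Vec.lookup xs i ℚ./ d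

matrix : ∀ {m n} d .{{_ : ℕ.NonZero d}} → Vec (Vec ℤ n) m → Matrix ℚ m n
matrix d rows i j = Vec.lookup (Vec.lookup rows i) j ℚ./ d

≋⇒same-nonroots : ∀ {F G} q → 0ℚ ℚ.< q → F ≋ G → F (ℝ⇒ℂ (ℚ⇒ℝ q)) 0 ⇔ G (ℝ⇒ℂ (ℚ⇒ℝ q)) 0
≋⇒same-nonroots q 0<q F≋G = F≋G (ℝ⇒ℂ (ℚ⇒ℝ q)) (λ q≈0 →
  ℚₚ.<-irrefl (≡.sym (null-const q (≈0⇒null {ℚ⇒ℝ q} (proj₁ q≈0)))) 0<q) 0

module _ (c : Chain) (D : FiniteDigraph) where
  open FiniteDigraph D using (∣V∣)
  private
    T : Matrix ℚ ∣V∣ ∣V∣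
    T = Chain.memoized c D
    module T = RationalChain (Chain.matrix c D) T (Chain.memoized-exact c D)

  combinatorial-eigenvalue : ∀ φ B q → {True (isUniqueInvariant? T φ B)} →
    {True (determinantAt (combinatorialℚ T φ) q ℚₚ.≟ 0ℚ)} →
    ¬ Chain.combinatorial c D (ℝ⇒ℂ (ℚ⇒ℝ q)) 0
  combinatorial-eigenvalue φ B q {unique} {det≡0} rewrite Chain.combinatorial-spec c D = T.combinatorial-root φ {B} q
    (toWitness unique) (toWitness det≡0)

  combinatorial-noneigenvalue : ∀ φ q → {True (isInvariant? T φ)} → {False (determinantAt (combinatorialℚ T φ) q ℚₚ.≟ 0ℚ)} →
    Chain.combinatorial c D (ℝ⇒ℂ (ℚ⇒ℝ q)) 0
  combinatorial-noneigenvalue φ q {invariant} {det≢0} rewrite Chain.combinatorial-spec c D =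
    T.combinatorial-nonroot φ q (toWitness invariant) (toWitnessFalse det≢0)

  normalized-eigenvalue : ∀ φ ψ B q → {True (isUniqueInvariant? T φ B)} → {True (0ℚ ℚₚ.<? q)} →
    {True (all? λ v → ψ v ℚ.* φ v ℚₚ.≟ 1ℚ)} → {True (determinantAt (conjugatedℚ T φ ψ) q ℚₚ.≟ 0ℚ)} →
    ¬ Chain.normalized c D (ℝ⇒ℂ (ℚ⇒ℝ q)) 0
  normalized-eigenvalue φ ψ B q {unique} {0<q} {ψφ≡1} {det≡0} rewrite Chain.normalized-spec c D =
    T.normalized-root φ {B} ψ q (toWitness 0<q) (toWitness unique) (toWitness ψφ≡1) (toWitness det≡0)

  normalized-noneigenvalue : ∀ φ σ τ q → {True (isInvariant? T φ)} → {True (isSquareRoot? φ σ τ)} →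
    {False (determinantAt (normalizedℚ T σ τ) q ℚₚ.≟ 0ℚ)} → Chain.normalized c D (ℝ⇒ℂ (ℚ⇒ℝ q)) 0
  normalized-noneigenvalue φ σ τ q {invariant} {root} {det≢0} rewrite Chain.normalized-spec c D =
    T.normalized-nonroot φ σ τ q (toWitness invariant) (toWitness root) (toWitnessFalse det≢0)

lost : ∀ {𝒞 μ X} (ex : Example 𝒞 μ) q {0<q : True (0ℚ ℚₚ.<? q)} → let z = ℝ⇒ℂ (ℚ⇒ℝ q) in
  ¬ X (Example.before ex) z 0 → X (Example.after ex) z 0 → DoesNotPreserve 𝒞 X μ
lost ex q {0<q} root nonroot = Example.refutes ex λ X≋X′ → root
  (Equivalence.from (≋⇒same-nonroots q (toWitness 0<q) X≋X′) nonroot)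

gained : ∀ {𝒞 μ X} (ex : Example 𝒞 μ) q {0<q : True (0ℚ ℚₚ.<? q)} → let z = ℝ⇒ℂ (ℚ⇒ℝ q) in
  X (Example.before ex) z 0 → ¬ X (Example.after ex) z 0 → DoesNotPreserve 𝒞 X μ
gained ex q {0<q} nonroot root = Example.refutes ex λ X≋X′ → root
  (Equivalence.to (≋⇒same-nonroots q (toWitness 0<q) X≋X′) nonroot)

-- After the splice the binary chain is the walk on the path `v`, `u₁`, `u₂` with a loop at each
-- vertex. It is reversible, φ is proportional to the degrees 2, 3, 2, and the eigenvector (1, 0,
-- -1) of the transition matrix yields the Laplace eigenvalue ½.
exampleC′ : Example StronglyConnected C
exampleC′ = record
  { before = D
  ; admissible = record
    { v = 0F ; regular = 0F , ≡.refl
    ; returnPaths = (0 , 0F ∷ []) , (0 , 1F ∷ []) ,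
        (([-] , ≡.refl) , [] , ≡.refl) , (([-] , ≡.refl) , [] , ≡.refl) , λ () }
  ; before∈𝒞 = stronglyConnected D 1 ; after∈𝒞 = stronglyConnected _ 3 }
  where
  D : FiniteDigraph
  D = fromEdges {1} ((0F , 0F) ∷ (0F , 0F) ∷ [])

-- Chosen for the normalized Laplacian: φ is (1, 4, 4)/9 before the splice, with rational square
-- roots, and the spliced digraph has the rational eigenvalue 1. In `exampleC` φ is (½, ½), whose
-- roots are irrational, and splicing in `exampleC′` yields nonzero eigenvalues that involve √17.
exampleC″ : Example StronglyConnected C
exampleC″ = record
  { before = D
  ; admissible = record
    { v = 2F ; regular = 3F , ≡.refl
    ; returnPaths = (0 , 6F ∷ []) , (1 , 3F ∷ 0F ∷ []) ,
        (([-] , ≡.refl) , [] , ≡.refl) , ((≡.refl ∷ [-] , ≡.refl) , (λ ()) ∷ [] , ≡.refl) , λ () }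
  ; before∈𝒞 = stronglyConnected D 2 ; after∈𝒞 = stronglyConnected _ 4 }
  where
  D : FiniteDigraph
  D = fromEdges {3} ((0F , 2F) ∷ (1F , 1F) ∷ (1F , 2F) ∷ (2F , 0F) ∷ (2F , 1F) ∷ (2F , 1F) ∷ (2F , 2F) ∷ [])

open Example using (before; after)
private
  half-half : Vector ℚ 2
  half-half = vector 2 (+ 1 ∷ + 1 ∷ [])
  two-two : Vector ℚ 2
  two-two = vector 1 (+ 2 ∷ + 2 ∷ [])
  -- The inverse of 1 - T + J for the T with all entries ½. This T is the transition matrix of the
  -- outsplit `threeLoops`, binary or not, and the binary one of the insplit.
  B₂ : Matrix ℚ 2 2
  B₂ = matrix 4 ((+ 3 ∷ ℤ.-1ℤ ∷ []) ∷ (ℤ.-1ℤ ∷ + 3 ∷ []) ∷ [])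

private
  φ-R φᵇ-R : Vector ℚ 2
  φ-R  = vector 5 (+ 2 ∷ + 3 ∷ [])
  φᵇ-R = vector 3 (+ 1 ∷ + 2 ∷ [])
  B-R Bᵇ-R : Matrix ℚ 2 2
  B-R  = matrix 10 ((+ 5 ∷ + 0 ∷ []) ∷ (ℤ.-1ℤ ∷ + 6 ∷ []) ∷ [])
  Bᵇ-R = matrix 6 ((+ 3 ∷ + 0 ∷ []) ∷ (ℤ.-1ℤ ∷ + 4 ∷ []) ∷ [])

-- Two states suffice for Moves (R), (O) and (I). A two-state chain with probabilities p and q of
-- changing state is reversible; the nonzero eigenvalue of its normalized Laplacian is p + q, and
-- that of its combinatorial Laplacian is twice the flow φ₀ p = φ₁ q. The digraph on the other side
-- has one vertex and Laplacian 0.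
R-ΔN : DoesNotPreserve StronglyConnected Spec-ΔN R
R-ΔN =
  lost exampleR (+ 5 ℚ./ 3)
    (normalized-eigenvalue chain (before exampleR) φ-R (vector 6 (+ 15 ∷ + 10 ∷ [])) B-R (+ 5 ℚ./ 3))
    (normalized-noneigenvalue chain (after exampleR) 1sℚ 1sℚ 1sℚ (+ 5 ℚ./ 3))

R-ΔbN : DoesNotPreserve StronglyConnected Spec-ΔbN R
R-ΔbN =
  lost exampleR (+ 3 ℚ./ 2)
    (normalized-eigenvalue binaryChain (before exampleR) φᵇ-R (vector 2 (+ 6 ∷ + 3 ∷ [])) Bᵇ-R (+ 3 ℚ./ 2))
    (normalized-noneigenvalue binaryChain (after exampleR) 1sℚ 1sℚ 1sℚ (+ 3 ℚ./ 2))

R-ΔC : DoesNotPreserve StronglyConnected Spec-ΔC R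
R-ΔC =
  lost exampleR (+ 4 ℚ./ 5)
    (combinatorial-eigenvalue chain (before exampleR) φ-R B-R (+ 4 ℚ./ 5))
    (combinatorial-noneigenvalue chain (after exampleR) 1sℚ (+ 4 ℚ./ 5))

R-ΔbC : DoesNotPreserve StronglyConnected Spec-ΔbC R
R-ΔbC =
  lost exampleR (+ 2 ℚ./ 3)
    (combinatorial-eigenvalue binaryChain (before exampleR) φᵇ-R Bᵇ-R (+ 2 ℚ./ 3))
    (combinatorial-noneigenvalue binaryChain (after exampleR) 1sℚ (+ 2 ℚ./ 3))

O-ΔN : DoesNotPreserve StronglyConnected Spec-ΔN O
O-ΔN =
  gained exampleO 1ℚ
    (normalized-noneigenvalue chain (before exampleO) 1sℚ 1sℚ 1sℚ 1ℚ)
    (normalized-eigenvalue chain (after exampleO) half-half two-two B₂ 1ℚ)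

O-ΔbN : DoesNotPreserve StronglyConnected Spec-ΔbN O
O-ΔbN =
  gained exampleO 1ℚ
    (normalized-noneigenvalue binaryChain (before exampleO) 1sℚ 1sℚ 1sℚ 1ℚ)
    (normalized-eigenvalue binaryChain (after exampleO) half-half two-two B₂ 1ℚ)

O-ΔC : DoesNotPreserve StronglyConnected Spec-ΔC O
O-ΔC =
  gained exampleO ½
    (combinatorial-noneigenvalue chain (before exampleO) 1sℚ ½)
    (combinatorial-eigenvalue chain (after exampleO) half-half B₂ ½)

O-ΔbC : DoesNotPreserve StronglyConnected Spec-ΔbC O
O-ΔbC =
  gained exampleO ½
    (combinatorial-noneigenvalue binaryChain (before exampleO) 1sℚ ½)
    (combinatorial-eigenvalue binaryChain (after exampleO) half-half B₂ ½)

private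
  φ-I : Vector ℚ 2
  φ-I = vector 3 (+ 2 ∷ + 1 ∷ [])
  B-I : Matrix ℚ 2 2
  B-I = matrix 6 ((+ 5 ∷ ℤ.- (+ 2) ∷ []) ∷ (ℤ.-1ℤ ∷ + 4 ∷ []) ∷ [])

I-ΔN : DoesNotPreserve StronglyConnected Spec-ΔN I
I-ΔN =
  gained exampleI 1ℚ
    (normalized-noneigenvalue chain (before exampleI) 1sℚ 1sℚ 1sℚ 1ℚ)
    (normalized-eigenvalue chain (after exampleI) φ-I (vector 2 (+ 3 ∷ + 6 ∷ [])) B-I 1ℚ)

I-ΔbN : DoesNotPreserve StronglyConnected Spec-ΔbN I
I-ΔbN =
  gained exampleI 1ℚ
    (normalized-noneigenvalue binaryChain (before exampleI) 1sℚ 1sℚ 1sℚ 1ℚ)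
    (normalized-eigenvalue binaryChain (after exampleI) half-half two-two B₂ 1ℚ)

I-ΔC : DoesNotPreserve StronglyConnected Spec-ΔC I
I-ΔC =
  gained exampleI (+ 4 ℚ./ 9)
    (combinatorial-noneigenvalue chain (before exampleI) 1sℚ (+ 4 ℚ./ 9))
    (combinatorial-eigenvalue chain (after exampleI) φ-I B-I (+ 4 ℚ./ 9))

I-ΔbC : DoesNotPreserve StronglyConnected Spec-ΔbC I
I-ΔbC =
  gained exampleI ½
    (combinatorial-noneigenvalue binaryChain (before exampleI) 1sℚ ½)
    (combinatorial-eigenvalue binaryChain (after exampleI) half-half B₂ ½)

private
  -- In each row of the adjacency matrix of the spliced `exampleC` the nonzero entries are equal, so
  -- both transition matrices coincide. They describe the walk on the path 1, `v`, `u₁`, `u₂` with a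
  -- loop at each vertex, whose degrees, in the order `v`, 1, `u₁`, `u₂`, are 3, 2, 3, 2.
  φ-C : Vector ℚ 4
  φ-C = vector 10 (+ 3 ∷ + 2 ∷ + 3 ∷ + 2 ∷ [])
  B-C : Matrix ℚ 4 4
  B-C = matrix 40 (
    (+ 45        ∷ + 10        ∷ ℤ.- (+ 15)  ∷ ℤ.- (+ 30)  ∷ []) ∷
    (+ 21        ∷ + 74        ∷ ℤ.- (+ 39)  ∷ ℤ.- (+ 46)  ∷ []) ∷
    (ℤ.- (+ 15)  ∷ ℤ.- (+ 30)  ∷ + 45        ∷ + 10        ∷ []) ∷
    (ℤ.- (+ 39)  ∷ ℤ.- (+ 46)  ∷ + 21        ∷ + 74        ∷ []) ∷ [])

C-ΔN : DoesNotPreserve StronglyConnected Spec-ΔN C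
C-ΔN =
  gained exampleC″ 1ℚ
    (normalized-noneigenvalue chain (before exampleC″) (vector 9 (+ 1 ∷ + 4 ∷ + 4 ∷ []))
        (vector 3 (+ 1 ∷ + 2 ∷ + 2 ∷ [])) (vector 2 (+ 6 ∷ + 3 ∷ + 3 ∷ [])) 1ℚ)
    (normalized-eigenvalue chain (after exampleC″) (vector 15 (+ 1 ∷ + 4 ∷ + 5 ∷ + 3 ∷ + 2 ∷ []))
        (vector 4 (+ 60 ∷ + 15 ∷ + 12 ∷ + 20 ∷ + 30 ∷ []))
      (matrix 75 (
        (+ 71        ∷ + 14         ∷ + 55        ∷ ℤ.- (+ 57) ∷ ℤ.- (+ 68) ∷ []) ∷
        (ℤ.- (+ 9)   ∷ + 144        ∷ + 30        ∷ ℤ.- (+ 72) ∷ ℤ.- (+ 78) ∷ []) ∷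
        (+ 1         ∷ + 34         ∷ + 80        ∷ ℤ.- (+ 42) ∷ ℤ.- (+ 58) ∷ []) ∷
        (ℤ.- (+ 24)  ∷ ℤ.- (+ 66)   ∷ ℤ.- (+ 45)  ∷ + 108      ∷ + 42       ∷ []) ∷
        (ℤ.- (+ 34)  ∷ ℤ.- (+ 106)  ∷ ℤ.- (+ 95)  ∷ + 78       ∷ + 172      ∷ []) ∷ [])) 1ℚ)

C-ΔbN : DoesNotPreserve StronglyConnected Spec-ΔbN C
C-ΔbN =
  gained exampleC′ ½
    (normalized-noneigenvalue binaryChain (before exampleC′) 1sℚ 1sℚ 1sℚ ½)
    (normalized-eigenvalue binaryChain (after exampleC′) (vector 7 (+ 2 ∷ + 3 ∷ + 2 ∷ [])) (vector 6 (+ 21 ∷ + 14 ∷ + 21 ∷ []))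
      (matrix 21 (
        (+ 26        ∷ ℤ.- (+ 3) ∷ ℤ.- (+ 16) ∷ []) ∷
        (ℤ.- (+ 4)   ∷ + 15      ∷ ℤ.- (+ 4)  ∷ []) ∷
        (ℤ.- (+ 16)  ∷ ℤ.- (+ 3) ∷ + 26       ∷ []) ∷ [])) ½)

C-ΔC : DoesNotPreserve StronglyConnected Spec-ΔC C
C-ΔC =
  gained exampleC (+ 1 ℚ./ 5)
    (combinatorial-noneigenvalue chain (before exampleC) half-half (+ 1 ℚ./ 5))
    (combinatorial-eigenvalue chain (after exampleC) φ-C B-C (+ 1 ℚ./ 5))

C-ΔbC : DoesNotPreserve StronglyConnected Spec-ΔbC C
C-ΔbC =
  gained exampleC (+ 1 ℚ./ 5)
    (combinatorial-noneigenvalue binaryChain (before exampleC) half-half (+ 1 ℚ./ 5))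
    (combinatorial-eigenvalue binaryChain (after exampleC) φ-C B-C (+ 1 ℚ./ 5))

-- Moves excluded by strong connectedness

module _ (D : FiniteDigraph) where
  open FiniteDigraph D
  open DigraphNotions D using (IsPath; IsReturnPathAt)

  -- Regularity gives an edge out of `v`, and a path leads from its range back to `v`. The last edge
  -- of that path, or the first edge itself if the path is empty, enters `v`.
  stronglyConnected⇒¬S : StronglyConnected D → ¬ SourceRemoval D
  stronglyConnected⇒¬S sc a with SourceRemoval.regular a
  ... | e , _ with sc (r e) (SourceRemoval.v a)
  ... | inj₁ re≡v                = SourceRemoval.source a e re≡v
  ... | inj₂ (_ , p , _ , _ , eq) = SourceRemoval.source a (Vec.last p) eq

  -- Cut the path at its first visit to `v`: all earlier edges have other ranges, as a return path
  -- demands.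
  firstArrival : ∀ v {n} (p : Vec E (suc n)) → IsPath p → r (Vec.last p) ≡ v →
    ∃₂ λ m (q : Vec E (suc m)) → IsPath q × Vec.head q ≡ Vec.head p × r (Vec.last q) ≡ v × VecAll.All (λ e → v ≢ r e)
      (Vec.init q)
  firstArrival v (e ∷ [])    _               eq = 0 , e ∷ [] , [-] , ≡.refl , eq , []
  firstArrival v (e ∷ f ∷ p) (re≡sf ∷ isPath) eq with r e ≟ v
  ... | yes re≡v = 0 , e ∷ [] , [-] , ≡.refl , re≡v , []
  ... | no re≢v with firstArrival v (f ∷ p) isPath eq
  ... | m , g ∷ q , isPath′ , ≡.refl , eq′ , distinct =
    suc m , e ∷ g ∷ q , re≡sf ∷ isPath′ , ≡.refl , eq′ , (re≢v ∘ ≡.sym) ∷ distinct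

  -- The exit `f` starts at `v`, and a path leads from its range back to `v`. Cut at the first
  -- arrival, `f` and this path form a return path that starts with `f` and so differs from the
  -- loop.
  stronglyConnected⇒¬P : StronglyConnected D → ¬ Eclosing D
  stronglyConnected⇒¬P sc a with Eclosing.exit a | Eclosing.isReturn a
  ... | here (f , f≢loop , sf≡sloop) | (_ , rloop≡sloop) , _ , rloop≡v = go (sc (r f) v)
    where
    open Eclosing a using (v; only)
    sf≡v : s f ≡ v
    sf≡v = ≡.trans sf≡sloop (≡.trans (≡.sym rloop≡sloop) rloop≡v)
    notReturn : ∀ {n} (p : Vec E (suc n)) → Vec.head p ≡ f → ¬ IsReturnPathAt v (n , p)
    notReturn p head≡f isReturn with only (_ , p) isReturn
    ... | ≡.refl = f≢loop (≡.sym head≡f)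
    go : r f ≡ v ⊎ (∃₂ λ n (p : Vec E (suc n)) → IsPath p × s (Vec.head p) ≡ r f × r (Vec.last p) ≡ v) → ⊥
    go (inj₁ rf≡v) = notReturn (f ∷ []) ≡.refl (([-] , ≡.trans rf≡v (≡.sym sf≡v)) , [] , rf≡v)
    go (inj₂ (_ , p , isPath , eq , eq′)) with firstArrival v (f ∷ p) (≡.sym eq ∷ isPath) eq′
    ... | m , q , isPath′ , head≡f , last≡v , distinct =
      notReturn q head≡f ((isPath′ , ≡.trans last≡v (≡.trans (≡.sym sf≡v) (≡.cong s (≡.sym head≡f)))) ,
        ≡.subst (λ w → VecAll.All (λ e → w ≢ r e) (Vec.init q)) (≡.sym last≡v) distinct , last≡v)

-- Assembly of the claims

∈All : ∀ {X μ} → DoesNotPreserve StronglyConnected X μ → DoesNotPreserve AllDigraphs X μ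
∈All (D , D′ , _ , _ , step , ¬≋) = D , D′ , tt , tt , step , ¬≋

changes-A⇒changes-L : ∀ {𝒞 μ} → DoesNotPreserve 𝒞 Spec-A μ → DoesNotPreserve 𝒞 Spec-L μ
changes-A⇒changes-L (D , D′ , D∈𝒞 , D′∈𝒞 , step , ¬≋) = D , D′ , D∈𝒞 , D′∈𝒞 , step , λ L≋L′ → ¬≋
  (≋-trans {Spec-A D} {Spec-L D} {Spec-A D′} (Spec-A≋Spec-L D)
    (≋-trans {Spec-L D} {Spec-L D′} {Spec-A D′} L≋L′ (≋-sym {Spec-A D′} {Spec-L D′} (Spec-A≋Spec-L D′))))

module _ (𝒞 : FiniteDigraph → Set) where
  splits-preserve-L : All (Preserves 𝒞 Spec-L) (O ∷ I ∷ [])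
  splits-preserve-L = O-preserves-L 𝒞 ∷ I-preserves-L 𝒞 ∷ []

  splits-preserve-A : All (Preserves 𝒞 Spec-A) (O ∷ I ∷ [])
  splits-preserve-A = preserves-L⇒preserves-A 𝒞 (O-preserves-L 𝒞) ∷ preserves-L⇒preserves-A 𝒞 (I-preserves-L 𝒞) ∷ []

  C-preserves-S : Preserves 𝒞 Spec-S C
  C-preserves-S D D′ _ _ (a , iso) = splice-Spec-S D D′ a iso

  C-preserves-Sb : Preserves 𝒞 Spec-Sb C
  C-preserves-Sb D D′ _ _ (a , iso) = splice-Spec-Sb D D′ a iso

  C-preserves-ΔS : Preserves 𝒞 Spec-ΔS C
  C-preserves-ΔS D D′ _ _ (a , iso) = splice-Spec-ΔS D D′ a iso

  C-preserves-ΔbS : Preserves 𝒞 Spec-ΔbS C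
  C-preserves-ΔbS D D′ _ _ (a , iso) = splice-Spec-ΔbS D D′ a iso

theorem1p1 : ((All (Preserves AllDigraphs Spec-A) (S ∷ O ∷ I ∷ [])
    × All (DoesNotPreserve AllDigraphs Spec-A) (R ∷ C ∷ P ∷ []))
    × (All (Preserves AllDigraphs Spec-L) (S ∷ O ∷ I ∷ [])
    × All (DoesNotPreserve AllDigraphs Spec-L) (R ∷ C ∷ P ∷ []))
    × (All (Preserves AllDigraphs Spec-Ab) (S ∷ [])
    × All (DoesNotPreserve AllDigraphs Spec-Ab) (R ∷ O ∷ I ∷ C ∷ P ∷ []))
    × All (λ X → Preserves AllDigraphs X C
    × All (DoesNotPreserve AllDigraphs X) (S ∷ R ∷ O ∷ I ∷ P ∷ []))
    (Spec-S ∷ Spec-Sb ∷ Spec-ΔS ∷ Spec-ΔbS ∷ [])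
    × All (λ X → All (DoesNotPreserve AllDigraphs X) (S ∷ R ∷ O ∷ I ∷ C ∷ P ∷ []))
    (Spec-Δ ∷ SymSpec-A ∷ SymSpec-Ab ∷ Spec-H ∷ []))
    ×
    ((∀ D → StronglyConnected D → ¬ Admissible S D × ¬ Admissible P D)
    × (All (Preserves StronglyConnected Spec-A) (O ∷ I ∷ [])
    × All (DoesNotPreserve StronglyConnected Spec-A) (R ∷ C ∷ []))
    × (All (Preserves StronglyConnected Spec-L) (O ∷ I ∷ [])
    × All (DoesNotPreserve StronglyConnected Spec-L) (R ∷ C ∷ []))
    × All (DoesNotPreserve StronglyConnected Spec-Ab) (R ∷ O ∷ I ∷ C ∷ [])
    × All (λ X → Preserves StronglyConnected X C
    × All (DoesNotPreserve StronglyConnected X) (R ∷ O ∷ I ∷ []))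
    (Spec-S ∷ Spec-Sb ∷ Spec-ΔS ∷ Spec-ΔbS ∷ [])
    × All (λ X → All (DoesNotPreserve StronglyConnected X) (R ∷ O ∷ I ∷ C ∷ []))
    (Spec-Δ ∷ SymSpec-A ∷ SymSpec-Ab ∷ Spec-H ∷ [])
    × All (λ X → All (DoesNotPreserve StronglyConnected X) (R ∷ O ∷ I ∷ C ∷ []))
    (Spec-ΔN ∷ Spec-ΔbN ∷ Spec-ΔC ∷ Spec-ΔbC ∷ []))
theorem1p1 =
  ( ( preserves-L⇒preserves-A AllDigraphs
      (S-preserves-L AllDigraphs) ∷ splits-preserve-A AllDigraphs , ∈All R-A ∷ ∈All C-A ∷ P-A ∷ [] )
  , ( S-preserves-L AllDigraphs ∷ splits-preserve-L AllDigraphs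
    , changes-A⇒changes-L (∈All R-A) ∷ changes-A⇒changes-L (∈All C-A) ∷ changes-A⇒changes-L P-A ∷ [] )
  , ( S-preserves-Ab AllDigraphs ∷ [] , ∈All R-Ab ∷ ∈All O-Ab ∷ ∈All I-Ab ∷ ∈All C-Ab ∷ P-Ab ∷ [] )
  , ( (C-preserves-S AllDigraphs , S-S ∷ ∈All R-S ∷ ∈All O-S ∷ ∈All I-S ∷ P-S ∷ [])
    ∷ (C-preserves-Sb AllDigraphs , S-Sb ∷ ∈All R-Sb ∷ ∈All O-Sb ∷ ∈All I-Sb ∷ P-Sb ∷ [])
    ∷ (C-preserves-ΔS AllDigraphs , S-ΔS ∷ ∈All R-ΔS ∷ ∈All O-ΔS ∷ ∈All I-ΔS ∷ P-ΔS ∷ [])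
    ∷ (C-preserves-ΔbS AllDigraphs , S-ΔbS ∷ ∈All R-ΔbS ∷ ∈All O-ΔbS ∷ ∈All I-ΔbS ∷ P-ΔbS ∷ [])
    ∷ [] )
  , ( (S-Δ ∷ ∈All R-Δ ∷ ∈All O-Δ ∷ ∈All I-Δ ∷ ∈All C-Δ ∷ P-Δ ∷ [])
    ∷ (S-SA ∷ ∈All R-SA ∷ ∈All O-SA ∷ ∈All I-SA ∷ ∈All C-SA ∷ P-SA ∷ [])
    ∷ (S-SAb ∷ ∈All R-SAb ∷ ∈All O-SAb ∷ ∈All I-SAb ∷ ∈All C-SAb ∷ P-SAb ∷ [])
    ∷ (S-H ∷ ∈All R-H ∷ ∈All O-H ∷ ∈All I-H ∷ ∈All C-H ∷ P-H ∷ [])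
    ∷ [] ) )
  , (λ D sc → stronglyConnected⇒¬S D sc , stronglyConnected⇒¬P D sc)
  , ( splits-preserve-A StronglyConnected , R-A ∷ C-A ∷ [] )
  , ( splits-preserve-L StronglyConnected , changes-A⇒changes-L R-A ∷ changes-A⇒changes-L C-A ∷ [] )
  , ( R-Ab ∷ O-Ab ∷ I-Ab ∷ C-Ab ∷ [] )
  , ( (C-preserves-S StronglyConnected , R-S ∷ O-S ∷ I-S ∷ [])
    ∷ (C-preserves-Sb StronglyConnected , R-Sb ∷ O-Sb ∷ I-Sb ∷ [])
    ∷ (C-preserves-ΔS StronglyConnected , R-ΔS ∷ O-ΔS ∷ I-ΔS ∷ [])
    ∷ (C-preserves-ΔbS StronglyConnected , R-ΔbS ∷ O-ΔbS ∷ I-ΔbS ∷ [])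
    ∷ [] )
  , ( (R-Δ ∷ O-Δ ∷ I-Δ ∷ C-Δ ∷ [])
    ∷ (R-SA ∷ O-SA ∷ I-SA ∷ C-SA ∷ [])
    ∷ (R-SAb ∷ O-SAb ∷ I-SAb ∷ C-SAb ∷ [])
    ∷ (R-H ∷ O-H ∷ I-H ∷ C-H ∷ [])
    ∷ [] )
  , ( (R-ΔN ∷ O-ΔN ∷ I-ΔN ∷ C-ΔN ∷ [])
    ∷ (R-ΔbN ∷ O-ΔbN ∷ I-ΔbN ∷ C-ΔbN ∷ [])
    ∷ (R-ΔC ∷ O-ΔC ∷ I-ΔC ∷ C-ΔC ∷ [])
    ∷ (R-ΔbC ∷ O-ΔbC ∷ I-ΔbC ∷ C-ΔbC ∷ [])
    ∷ [] )
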